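{- Let $p>3$ be a prime and $l$ an even integer with $0<l<p-1$. Then \[ T_{p,l}(s)\equiv\zeta_{p,l}(s)\pmod{p\mathbb{Z}_p}\quad\text{for all } s\in\mathbb{Z}_p, \] and, if $l\ne2$, $\Delta_{T_{p,l}}\equiv2\Delta_{\zeta_{p,l}}\pmod{p\mathbb{Z}_p}$. Moreover, $T_{p,l}(0)\in\mathbb{Z}_p^*$ if and only if $\zeta_{p,l}(0)\in\mathbb{Z}_p^*$, and $T_{p,l}\in\mathcal{W}^0_{p,2}$ if and only if $\zeta_{p,l}\in\mathcal{W}^0_{p,2}$.
   Context: For $a\in\mathbb{Z}_p^*$ let $q(a)=(a^{p-1}-1)/p$ and $u(a)=a^{p-1}\in1+p\mathbb{Z}_p$, with $u(a)^s=\sum_{k\ge0}(u(a)-1)^k\binom{s}{k}$ for $s\in\mathbb{Z}_p$. Define $T_{p,l}(s)=\sum_{a=1}^{p-1}a^l\,q(a)\,u(a)^s$. Let $B_n$ be the Bernoulli numbers ($z/(e^z-1)=\sum B_nz^n/n!$), so $\zeta(1-n)=-B_n/n$ for $n\ge2$. Let $\zeta_{p,l}$ be the unique continuous function $\mathbb{Z}_p\to\mathbb{Z}_p$ with $\zeta_{p,l}(s)=-(1-p^{n-1})B_n/n$ for $n=l+s(p-1)$, $s\in\mathbb{N}_0$ (this function exists and lies in $\mathcal{K}_{p,2}$). Let $\Delta^n f(s)=\sum_{k=0}^n\binom{n}{k}(-1)^{n-k}f(s+k)$; $\mathcal{K}_{p,2}$ is the set of $f:\mathbb{Z}_p\to\mathbb{Z}_p$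 with $\Delta^n f(s)\equiv0\pmod{p^n}$ for all $s$, $n\ge0$; for $f\in\mathcal{K}_{p,2}$, $\Delta_f(n)=\Delta^nf(0)/p^n$, and $\Delta_f$ is the integer in $[0,p)$ congruent to $\Delta_f(1)$ mod $p$. $\mathcal{W}^0_{p,2}$ is the set of $f\in\mathcal{K}_{p,2}$ with $f(0)\in p\mathbb{Z}_p$ and $\Delta_f\ne0$. -}

module Defs where

open import Data.Nat as ℕ using (ℕ; zero; suc)
open import Data.Nat.Combinatorics using (_C_)
open import Data.Integer as ℤ using (ℤ; +_; -[1+_])
open import Data.Integer.Divisibility using () renaming (_∣_ to _∣ℤ_)
open import Data.Rational as ℚ using (ℚ; ↥_; ↧_)
open import Data.List using (List; []; _∷_; map; foldr; upTo)
open import Data.Vec as Vec using (Vec; []; _∷_; _∷ʳ_; lookup; tabulate)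
open import Data.Fin using (Fin; toℕ)
open import Data.Product using (Σ; ∃; _×_)
open import Relation.Nullary using (¬_)
open import Relation.Binary.PropositionalEquality using (_≢_)

sumℤ : List ℤ → ℤ
sumℤ = foldr ℤ._+_ (+ 0)

Σ≤ : ℕ → (ℕ → ℤ) → ℤ
Σ≤ n f = sumℤ (map f (upTo (suc n)))

sumℚ : ∀ {n} → Vec ℚ n → ℚ
sumℚ = Vec.foldr _ ℚ._+_ ℚ.0ℚ

-- Bernoulli numbers, z/(e^z-1) = Σ B_n z^n/n!  (so B₁ = -1/2),
-- via the recurrence  B₀ = 1,  B_m = -(1/(m+1)) Σ_{j<m} C(m+1,j) B_j.

bernoulliVec : (n : ℕ) → Vec ℚ (suc n)
bernoulliVec zero = ℚ.1ℚ ∷ []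
bernoulliVec (suc n) = bs ∷ʳ next
  where
  bs = bernoulliVec n
  next : ℚ
  next = ℚ.- ((+ 1 ℚ./ suc (suc n)) ℚ.*
           sumℚ (tabulate (λ (j : Fin (suc n)) →
                   ((+ (suc (suc n) C toℕ j)) ℚ./ 1) ℚ.* lookup bs j)))

bernoulli : ℕ → ℚ
bernoulli n = Vec.last (bernoulliVec n)

-- 1/n as a rational (only used for n ≥ 2; 1/0 := 0 is a junk value)
recipℕ : ℕ → ℚ
recipℕ zero = ℚ.0ℚ
recipℕ (suc m) = + 1 ℚ./ suc m

zetaValue : (p l s : ℕ) → ℚ
zetaValue p l s =
  ℚ.- ((ℚ.1ℚ ℚ.- (+ (p ℕ.^ (n ℕ.∸ 1)) ℚ./ 1)) ℚ.* bernoulli n ℚ.* recipℕ n)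
  where
  n = l ℕ.+ s ℕ.* (p ℕ.∸ 1)

-- p-adic integers, represented by sequences of integers x₀,x₁,x₂,…
-- with x_{k+1} ≡ x_k (mod p^k); x_k is the residue of x mod p^k.

Seq : Set
Seq = ℕ → ℤ

CongMod : ℕ → ℕ → Seq → Seq → Set
CongMod p k x y = (+ (p ℕ.^ k)) ∣ℤ (x k ℤ.- y k)

IsZp : ℕ → Seq → Set
IsZp p x = ∀ k → (+ (p ℕ.^ k)) ∣ℤ (x (suc k) ℤ.- x k)

_≈[_]_ : Seq → ℕ → Seq → Set
x ≈[ p ] y = ∀ k → CongMod p k x y

ι : ℤ → Seq
ι n _ = n

ιℕ : ℕ → Seq
ιℕ n = ι (+ n)

_+Z_ : Seq → Seq → Seq
(x +Z y) k = x k ℤ.+ y k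

-- x ∈ Z_p equals the rational r (with p ∤ denominator)
EqRat : ℕ → Seq → ℚ → Set
EqRat p x r = ∀ k → (+ (p ℕ.^ k)) ∣ℤ ((↧ r) ℤ.* x k ℤ.- ↥ r)

IsUnit : ℕ → Seq → Set
IsUnit p x = ¬ ((+ p) ∣ℤ x 1)

IsZpFun : ℕ → (Seq → Seq) → Set
IsZpFun p f =
  (∀ s → IsZp p s → IsZp p (f s)) ×
  (∀ s t → IsZp p s → IsZp p t → s ≈[ p ] t → f s ≈[ p ] f t)

IsContinuous : ℕ → (Seq → Seq) → Set
IsContinuous p f =
  ∀ s → IsZp p s → ∀ k → ∃ λ m → ∀ t → IsZp p t →
    CongMod p m s t → CongMod p k (f s) (f t)

signPow : ℕ → ℤ
signPow zero = + 1
signPow (suc j) = ℤ.- signPow j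

binomℤ : ℤ → ℕ → ℤ
binomℤ (+ n) j = + (n C j)
binomℤ -[1+ m ] j = signPow j ℤ.* + ((m ℕ.+ j) C j)

-- binom(s, j) ∈ Z_p for s ∈ Z_p : its residue mod p^k is determined by
-- s mod p^{k+j} (since v_p(j!) ≤ j).
binomZp : Seq → ℕ → Seq
binomZp s j k = binomℤ (s (k ℕ.+ j)) j

-- u^s = Σ_{j≥0} (u-1)^j binom(s, j)  for u ∈ 1 + pZ (u an integer);
-- modulo p^k the terms with j > k vanish.
powZp : ℤ → Seq → Seq
powZp u s k = Σ≤ k (λ j → ((u ℤ.- + 1) ℤ.^ j) ℤ.* binomZp s j k)

divℕ : ℕ → ℕ → ℕ
divℕ m zero = 0
divℕ m (suc d) = m ℕ./ suc d

fermatQ : ℕ → ℕ → ℤ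
fermatQ p a = + divℕ (a ℕ.^ (p ℕ.∸ 1) ℕ.∸ 1) p

uPow : ℕ → ℕ → ℤ
uPow p a = + (a ℕ.^ (p ℕ.∸ 1))

T : ℕ → ℕ → Seq → Seq
T p l s k =
  sumℤ (map (λ i → let a = suc i in
                 + (a ℕ.^ l) ℤ.* fermatQ p a ℤ.* powZp (uPow p a) s k)
            (upTo (p ℕ.∸ 1)))

Δ^ : ℕ → (Seq → Seq) → Seq → Seq
Δ^ n f s i = Σ≤ n (λ k → + (n C k) ℤ.* signPow (n ℕ.∸ k) ℤ.* f (s +Z ιℕ k) i)

InK : ℕ → (Seq → Seq) → Set
InK p f = IsZpFun p f ×
  (∀ s → IsZp p s → ∀ n → CongMod p n (Δ^ n f s) (ι (+ 0)))

divℤ : ℤ → ℕ → ℤ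
divℤ x zero = + 0
divℤ x (suc d) = x ℤ./ℕ suc d

modℤ : ℤ → ℕ → ℕ
modℤ x zero = 0
modℤ x (suc d) = x ℤ.%ℕ suc d

-- Δ_f : the integer in [0,p) congruent to Δ_f(1) = Δ^1 f(0)/p mod p
-- (computed from the residue of Δ^1 f(0) mod p²).
Δdigit : ℕ → (Seq → Seq) → ℕ
Δdigit p f = modℤ (divℤ (Δ^ 1 f (ιℕ 0) 2) p) p

InW0 : ℕ → (Seq → Seq) → Set
InW0 p f = InK p f × CongMod p 1 (f (ιℕ 0)) (ι (+ 0)) × Δdigit p f ≢ 0

{-# OPTIONS --safe #-}

-- Let S m M = Σ_{a<M} a^m.  The recursion (n+1) S n M = M^(n+1) - Σ_{j<n} C(n+1,j) S j M is the Bernoulli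
-- recursion up to its first term, so S n M / M tends to B_n as M = p^N tends to 0 in Z_p.  Permuting the
-- residues prime to p by a unit c turns this into Voronoi's formula: with n = l + s(p-1), the value
-- -(c^n - 1) ζ(s) is the limit of Σ ⌊ca/p^N⌋ (ca)^(n-1), summed over a < p^N prime to p.  Its differences
-- in s carry factors (ca)^(p-1) - 1, whence the Kummer congruences, that is ζ ∈ K.
-- On the other side p q(a) = u(a) - 1 gives p Σ a^l q(a) u(a)^s = S n′ p - S n p with n′ = n + p - 1, and
-- S n p ≡ p B_n modulo p² (modulo p³ if l ≠ 2), because S n (p M) ≡ p S n M to that relative precision.
-- So Σ a^l q(a) u(a)^s ≡ n ζ(s) - n′ ζ(s+1) modulo p (modulo p²), and the Kummer congruences of order one
-- and two finish the proof.

module Submission where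

open import Defs
open import Data.Nat as ℕ using (ℕ; zero; suc; z≤n; s≤s; _<_; _∸_)
import Data.Nat.Properties as ℕ
import Data.Nat.DivMod as ℕ
import Data.Nat.Divisibility as ℕ
open import Data.Nat.Combinatorics using (_C_; nCk+nC[k+1]≡[n+1]C[k+1]; k>n⇒nCk≡0; nC1≡n; nCn≡1)
open import Data.Nat.Induction using (<-rec)
open import Data.Nat.Primality using (Prime; euclidsLemma; prime⇒nonZero; prime⇒nonTrivial; prime⇒irreducible)
open import Data.Integer as ℤ using (ℤ; +_; -[1+_]; _+_; _*_; _-_; -_; _^_)
import Data.Integer.Properties as ℤ
import Data.Integer.DivMod as ℤ
open import Data.Integer.Divisibility using () renaming (_∣_ to _∣ℤ_)
open import Data.Integer.Divisibility.Signed as Signed using (_∣_; divides)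
open import Data.Integer.Tactic.RingSolver using (solve-∀)
open import Data.Rational as ℚ using (ℚ; ↥_; ↧_; 1ℚ)
import Data.Rational.Properties as ℚ
import Data.Rational.Solver as ℚ
import Data.Rational.Unnormalised as ℚᵘ
import Data.Rational.Unnormalised.Properties as ℚᵘ
open import Data.Fin as Fin using (Fin; toℕ; fromℕ<)
import Data.Fin.Properties as Fin
open import Data.Fin.Permutation using (permutation)
open import Data.Fin.Relation.Unary.Top using (view; ‵fromℕ; ‵inject₁)
open import Data.List using (map; upTo; applyUpTo)
open import Data.Vec as Vec using (Vec; []; _∷_; _∷ʳ_; lookup; tabulate)
import Data.Vec.Properties as Vec
open import Data.Product using (∃; _×_; _,_; proj₁; proj₂)
open import Data.Sum using (_⊎_; inj₁; inj₂; [_,_]′)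
open import Function using (_∘_)
open import Function.Bundles using (_⇔_; mk⇔; module Equivalence)
open import Relation.Nullary using (¬_; yes; no; contradiction)
open import Relation.Binary.Bundles using (Setoid)
open import Relation.Binary.PropositionalEquality hiding ([_])
import Algebra.Properties.Semiring.Sum as Sum
import Relation.Binary.Reasoning.Setoid as SetoidReasoning

-- Congruences

-- Denominators shape the proof. `B_n` enters as a pair `D`, `E` with `D B_n = E`, where `p` may
-- divide `D`, and the values of ζ enter through `EqRat`, which fixes only denominator times value.
-- Cancelling a positive integer `d` costs at most `d` p-adic digits; the loss is harmless because
-- the range `p^N` of the power sums is chosen after `D`. The exceptional role of `l = 2` comes from
-- comparing `S n (p M)` with `p S n M`. The error terms are products of `S 1 p`, `S 2 p` or
-- `S 3 p`, all divisible by `p`, with lower power sums up to `M`. The extra digit for `l ≠ 2` comes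
-- from `p²` dividing `S (n-1) p`. By reflection this follows from `p` dividing `S (n-2) p`, which
-- can fail for `l = 2`, as `n - 2` is then a multiple of `p - 1`. The claim on W⁰ survives because
-- for `l = 2` the value ζ(0) is a unit, so neither function lies in W⁰.

infix 4 _≋_[_]

-- Solved for `a`, so that matching on `refl` eliminates `a` and closure under the ring operations
-- becomes a ring identity in the quotients.
record _≋_[_] (a b m : ℤ) : Set where
  constructor by
  field
    quotient : ℤ
    equality : a ≡ b + quotient * m

≋⇒∣ : ∀ {a b m} → a ≋ b [ m ] → m ∣ a - b
≋⇒∣ {b = b} {m} (by q refl) = divides q (lem b (q * m))
  where
  lem : ∀ b x → (b + x) - b ≡ x
  lem = solve-∀

∣⇒≋ : ∀ {a b m} → m ∣ a - b → a ≋ b [ m ]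
∣⇒≋ {a} {b} {m} (divides q eq) = by q (trans (lem a b) (cong (λ x → b + x) eq))
  where
  lem : ∀ a b → a ≡ b + (a - b)
  lem = solve-∀

∣⇒≋0 : ∀ {a m} → m ∣ a → a ≋ + 0 [ m ]
∣⇒≋0 {a} d = ∣⇒≋ (subst (_ ∣_) (sym (ℤ.+-identityʳ a)) d)

≋0⇒∣ : ∀ {a m} → a ≋ + 0 [ m ] → m ∣ a
≋0⇒∣ {a} c = subst (_ ∣_) (ℤ.+-identityʳ a) (≋⇒∣ c)

≋-reflexive : ∀ {a b m} → a ≡ b → a ≋ b [ m ]
≋-reflexive {a} refl = by (+ 0) (sym (ℤ.+-identityʳ a))

≋-refl : ∀ {a m} → a ≋ a [ m ]
≋-refl = ≋-reflexive refl

≋-sym : ∀ {a b m} → a ≋ b [ m ] → b ≋ a [ m ]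
≋-sym {b = b} {m} (by q refl) = by (- q) (lem b q m)
  where
  lem : ∀ b q m → b ≡ (b + q * m) + (- q) * m
  lem = solve-∀

≋-trans : ∀ {a b c m} → a ≋ b [ m ] → b ≋ c [ m ] → a ≋ c [ m ]
≋-trans {c = c} {m} (by q refl) (by r refl) = by (r + q) (lem c q r m)
  where
  lem : ∀ c q r m → (c + r * m) + q * m ≡ c + (r + q) * m
  lem = solve-∀

≋-+ : ∀ {a b c d m} → a ≋ b [ m ] → c ≋ d [ m ] → a + c ≋ b + d [ m ]
≋-+ {b = b} {d = d} {m} (by q refl) (by r refl) = by (q + r) (lem b d q r m)
  where
  lem : ∀ b d q r m → (b + q * m) + (d + r * m) ≡ (b + d) + (q + r) * m
  lem = solve-∀

≋-neg : ∀ {a b m} → a ≋ b [ m ] → - a ≋ - b [ m ]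
≋-neg {b = b} {m} (by q refl) = by (- q) (lem b q m)
  where
  lem : ∀ b q m → - (b + q * m) ≡ - b + (- q) * m
  lem = solve-∀

≋-- : ∀ {a b c d m} → a ≋ b [ m ] → c ≋ d [ m ] → a - c ≋ b - d [ m ]
≋-- p q = ≋-+ p (≋-neg q)

≋-* : ∀ {a b c d m} → a ≋ b [ m ] → c ≋ d [ m ] → a * c ≋ b * d [ m ]
≋-* {b = b} {d = d} {m} (by q refl) (by r refl) = by (b * r + q * d + q * r * m) (lem b d q r m)
  where
  lem : ∀ b d q r m → (b + q * m) * (d + r * m) ≡ b * d + (b * r + q * d + q * r * m) * m
  lem = solve-∀

≋-*ˡ : ∀ {a b m} x → a ≋ b [ m ] → x * a ≋ x * b [ m ]
≋-*ˡ x = ≋-* (≋-refl {x})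

≋-*ʳ : ∀ {a b m} x → a ≋ b [ m ] → a * x ≋ b * x [ m ]
≋-*ʳ x p = ≋-* p (≋-refl {x})

≋-^ : ∀ {a b m} n → a ≋ b [ m ] → a ^ n ≋ b ^ n [ m ]
≋-^ zero    p = ≋-refl
≋-^ (suc n) p = ≋-* p (≋-^ n p)

≋-∣ : ∀ {a b m m′} → m′ ∣ m → a ≋ b [ m ] → a ≋ b [ m′ ]
≋-∣ d p = ∣⇒≋ (Signed.∣-trans d (≋⇒∣ p))

≋-scale : ∀ {a b m} x → a ≋ b [ m ] → x * a ≋ x * b [ x * m ]
≋-scale {b = b} {m} x (by q refl) = by q (lem x b q m)
  where
  lem : ∀ x b q m → x * (b + q * m) ≡ x * b + q * (x * m)
  lem = solve-∀

≋-unscale : ∀ {a b m} x .{{_ : ℤ.NonZero x}} → x * a ≋ x * b [ x * m ] → a ≋ b [ m ]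
≋-unscale {a} {b} {m} x p = ∣⇒≋ (Signed.*-cancelˡ-∣ x (subst (x * m ∣_) (lem x a b) (≋⇒∣ p)))
  where
  lem : ∀ x a b → x * a - x * b ≡ x * (a - b)
  lem = solve-∀

≋-shift : ∀ {a b c m} → a ≋ b + c [ m ] → c ≋ + 0 [ m ] → a ≋ b [ m ]
≋-shift {b = b} p q = ≋-trans p (≋-trans (≋-+ (≋-refl {b}) q) (≋-reflexive (ℤ.+-identityʳ b)))

≋0-*ˡ : ∀ {a m} x → a ≋ + 0 [ m ] → x * a ≋ + 0 [ m ]
≋0-*ˡ x p = ≋-trans (≋-*ˡ x p) (≋-reflexive (ℤ.*-zeroʳ x))

≋0-*ʳ : ∀ {a m} x → a ≋ + 0 [ m ] → a * x ≋ + 0 [ m ]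
≋0-*ʳ x p = ≋-trans (≋-*ʳ x p) (≋-reflexive (ℤ.*-zeroˡ x))

-≋0⇒≋ : ∀ {a b m} → a - b ≋ + 0 [ m ] → a ≋ b [ m ]
-≋0⇒≋ p = ∣⇒≋ (≋0⇒∣ p)

≋⇒-≋0 : ∀ {a b m} → a ≋ b [ m ] → a - b ≋ + 0 [ m ]
≋⇒-≋0 p = ∣⇒≋0 (≋⇒∣ p)

≋-setoid : ℤ → Setoid _ _
≋-setoid m = record
  { Carrier = ℤ
  ; _≈_ = λ a b → a ≋ b [ m ]
  ; isEquivalence = record { refl = ≋-refl ; sym = ≋-sym ; trans = ≋-trans }
  }

module ≋-Reasoning (m : ℤ) = SetoidReasoning (≋-setoid m)

pos-^ : ∀ a n → + (a ℕ.^ n) ≡ (+ a) ^ n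
pos-^ a zero    = refl
pos-^ a (suc n) = trans (ℤ.pos-* a (a ℕ.^ n)) (cong (λ x → + a * x) (pos-^ a n))

^-distribʳ-* : ∀ a b n → (a * b) ^ n ≡ a ^ n * b ^ n
^-distribʳ-* a b zero    = refl
^-distribʳ-* a b (suc n) = trans (cong (λ x → a * b * x) (^-distribʳ-* a b n)) (lem a b (a ^ n) (b ^ n))
  where
  lem : ∀ a b x y → a * b * (x * y) ≡ (a * x) * (b * y)
  lem = solve-∀

^-∣ : ∀ a {m n} → m ℕ.≤ n → a ^ m ∣ a ^ n
^-∣ a {m} {n} m≤n = divides (a ^ (n ℕ.∸ m))
  (trans (cong (λ x → a ^ x) (sym (ℕ.m∸n+n≡m m≤n))) (ℤ.^-distribˡ-+-* a (n ℕ.∸ m) m))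

^-NonZero : ∀ a n .{{_ : ℤ.NonZero a}} → ℤ.NonZero (a ^ n)
^-NonZero a zero = _
^-NonZero a (suc n) = ℤ.i*j≢0 a (a ^ n) {{it}} {{^-NonZero a n}}
  where
  it : {{ℤ.NonZero a}} → ℤ.NonZero a
  it {{x}} = x

-- Finite sums

open Sum ℤ.+-*-semiring using (sum; ∑-distrib-+; ∑-comm; sum-permute; *-distribˡ-sum; sum-cong-≗)

Σ< : ℕ → (ℕ → ℤ) → ℤ
Σ< n f = sum (λ (i : Fin n) → f (toℕ i))

Σ-cong< : ∀ n {f g : ℕ → ℤ} → (∀ i → i ℕ.< n → f i ≡ g i) → Σ< n f ≡ Σ< n g
Σ-cong< n f≗g = sum-cong-≗ (λ i → f≗g (toℕ i) (Fin.toℕ<n i))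

Σ-cong : ∀ n {f g : ℕ → ℤ} → (∀ i → f i ≡ g i) → Σ< n f ≡ Σ< n g
Σ-cong n f≗g = Σ-cong< n (λ i _ → f≗g i)

Σ-≋ : ∀ n {f g : ℕ → ℤ} {m} → (∀ i → i ℕ.< n → f i ≋ g i [ m ]) → Σ< n f ≋ Σ< n g [ m ]
Σ-≋ zero    p = ≋-refl
Σ-≋ (suc n) p = ≋-+ (p 0 (s≤s z≤n)) (Σ-≋ n (λ i i<n → p (suc i) (s≤s i<n)))

Σ-0 : ∀ n → Σ< n (λ _ → + 0) ≡ + 0
Σ-0 zero    = refl
Σ-0 (suc n) = trans (ℤ.+-identityˡ _) (Σ-0 n)

Σ-≋0 : ∀ n {f : ℕ → ℤ} {m} → (∀ i → i ℕ.< n → f i ≋ + 0 [ m ]) → Σ< n f ≋ + 0 [ m ]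
Σ-≋0 n p = ≋-trans (Σ-≋ n p) (≋-reflexive (Σ-0 n))

Σ-+ : ∀ n (f g : ℕ → ℤ) → Σ< n (λ i → f i + g i) ≡ Σ< n f + Σ< n g
Σ-+ n f g = ∑-distrib-+ {n} (λ i → f (toℕ i)) (λ i → g (toℕ i))

Σ-*ˡ : ∀ n x (f : ℕ → ℤ) → Σ< n (λ i → x * f i) ≡ x * Σ< n f
Σ-*ˡ n x f = sym (*-distribˡ-sum {n} x (λ i → f (toℕ i)))

Σ-*ʳ : ∀ n x (f : ℕ → ℤ) → Σ< n (λ i → f i * x) ≡ Σ< n f * x
Σ-*ʳ n x f = trans (Σ-cong n (λ i → ℤ.*-comm (f i) x)) (trans (Σ-*ˡ n x f) (ℤ.*-comm x (Σ< n f)))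

Σ-neg : ∀ n (f : ℕ → ℤ) → Σ< n (λ i → - f i) ≡ - Σ< n f
Σ-neg zero    f = refl
Σ-neg (suc n) f = trans (cong (λ x → - f 0 + x) (Σ-neg n (f ∘ suc))) (sym (ℤ.neg-distrib-+ (f 0) _))

Σ-- : ∀ n (f g : ℕ → ℤ) → Σ< n (λ i → f i - g i) ≡ Σ< n f - Σ< n g
Σ-- n f g = trans (Σ-+ n f (λ i → - g i)) (cong (λ x → Σ< n f + x) (Σ-neg n g))

Σ-swap : ∀ m n (f : ℕ → ℕ → ℤ) → Σ< m (λ i → Σ< n (λ j → f i j)) ≡ Σ< n (λ j → Σ< m (λ i → f i j))
Σ-swap m n f = ∑-comm {m} {n} (λ i j → f (toℕ i) (toℕ j))

Σ-const : ∀ n x → Σ< n (λ _ → x) ≡ + n * x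
Σ-const zero    x = refl
Σ-const (suc n) x = trans (cong (λ y → x + y) (Σ-const n x)) (lem x (+ n))
  where
  lem : ∀ x y → x + y * x ≡ (+ 1 + y) * x
  lem = solve-∀

Σ-++ : ∀ m n (f : ℕ → ℤ) → Σ< (m ℕ.+ n) f ≡ Σ< m f + Σ< n (λ i → f (m ℕ.+ i))
Σ-++ zero    n f = sym (ℤ.+-identityˡ _)
Σ-++ (suc m) n f = trans (cong (λ x → f 0 + x) (Σ-++ m n (f ∘ suc))) (sym (ℤ.+-assoc (f 0) _ _))

Σ-last : ∀ n (f : ℕ → ℤ) → Σ< (suc n) f ≡ Σ< n f + f n
Σ-last zero    f = ℤ.+-comm (f 0) (+ 0)
Σ-last (suc n) f = trans (cong (λ x → f 0 + x) (Σ-last n (f ∘ suc))) (sym (ℤ.+-assoc (f 0) _ _))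

Σ-blocks : ∀ k m (f : ℕ → ℤ) → Σ< (k ℕ.* m) f ≡ Σ< k (λ b → Σ< m (λ a → f (a ℕ.+ b ℕ.* m)))
Σ-blocks zero    m f = refl
Σ-blocks (suc k) m f = begin
  Σ< (m ℕ.+ k ℕ.* m) f
    ≡⟨ Σ-++ m (k ℕ.* m) f ⟩
  Σ< m f + Σ< (k ℕ.* m) (λ i → f (m ℕ.+ i))
    ≡⟨ cong₂ _+_ (Σ-cong m (λ a → cong f (sym (ℕ.+-identityʳ a)))) (Σ-blocks k m (λ i → f (m ℕ.+ i))) ⟩
  Σ< m (λ a → f (a ℕ.+ 0)) + Σ< k (λ b → Σ< m (λ a → f (m ℕ.+ (a ℕ.+ b ℕ.* m))))
    ≡⟨ cong (λ x → Σ< m (λ a → f (a ℕ.+ 0)) + x)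
         (Σ-cong k (λ b → Σ-cong m (λ a → cong f (swap m a (b ℕ.* m))))) ⟩
  Σ< m (λ a → f (a ℕ.+ 0)) + Σ< k (λ b → Σ< m (λ a → f (a ℕ.+ (m ℕ.+ b ℕ.* m)))) ∎
  where
  open ≡-Reasoning
  swap : ∀ x y z → x ℕ.+ (y ℕ.+ z) ≡ y ℕ.+ (x ℕ.+ z)
  swap x y z = trans (sym (ℕ.+-assoc x y z)) (trans (cong (ℕ._+ z) (ℕ.+-comm x y)) (ℕ.+-assoc y x z))

Σ-reverse : ∀ n (f : ℕ → ℤ) → Σ< n f ≡ Σ< n (λ i → f (n ℕ.∸ suc i))
Σ-reverse zero    f = refl
Σ-reverse (suc n) f = trans (Σ-last n f) (trans (ℤ.+-comm _ (f n)) (cong (λ x → f n + x) (Σ-reverse n f)))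

Σ-telescope : ∀ n (f : ℕ → ℤ) → Σ< n (λ i → f (suc i) - f i) ≡ f n - f 0
Σ-telescope zero    f = sym (ℤ.+-inverseʳ (f 0))
Σ-telescope (suc n) f = trans (Σ-last n (λ i → f (suc i) - f i)) (trans (cong (_+ (f (suc n) - f n)) (Σ-telescope n f)) (lem (f 0) (f n) (f (suc n))))
  where
  lem : ∀ x y z → (y - x) + (z - y) ≡ z - x
  lem = solve-∀

sumℤ-upTo : ∀ n (f : ℕ → ℤ) → sumℤ (map f (upTo n)) ≡ Σ< n f
sumℤ-upTo n f = go n (λ i → i)
  where
  go : ∀ n (g : ℕ → ℕ) → sumℤ (map f (applyUpTo g n)) ≡ Σ< n (λ i → f (g i))
  go zero    g = refl
  go (suc n) g = cong (λ x → f (g 0) + x) (go n (g ∘ suc))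

module _ {M c c′ : ℕ} .{{_ : ℕ.NonZero M}} (cc′ : (c ℕ.* c′) ℕ.% M ≡ 1 ℕ.% M) where

  private
    times : ℕ → Fin M → Fin M
    times x i = fromℕ< (ℕ.m%n<n (x ℕ.* toℕ i) M)

    undo : ∀ x y → (x ℕ.* y) ℕ.% M ≡ 1 ℕ.% M → ∀ i → times x (times y i) ≡ i
    undo x y xy i = Fin.toℕ-injective (begin
      toℕ (times x (times y i))               ≡⟨ Fin.toℕ-fromℕ< _ ⟩
      (x ℕ.* toℕ (times y i)) ℕ.% M          ≡⟨ cong (λ z → (x ℕ.* z) ℕ.% M) (Fin.toℕ-fromℕ< _) ⟩
      (x ℕ.* ((y ℕ.* toℕ i) ℕ.% M)) ℕ.% M   ≡⟨ ℕ.%-distribˡ-* x _ M ⟩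
      (x ℕ.% M ℕ.* ((y ℕ.* toℕ i) ℕ.% M ℕ.% M)) ℕ.% M
        ≡⟨ cong (λ z → (x ℕ.% M ℕ.* z) ℕ.% M) (ℕ.m%n%n≡m%n (y ℕ.* toℕ i) M) ⟩
      (x ℕ.% M ℕ.* ((y ℕ.* toℕ i) ℕ.% M)) ℕ.% M ≡⟨ ℕ.%-distribˡ-* x _ M ⟨
      (x ℕ.* (y ℕ.* toℕ i)) ℕ.% M           ≡⟨ cong (ℕ._% M) (ℕ.*-assoc x y (toℕ i)) ⟨
      (x ℕ.* y ℕ.* toℕ i) ℕ.% M             ≡⟨ ℕ.%-distribˡ-* (x ℕ.* y) (toℕ i) M ⟩
      ((x ℕ.* y) ℕ.% M ℕ.* (toℕ i ℕ.% M)) ℕ.% M ≡⟨ cong (λ z → (z ℕ.* (toℕ i ℕ.% M)) ℕ.% M) xy ⟩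
      (1 ℕ.% M ℕ.* (toℕ i ℕ.% M)) ℕ.% M      ≡⟨ ℕ.%-distribˡ-* 1 (toℕ i) M ⟨
      (1 ℕ.* toℕ i) ℕ.% M                  ≡⟨ cong (ℕ._% M) (ℕ.*-identityˡ (toℕ i)) ⟩
      toℕ i ℕ.% M                          ≡⟨ ℕ.m<n⇒m%n≡m (Fin.toℕ<n i) ⟩
      toℕ i                                ∎)
      where open ≡-Reasoning

  -- Multiplication by `c` modulo `M` is a bijection of `Fin M`, with multiplication by `c′` as its
  -- inverse.
  Σ-permute-% : ∀ f → Σ< M (λ a → f ((c ℕ.* a) ℕ.% M)) ≡ Σ< M f
  Σ-permute-% f = sym (trans
    (sum-permute (λ i → f (toℕ i))
      (permutation (times c) (times c′) (undo c c′ cc′)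
        (undo c′ c (trans (cong (ℕ._% M) (ℕ.*-comm c′ c)) cc′))))
    (sum-cong-≗ {M} (λ i → cong f (Fin.toℕ-fromℕ< (ℕ.m%n<n (c ℕ.* toℕ i) M)))))

-- Truncated binomial expansions

expand₂ : ∀ a x m → (a + x) ^ suc m ≋ a ^ suc m + + suc m * a ^ m * x [ x * x ]
expand₂ a x zero = ≋-reflexive (lem a x)
  where
  lem : ∀ a x → (a + x) * + 1 ≡ a * + 1 + + 1 * + 1 * x
  lem = solve-∀
expand₂ a x (suc m) with expand₂ a x m
... | by q eq = by (a * q + + suc m * a ^ m + q * x)
  (trans (cong (λ y → (a + x) * y) eq) (lem a x (a ^ m) (+ suc m) q))
  where
  lem : ∀ a x A s q → (a + x) * (a * A + s * A * x + q * (x * x))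
      ≡ a * (a * A) + (+ 1 + s) * (a * A) * x + (a * q + s * A + q * x) * (x * x)
  lem = solve-∀

-- The binomial coefficient C(m+2, 2), built by Pascal's rule so that each step of `expand₄` is a
-- ring identity.
quadCoeff : ℕ → ℤ
quadCoeff zero    = + 1
quadCoeff (suc m) = quadCoeff m + + suc (suc m)

-- This is C(m+2, 3) a^(m-1); the recursion avoids the exponent `m - 1` at `m = 0`.
cubicTerm : ℕ → ℤ → ℤ
cubicTerm zero    a = + 0
cubicTerm (suc m) a = a * cubicTerm m a + quadCoeff m * a ^ m

expand₄ : ∀ a x m → (a + x) ^ suc (suc m) ≋
  a ^ suc (suc m) + + suc (suc m) * a ^ suc m * x + quadCoeff m * a ^ m * (x * x) + cubicTerm m a * (x * x * x)
  [ x * x * x * x ]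
expand₄ a x zero = ≋-reflexive (lem a x)
  where
  lem : ∀ a x → (a + x) * ((a + x) * + 1)
      ≡ a * (a * + 1) + + 2 * (a * + 1) * x + + 1 * + 1 * (x * x) + + 0 * (x * x * x)
  lem = solve-∀
expand₄ a x (suc m) with expand₄ a x m
... | by q eq = by (a * q + cubicTerm m a + q * x)
  (trans (cong (λ y → (a + x) * y) eq) (lem a x (a ^ m) (+ suc (suc m)) (quadCoeff m) (cubicTerm m a) q))
  where
  lem : ∀ a x A s t c q →
      (a + x) * (a * (a * A) + s * (a * A) * x + t * A * (x * x) + c * (x * x * x) + q * (x * x * x * x))
      ≡ a * (a * (a * A)) + (+ 1 + s) * (a * (a * A)) * x + (t + s) * (a * A) * (x * x)
        + (a * c + t * A) * (x * x * x) + (a * q + c + q * x) * (x * x * x * x)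
  lem = solve-∀

-- Binomial coefficients

infixl 9 _Cℤ_
_Cℤ_ : ℕ → ℕ → ℤ
n Cℤ k = + (n C k)

Cℤ-pascal : ∀ n k → suc n Cℤ suc k ≡ n Cℤ k + n Cℤ suc k
Cℤ-pascal n k = cong +_ (sym (nCk+nC[k+1]≡[n+1]C[k+1] n k))

C-absorb : ∀ n k → suc k ℕ.* (suc n C suc k) ≡ suc n ℕ.* (n C k)
C-absorb zero zero = refl
C-absorb zero (suc k) = trans (cong (suc (suc k) ℕ.*_) (k>n⇒nCk≡0 {1} {suc (suc k)} (s≤s (s≤s z≤n))))
  (trans (ℕ.*-zeroʳ (suc (suc k))) (sym (cong (1 ℕ.*_) (k>n⇒nCk≡0 {0} {suc k} (s≤s z≤n)))))
C-absorb (suc n) zero = trans (ℕ.*-identityˡ _) (trans (nC1≡n (suc (suc n))) (sym (ℕ.*-identityʳ (suc (suc n)))))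
C-absorb (suc n) (suc k) = ℤ.+-injective (begin
  + (suc (suc k) ℕ.* (suc (suc n) C suc (suc k)))
    ≡⟨ ℤ.pos-* (suc (suc k)) (suc (suc n) C suc (suc k)) ⟩
  + suc (suc k) * (suc (suc n) Cℤ suc (suc k))
    ≡⟨ cong (+ suc (suc k) *_) (Cℤ-pascal (suc n) (suc k)) ⟩
  + suc (suc k) * (suc n Cℤ suc k + suc n Cℤ suc (suc k))
    ≡⟨ lem₁ (+ suc k) (suc n Cℤ suc k) (suc n Cℤ suc (suc k)) ⟩
  + suc k * (suc n Cℤ suc k) + + suc (suc k) * (suc n Cℤ suc (suc k)) + suc n Cℤ suc k
    ≡⟨ cong₂ (λ x y → x + y + suc n Cℤ suc k) (absorbℤ k (C-absorb n k)) (absorbℤ (suc k) (C-absorb n (suc k))) ⟩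
  + suc n * (n Cℤ k) + + suc n * (n Cℤ suc k) + suc n Cℤ suc k
    ≡⟨ cong (_+ suc n Cℤ suc k) (trans (sym (ℤ.*-distribˡ-+ (+ suc n) (n Cℤ k) (n Cℤ suc k)))
         (cong (+ suc n *_) (sym (Cℤ-pascal n k)))) ⟩
  + suc n * (suc n Cℤ suc k) + suc n Cℤ suc k
    ≡⟨ lem₂ (+ suc n) (suc n Cℤ suc k) ⟩
  + suc (suc n) * (suc n Cℤ suc k)
    ≡⟨ ℤ.pos-* (suc (suc n)) (suc n C suc k) ⟨
  + (suc (suc n) ℕ.* (suc n C suc k)) ∎)
  where
  open ≡-Reasoning
  absorbℤ : ∀ k → suc k ℕ.* (suc n C suc k) ≡ suc n ℕ.* (n C k) → + suc k * (suc n Cℤ suc k) ≡ + suc n * (n Cℤ k)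
  absorbℤ k eq = trans (sym (ℤ.pos-* (suc k) _)) (trans (cong +_ eq) (ℤ.pos-* (suc n) _))
  lem₁ : ∀ k x y → (+ 1 + k) * (x + y) ≡ k * x + (+ 1 + k) * y + x
  lem₁ = solve-∀
  lem₂ : ∀ n x → n * x + x ≡ (+ 1 + n) * x
  lem₂ = solve-∀

Σ-pascal : ∀ n (h : ℕ → ℤ) → Σ< (suc (suc n)) (λ k → suc n Cℤ k * h k) ≡
  Σ< (suc n) (λ k → n Cℤ k * h k) + Σ< (suc n) (λ k → n Cℤ k * h (suc k))
Σ-pascal n h = begin
  + 1 * h 0 + Σ< (suc n) (λ k → suc n Cℤ suc k * h (suc k))
    ≡⟨ cong (λ y → + 1 * h 0 + y) (trans (Σ-cong (suc n) split) (Σ-+ (suc n) (λ k → n Cℤ k * h (suc k)) (λ k → n Cℤ suc k * h (suc k)))) ⟩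
  + 1 * h 0 + (Y + Z)
    ≡⟨ lem (+ 1 * h 0) Y Z ⟩
  (+ 1 * h 0 + Z) + Y
    ≡⟨ cong (_+ Y) (Σ-last (suc n) (λ k → n Cℤ k * h k)) ⟩
  (X + n Cℤ suc n * h (suc n)) + Y
    ≡⟨ cong (λ c → X + + c * h (suc n) + Y) (k>n⇒nCk≡0 (ℕ.n<1+n n)) ⟩
  (X + + 0 * h (suc n)) + Y
    ≡⟨ lem₂ X (h (suc n)) Y ⟩
  X + Y ∎
  where
  open ≡-Reasoning
  X = Σ< (suc n) (λ k → n Cℤ k * h k)
  Y = Σ< (suc n) (λ k → n Cℤ k * h (suc k))
  Z = Σ< (suc n) (λ k → n Cℤ suc k * h (suc k))
  split : ∀ k → suc n Cℤ suc k * h (suc k) ≡ n Cℤ k * h (suc k) + n Cℤ suc k * h (suc k)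
  split k = trans (cong (_* h (suc k)) (Cℤ-pascal n k)) (ℤ.*-distribʳ-+ (h (suc k)) (n Cℤ k) (n Cℤ suc k))
  lem : ∀ x y z → x + (y + z) ≡ (x + z) + y
  lem = solve-∀
  lem₂ : ∀ x y z → (x + + 0 * y) + z ≡ x + z
  lem₂ = solve-∀

binomial : ∀ n a → (a + + 1) ^ n ≡ Σ< (suc n) (λ k → n Cℤ k * a ^ k)
binomial zero    a = refl
binomial (suc n) a = begin
  (a + + 1) * (a + + 1) ^ n ≡⟨ cong ((a + + 1) *_) (binomial n a) ⟩
  (a + + 1) * X             ≡⟨ lem a X ⟩
  X + a * X                 ≡⟨ cong (λ y → X + y) (sym (trans (Σ-cong (suc n) (λ k → swap (n Cℤ k) a (a ^ k))) (Σ-*ˡ (suc n) a (λ k → n Cℤ k * a ^ k)))) ⟩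
  X + Σ< (suc n) (λ k → n Cℤ k * (a * a ^ k)) ≡⟨ Σ-pascal n (a ^_) ⟨
  Σ< (suc (suc n)) (λ k → suc n Cℤ k * a ^ k) ∎
  where
  open ≡-Reasoning
  X = Σ< (suc n) (λ k → n Cℤ k * a ^ k)
  lem : ∀ a x → (a + + 1) * x ≡ x + a * x
  lem = solve-∀
  swap : ∀ x y z → x * (y * z) ≡ y * (x * z)
  swap = solve-∀

-- Power sums

S : ℕ → ℕ → ℤ
S m M = Σ< M (λ a → (+ a) ^ m)

S-0 : ∀ M → S 0 M ≡ + M
S-0 M = trans (Σ-const M (+ 1)) (ℤ.*-identityʳ (+ M))

-- The sum over `j` of C(n+1, j) a^j is (a+1)^(n+1) - a^(n+1), which telescopes over `a < M`.
S-recursion : ∀ n M → Σ< (suc n) (λ j → suc n Cℤ j * S j M) ≡ (+ M) ^ suc n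
S-recursion n M = begin
  Σ< (suc n) (λ j → suc n Cℤ j * S j M)
    ≡⟨ Σ-cong (suc n) (λ j → sym (Σ-*ˡ M (suc n Cℤ j) (λ a → (+ a) ^ j))) ⟩
  Σ< (suc n) (λ j → Σ< M (λ a → suc n Cℤ j * (+ a) ^ j))
    ≡⟨ Σ-swap (suc n) M (λ j a → suc n Cℤ j * (+ a) ^ j) ⟩
  Σ< M (λ a → Σ< (suc n) (λ j → suc n Cℤ j * (+ a) ^ j))
    ≡⟨ Σ-cong M step ⟩
  Σ< M (λ a → (+ suc a) ^ suc n - (+ a) ^ suc n)
    ≡⟨ Σ-telescope M (λ a → (+ a) ^ suc n) ⟩
  (+ M) ^ suc n - + 0
    ≡⟨ ℤ.+-identityʳ _ ⟩
  (+ M) ^ suc n ∎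
  where
  open ≡-Reasoning
  cancel : ∀ x y → x ≡ (x + + 1 * y) - y
  cancel = solve-∀
  step : ∀ a → Σ< (suc n) (λ j → suc n Cℤ j * (+ a) ^ j) ≡ (+ suc a) ^ suc n - (+ a) ^ suc n
  step a = begin
    X ≡⟨ cancel X ((+ a) ^ suc n) ⟩
    (X + + 1 * (+ a) ^ suc n) - (+ a) ^ suc n
      ≡⟨ cong (λ c → (X + + c * (+ a) ^ suc n) - (+ a) ^ suc n) (nCn≡1 (suc n)) ⟨
    (X + suc n Cℤ suc n * (+ a) ^ suc n) - (+ a) ^ suc n
      ≡⟨ cong (_- (+ a) ^ suc n) (Σ-last (suc n) (λ j → suc n Cℤ j * (+ a) ^ j)) ⟨
    Σ< (suc (suc n)) (λ j → suc n Cℤ j * (+ a) ^ j) - (+ a) ^ suc n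
      ≡⟨ cong (_- (+ a) ^ suc n) (binomial (suc n) (+ a)) ⟨
    (+ a + + 1) ^ suc n - (+ a) ^ suc n
      ≡⟨ cong (λ x → (+ x) ^ suc n - (+ a) ^ suc n) (ℕ.+-comm a 1) ⟩
    (+ suc a) ^ suc n - (+ a) ^ suc n ∎
    where
    X = Σ< (suc n) (λ j → suc n Cℤ j * (+ a) ^ j)

C-last : ∀ n → suc n C n ≡ suc n
C-last zero    = refl
C-last (suc n) = trans (sym (nCk+nC[k+1]≡[n+1]C[k+1] (suc n) n))
  (trans (cong₂ ℕ._+_ (C-last n) (nCn≡1 (suc n))) (ℕ.+-comm (suc n) 1))

S-step : ∀ n M → + suc n * S n M ≡ (+ M) ^ suc n - Σ< n (λ j → suc n Cℤ j * S j M)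
S-step n M = begin
  + suc n * S n M               ≡⟨ lem X (+ suc n * S n M) ⟩
  (X + + suc n * S n M) - X     ≡⟨ cong (λ c → (X + + c * S n M) - X) (C-last n) ⟨
  (X + suc n Cℤ n * S n M) - X  ≡⟨ cong (_- X) (trans (sym (Σ-last n (λ j → suc n Cℤ j * S j M))) (S-recursion n M)) ⟩
  (+ M) ^ suc n - X             ∎
  where
  open ≡-Reasoning
  X = Σ< n (λ j → suc n Cℤ j * S j M)
  lem : ∀ x y → y ≡ (x + y) - x
  lem = solve-∀

-- Divisibility by prime powers, Fermat's theorem, power sums modulo `p`

module _ {p : ℕ} (pr : Prime p) where

  private instance
    p≢0 : ℕ.NonZero p
    p≢0 = prime⇒nonZero pr
    pℤ≢0 : ℤ.NonZero (+ p)
    pℤ≢0 = p≢0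

  prime-∣* : ∀ a b → + p ∣ a * b → + p ∣ a ⊎ + p ∣ b
  prime-∣* a b d with euclidsLemma ℤ.∣ a ∣ ℤ.∣ b ∣ pr (subst (p ℕ.∣_) (ℤ.abs-* a b) (Signed.∣⇒∣ᵤ d))
  ... | inj₁ x = inj₁ (Signed.∣ᵤ⇒∣ x)
  ... | inj₂ x = inj₂ (Signed.∣ᵤ⇒∣ x)

  prime∤1 : ¬ (+ p ∣ + 1)
  prime∤1 d with ℕ.∣1⇒≡1 (Signed.∣⇒∣ᵤ d)
  ... | refl = ℕ.nonTrivial⇒≢1 {{prime⇒nonTrivial pr}} refl

  <p⇒∤ : ∀ {n} → 0 ℕ.< n → n ℕ.< p → ¬ (+ p ∣ + n)
  <p⇒∤ {suc n} _ n<p d = ℕ.>⇒∤ n<p (Signed.∣⇒∣ᵤ d)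

  -- Euclid's lemma moves one factor `p` at a time from the product into `b`.
  p^-cancel : ∀ k a b → ¬ (+ p ∣ a) → (+ p) ^ k ∣ a * b → (+ p) ^ k ∣ b
  p^-cancel zero    a b _   _ = divides b (sym (ℤ.*-identityʳ b))
  p^-cancel (suc k) a b p∤a d with prime-∣* a b (Signed.∣-trans (divides ((+ p) ^ k) (ℤ.*-comm (+ p) _)) d)
  ... | inj₁ p∣a = contradiction p∣a p∤a
  ... | inj₂ (divides b′ refl) = subst ((+ p) ^ suc k ∣_) (ℤ.*-comm (+ p) b′)
    (Signed.*-monoʳ-∣ (+ p) (p^-cancel k a b′ p∤a (Signed.*-cancelˡ-∣ (+ p) (subst ((+ p) ^ suc k ∣_) (lem a b′ (+ p)) d))))
    where
    lem : ∀ a b p → a * (b * p) ≡ p * (a * b)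
    lem = solve-∀

  ^-∤ : ∀ a n → ¬ (+ p ∣ a) → ¬ (+ p ∣ a ^ n)
  ^-∤ a zero    p∤a = prime∤1
  ^-∤ a (suc n) p∤a d with prime-∣* a (a ^ n) d
  ... | inj₁ x = p∤a x
  ... | inj₂ y = ^-∤ a n p∤a y

  -- The exponent of p in d is at most d.
  p^-absorb : ∀ d → .{{ℕ.NonZero d}} → ∀ k x → (+ p) ^ k ∣ + d * x → (+ p) ^ k ∣ (+ p) ^ d * x
  p^-absorb = <-rec (λ d → .{{ℕ.NonZero d}} → ∀ k x → (+ p) ^ k ∣ + d * x → (+ p) ^ k ∣ (+ p) ^ d * x) go
    where
    go : ∀ d → (∀ {e} → e ℕ.< d → .{{ℕ.NonZero e}} → ∀ k x → (+ p) ^ k ∣ + e * x → (+ p) ^ k ∣ (+ p) ^ e * x) →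
         .{{ℕ.NonZero d}} → ∀ k x → (+ p) ^ k ∣ + d * x → (+ p) ^ k ∣ (+ p) ^ d * x
    go d rec k x dvd with p ℕ.∣? d
    ... | no  p∤d = Signed.∣n⇒∣m*n ((+ p) ^ d) (p^-cancel k (+ d) x (λ y → p∤d (Signed.∣⇒∣ᵤ y)) dvd)
    ... | yes (ℕ.divides zero refl) = contradiction refl (ℕ.≢-nonZero⁻¹ d)
    ... | yes (ℕ.divides e@(suc _) refl) =
      Signed.∣-trans (rec e<d k (+ p * x) (subst ((+ p) ^ k ∣_) (trans (cong (_* x) (ℤ.pos-* e p)) (lem (+ e) (+ p) x)) dvd))
        (subst (_∣ (+ p) ^ (e ℕ.* p) * x) (lem₂ (+ p) ((+ p) ^ e) x)
          (Signed.*-monoˡ-∣ x (^-∣ (+ p) e<d)))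
      where
      e<d : e ℕ.< e ℕ.* p
      e<d = ℕ.m<m*n e p (ℕ.nonTrivial⇒n>1 p {{prime⇒nonTrivial pr}})
      lem : ∀ e p x → e * p * x ≡ e * (p * x)
      lem = solve-∀
      lem₂ : ∀ p q x → p * q * x ≡ q * (p * x)
      lem₂ = solve-∀

  -- The crude bound `v_p(d) ≤ d` is enough, since the precision `d + k` is always chosen after `d`.
  p^-cancel-loss : ∀ d → .{{ℕ.NonZero d}} → ∀ k x → (+ p) ^ (d ℕ.+ k) ∣ + d * x → (+ p) ^ k ∣ x
  p^-cancel-loss d k x dvd = Signed.*-cancelˡ-∣ ((+ p) ^ d) {{^-NonZero (+ p) d}}
    (subst (_∣ (+ p) ^ d * x) (ℤ.^-distribˡ-+-* (+ p) d k) (p^-absorb d (d ℕ.+ k) x dvd))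

  -- Absorption gives j C(p, j) = p C(p-1, j-1), and `p` does not divide `j`.
  p∣C : ∀ {j} → 0 ℕ.< j → j ℕ.< p → + p ∣ p Cℤ j
  p∣C {suc j} 0<j j<p = [ (λ x → contradiction x (<p⇒∤ 0<j j<p)) , (λ x → x) ]′
    (prime-∣* (+ suc j) (p Cℤ suc j) (divides (ℕ.pred p Cℤ j) absorb))
    where
    lem : ∀ n → + suc j * (suc n Cℤ suc j) ≡ n Cℤ j * + suc n
    lem n = trans (sym (ℤ.pos-* (suc j) (suc n C suc j)))
      (trans (cong +_ (trans (C-absorb n j) (ℕ.*-comm (suc n) (n C j)))) (ℤ.pos-* (n C j) (suc n)))
    absorb : + suc j * (p Cℤ suc j) ≡ ℕ.pred p Cℤ j * + p
    absorb = subst (λ q → + suc j * (q Cℤ suc j) ≡ ℕ.pred p Cℤ j * + q) (ℕ.suc-pred p) (lem (ℕ.pred p))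

  -- S-recursion for n + 1 = p, read modulo p, is Fermat's little theorem.
  fermat : ∀ M → (+ M) ^ p ≋ + M [ + p ]
  fermat M = aux (ℕ.pred p) (ℕ.suc-pred p)
    where
    aux : ∀ n → suc n ≡ p → (+ M) ^ p ≋ + M [ + p ]
    aux n n+1≡p = begin
      (+ M) ^ p                                ≡⟨ cong (λ q → (+ M) ^ q) n+1≡p ⟨
      (+ M) ^ suc n                            ≡⟨ S-recursion n M ⟨
      Σ< (suc n) (λ j → suc n Cℤ j * S j M)    ≈⟨ ≋-+ (≋-reflexive (trans (ℤ.*-identityˡ (S 0 M)) (S-0 M)))
                                                    (Σ-≋0 n (λ j j<n → ≋0-*ʳ (S (suc j) M) (∣⇒≋0 (vanish j j<n)))) ⟩
      + M + + 0                                ≡⟨ ℤ.+-identityʳ (+ M) ⟩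
      + M                                      ∎
      where
      open ≋-Reasoning (+ p)
      vanish : ∀ j → j ℕ.< n → + p ∣ suc n Cℤ suc j
      vanish j j<n = subst (λ q → + p ∣ q Cℤ suc j) (sym n+1≡p) (p∣C (s≤s z≤n) (subst (suc j ℕ.<_) n+1≡p (s≤s j<n)))

  fermat-unit : ∀ M → ¬ (+ p ∣ + M) → (+ M) ^ (p ℕ.∸ 1) ≋ + 1 [ + p ]
  fermat-unit M p∤M = [ (λ x → contradiction x p∤M) , ∣⇒≋ ]′
    (prime-∣* (+ M) ((+ M) ^ (p ℕ.∸ 1) - + 1) (subst (+ p ∣_) (factor (ℕ.pred p) (ℕ.suc-pred p)) (≋⇒∣ (fermat M))))
    where
    lem : ∀ m x → m * x - m ≡ m * (x - + 1)
    lem = solve-∀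
    factor : ∀ n → suc n ≡ p → (+ M) ^ p - + M ≡ + M * ((+ M) ^ (p ℕ.∸ 1) - + 1)
    factor n n+1≡p = subst (λ q → (+ M) ^ q - + M ≡ + M * ((+ M) ^ (q ℕ.∸ 1) - + 1)) n+1≡p (lem (+ M) ((+ M) ^ n))

  -- `S-step` writes (m+1) S m p as a power of `p` minus a combination of lower power sums, and
  -- `m + 1 < p` can be cancelled modulo `p`.
  S≋0 : ∀ m → suc m ℕ.< p → S m p ≋ + 0 [ + p ]
  S≋0 = <-rec (λ m → suc m ℕ.< p → S m p ≋ + 0 [ + p ]) go
    where
    go : ∀ m → (∀ {j} → j ℕ.< m → suc j ℕ.< p → S j p ≋ + 0 [ + p ]) → suc m ℕ.< p → S m p ≋ + 0 [ + p ]
    go m rec m+1<p = [ (λ x → contradiction x (<p⇒∤ (s≤s z≤n) m+1<p)) , ∣⇒≋0 ]′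
      (prime-∣* (+ suc m) (S m p) (≋0⇒∣ (≋-trans (≋-reflexive (S-step m p)) (≋-- p^≋0 Σ≋0))))
      where
      p^≋0 : (+ p) ^ suc m ≋ + 0 [ + p ]
      p^≋0 = ∣⇒≋0 (divides ((+ p) ^ m) (ℤ.*-comm (+ p) ((+ p) ^ m)))
      Σ≋0 : Σ< m (λ j → suc m Cℤ j * S j p) ≋ + 0 [ + p ]
      Σ≋0 = Σ-≋0 m (λ j j<m → ≋0-*ˡ (suc m Cℤ j) (rec j<m (ℕ.<-trans (s≤s j<m) m+1<p)))

  -- Otherwise S l p would be congruent to p - 1, against S≋0.
  nonroot : ∀ l → 0 ℕ.< l → suc l ℕ.< p → ∃ λ g → ¬ (+ p ∣ + g) × ¬ ((+ g) ^ l ≋ + 1 [ + p ])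
  nonroot l 0<l l+1<p = find (ℕ.pred p) (ℕ.suc-pred p)
    where
    0^l : ∀ {l} → 0 ℕ.< l → (+ 0) ^ l ≡ + 0
    0^l (s≤s _) = refl
    find : ∀ n → suc n ≡ p → ∃ λ g → ¬ (+ p ∣ + g) × ¬ ((+ g) ^ l ≋ + 1 [ + p ])
    find n n+1≡p = suc (toℕ i) , <p⇒∤ (s≤s z≤n) (subst (suc (toℕ i) ℕ.<_) n+1≡p (s≤s (Fin.toℕ<n i))) , λ h → proj₂ witness (≋⇒∣ h)
      where
      n<p : n ℕ.< p
      n<p = ℕ.≤-reflexive n+1≡p
      0<n : 0 ℕ.< n
      0<n = ℕ.≤-pred (ℕ.≤-trans (s≤s (s≤s z≤n)) (ℕ.≤-trans l+1<p (ℕ.≤-reflexive (sym n+1≡p))))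
      Root : Fin n → Set
      Root i = + p ∣ (+ suc (toℕ i)) ^ l - + 1
      ¬all : ¬ (∀ i → Root i)
      ¬all all = <p⇒∤ 0<n n<p (≋0⇒∣ (begin
        + n                                         ≡⟨ ℤ.*-identityʳ (+ n) ⟨
        + n * + 1                                   ≡⟨ Σ-const n (+ 1) ⟨
        Σ< n (λ _ → + 1)                            ≈⟨ Σ-≋ n {λ _ → + 1} {λ i → (+ suc i) ^ l} (λ i i<n → ≋-sym (∣⇒≋ (subst (λ j → + p ∣ (+ suc j) ^ l - + 1) (Fin.toℕ-fromℕ< i<n) (all (Fin.fromℕ< i<n))))) ⟩
        Σ< n (λ i → (+ suc i) ^ l)                  ≡⟨ ℤ.+-identityˡ _ ⟨
        + 0 + Σ< n (λ i → (+ suc i) ^ l)            ≡⟨ cong (_+ Σ< n (λ i → (+ suc i) ^ l)) (0^l 0<l) ⟨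
        S l (suc n)                                 ≡⟨ cong (S l) n+1≡p ⟩
        S l p                                       ≈⟨ S≋0 l l+1<p ⟩
        + 0                                         ∎))
        where open ≋-Reasoning (+ p)
      witness : ∃ λ i → ¬ Root i
      -- Divisibility is decidable and the range is finite, so the refutation `¬all` yields an
      -- actual non-root.
      witness = Fin.¬∀⟶∃¬ n Root (λ i → + p Signed.∣? ((+ suc (toℕ i)) ^ l - + 1)) ¬all
      i = proj₁ witness

-- (1 + qP)^(n+1) is 1 + (n+1) q P up to a multiple of P², and P² is a multiple of (n+1) P because
-- `n + 1` divides `P`. For n + 1 = p each p-th power gains a digit.
power-lift : ∀ y P n → + suc n ∣ P → y ≋ + 1 [ P ] → y ^ suc n ≋ + 1 [ + suc n * P ]
power-lift y P n (divides r refl) (by q refl) = ≋-trans (≋-∣ sq∣ (expand₂ (+ 1) (q * P) n))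
  (by q (trans (cong₂ (λ x y → x + + suc n * y * (q * P)) (ℤ.^-zeroˡ (suc n)) (ℤ.^-zeroˡ n)) (lem₁ (+ suc n) q P)))
  where
  lem₁ : ∀ s q P → + 1 + s * + 1 * (q * P) ≡ + 1 + q * (s * P)
  lem₁ = solve-∀
  lem₂ : ∀ q r s → q * (r * s) * (q * (r * s)) ≡ (q * q * r) * (s * (r * s))
  lem₂ = solve-∀
  sq∣ : + suc n * P ∣ q * P * (q * P)
  sq∣ = divides (q * q * r) (lem₂ q r (+ suc n))

module _ {p : ℕ} (pr : Prime p) where

  lift-1 : ∀ {x} k → x ≋ + 1 [ + p ] → x ^ (p ℕ.^ k) ≋ + 1 [ (+ p) ^ suc k ]
  lift-1 {x} zero    h = subst₂ (λ y m → y ≋ + 1 [ m ]) (sym (ℤ.*-identityʳ x)) (sym (ℤ.*-identityʳ (+ p))) h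
  lift-1 {x} (suc k) h = subst (λ y → y ≋ + 1 [ (+ p) ^ suc (suc k) ])
    (trans (ℤ.^-*-assoc x (p ℕ.^ k) p) (cong (λ n → x ^ n) (ℕ.*-comm (p ℕ.^ k) p)))
    (aux (ℕ.pred p) (ℕ.suc-pred p {{prime⇒nonZero pr}}))
    where
    y = x ^ (p ℕ.^ k)
    aux : ∀ n → suc n ≡ p → y ^ p ≋ + 1 [ + p * (+ p) ^ suc k ]
    aux n n+1≡p = subst (λ q → + q ∣ (+ p) ^ suc k → y ^ q ≋ + 1 [ + q * (+ p) ^ suc k ]) n+1≡p
      (λ d → power-lift y ((+ p) ^ suc k) n d (lift-1 k h)) (divides ((+ p) ^ k) (ℤ.*-comm (+ p) ((+ p) ^ k)))

-- Bernoulli numbers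

ιℚ : ℤ → ℚ
ιℚ i = i ℚ./ 1

toℚᵘ-ιℚ : ∀ i → ℚ.toℚᵘ (ιℚ i) ℚᵘ.≃ ℚᵘ.mkℚᵘ i 0
toℚᵘ-ιℚ i = ℚ.toℚᵘ-fromℚᵘ (ℚᵘ.mkℚᵘ i 0)

ιℚ-+ : ∀ i j → ιℚ (i + j) ≡ ιℚ i ℚ.+ ιℚ j
ιℚ-+ i j = ℚ.toℚᵘ-injective (begin
  ℚ.toℚᵘ (ιℚ (i + j))                    ≈⟨ toℚᵘ-ιℚ (i + j) ⟩
  ℚᵘ.mkℚᵘ (i + j) 0                      ≈⟨ ℚᵘ.*≡* (lem i j) ⟩
  ℚᵘ.mkℚᵘ i 0 ℚᵘ.+ ℚᵘ.mkℚᵘ j 0           ≈⟨ ℚᵘ.+-cong (toℚᵘ-ιℚ i) (toℚᵘ-ιℚ j) ⟨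
  ℚ.toℚᵘ (ιℚ i) ℚᵘ.+ ℚ.toℚᵘ (ιℚ j)       ≈⟨ ℚ.toℚᵘ-homo-+ (ιℚ i) (ιℚ j) ⟨
  ℚ.toℚᵘ (ιℚ i ℚ.+ ιℚ j)                 ∎)
  where
  open ℚᵘ.≃-Reasoning
  lem : ∀ i j → (i + j) * + 1 ≡ (i * + 1 + j * + 1) * + 1
  lem = solve-∀

ιℚ-* : ∀ i j → ιℚ (i * j) ≡ ιℚ i ℚ.* ιℚ j
ιℚ-* i j = ℚ.toℚᵘ-injective (begin
  ℚ.toℚᵘ (ιℚ (i * j))                    ≈⟨ toℚᵘ-ιℚ (i * j) ⟩
  ℚᵘ.mkℚᵘ (i * j) 0                      ≈⟨ ℚᵘ.≃-refl ⟩
  ℚᵘ.mkℚᵘ i 0 ℚᵘ.* ℚᵘ.mkℚᵘ j 0           ≈⟨ ℚᵘ.*-cong (toℚᵘ-ιℚ i) (toℚᵘ-ιℚ j) ⟨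
  ℚ.toℚᵘ (ιℚ i) ℚᵘ.* ℚ.toℚᵘ (ιℚ j)       ≈⟨ ℚ.toℚᵘ-homo-* (ιℚ i) (ιℚ j) ⟨
  ℚ.toℚᵘ (ιℚ i ℚ.* ιℚ j)                 ∎)
  where open ℚᵘ.≃-Reasoning

ιℚ-neg : ∀ i → ιℚ (- i) ≡ ℚ.- ιℚ i
ιℚ-neg i = ℚ.toℚᵘ-injective (begin
  ℚ.toℚᵘ (ιℚ (- i))        ≈⟨ toℚᵘ-ιℚ (- i) ⟩
  ℚᵘ.mkℚᵘ (- i) 0          ≈⟨ ℚᵘ.≃-refl ⟩
  ℚᵘ.- ℚᵘ.mkℚᵘ i 0         ≈⟨ ℚᵘ.-‿cong (toℚᵘ-ιℚ i) ⟨
  ℚᵘ.- ℚ.toℚᵘ (ιℚ i)       ≈⟨ ℚ.toℚᵘ-homo‿- (ιℚ i) ⟨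
  ℚ.toℚᵘ (ℚ.- ιℚ i)        ∎)
  where open ℚᵘ.≃-Reasoning

ιℚ-recip : ∀ m → ιℚ (+ suc m) ℚ.* (+ 1 ℚ./ suc m) ≡ 1ℚ
ιℚ-recip m = ℚ.toℚᵘ-injective (begin
  ℚ.toℚᵘ (ιℚ (+ suc m) ℚ.* (+ 1 ℚ./ suc m))          ≈⟨ ℚ.toℚᵘ-homo-* (ιℚ (+ suc m)) (+ 1 ℚ./ suc m) ⟩
  ℚ.toℚᵘ (ιℚ (+ suc m)) ℚᵘ.* ℚ.toℚᵘ (+ 1 ℚ./ suc m)  ≈⟨ ℚᵘ.*-cong (toℚᵘ-ιℚ (+ suc m)) (ℚ.toℚᵘ-fromℚᵘ (ℚᵘ.mkℚᵘ (+ 1) m)) ⟩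
  ℚᵘ.mkℚᵘ (+ suc m) 0 ℚᵘ.* ℚᵘ.mkℚᵘ (+ 1) m           ≈⟨ ℚᵘ.*≡* (lem (+ suc m)) ⟩
  ℚᵘ.1ℚᵘ                                             ∎)
  where
  open ℚᵘ.≃-Reasoning
  lem : ∀ s → s * + 1 * + 1 ≡ + 1 * (+ 1 * s)
  lem = solve-∀

-- The only passage from an equation in ℚ back to one in ℤ; numerator and denominator of the reduced
-- fraction `r` stay symbolic.
ιℚ-cross : ∀ a c r → ιℚ a ℚ.* r ≡ ιℚ c → a * ↥ r ≡ c * ↧ r
ιℚ-cross a c r@record{} eq with (begin
  ℚᵘ.mkℚᵘ a 0 ℚᵘ.* ℚ.toℚᵘ r        ≈⟨ ℚᵘ.*-congʳ {ℚ.toℚᵘ r} (toℚᵘ-ιℚ a) ⟨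
  ℚ.toℚᵘ (ιℚ a) ℚᵘ.* ℚ.toℚᵘ r      ≈⟨ ℚ.toℚᵘ-homo-* (ιℚ a) r ⟨
  ℚ.toℚᵘ (ιℚ a ℚ.* r)              ≈⟨ ℚᵘ.≃-reflexive (cong ℚ.toℚᵘ eq) ⟩
  ℚ.toℚᵘ (ιℚ c)                    ≈⟨ toℚᵘ-ιℚ c ⟩
  ℚᵘ.mkℚᵘ c 0                      ∎)
  where open ℚᵘ.≃-Reasoning
... | ℚᵘ.*≡* h = trans (sym (ℤ.*-identityʳ (a * ↥ r))) (trans h (cong (c *_) (ℤ.*-identityˡ (↧ r))))

lookup-∷ʳ-inject₁ : ∀ {A : Set} {n} (xs : Vec A n) x i → lookup (xs ∷ʳ x) (Fin.inject₁ i) ≡ lookup xs i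
lookup-∷ʳ-inject₁ (y ∷ xs) x Fin.zero    = refl
lookup-∷ʳ-inject₁ (y ∷ xs) x (Fin.suc i) = lookup-∷ʳ-inject₁ xs x i

lookup-∷ʳ-fromℕ : ∀ {A : Set} {n} (xs : Vec A n) x → lookup (xs ∷ʳ x) (Fin.fromℕ n) ≡ x
lookup-∷ʳ-fromℕ []       x = refl
lookup-∷ʳ-fromℕ (y ∷ xs) x = lookup-∷ʳ-fromℕ xs x

bernoulliNext : ℕ → ℚ
bernoulliNext n = ℚ.- ((+ 1 ℚ./ suc (suc n)) ℚ.*
  sumℚ (tabulate (λ (j : Fin (suc n)) → ιℚ (+ (suc (suc n) C toℕ j)) ℚ.* lookup (bernoulliVec n) j)))

bernoulli-suc : ∀ n → bernoulli (suc n) ≡ bernoulliNext n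
bernoulli-suc n = Vec.last-∷ʳ (bernoulliNext n) (bernoulliVec n)

lookup-bernoulliVec : ∀ n (j : Fin (suc n)) → lookup (bernoulliVec n) j ≡ bernoulli (toℕ j)
lookup-bernoulliVec zero    Fin.zero = refl
lookup-bernoulliVec (suc n) j with view j
... | ‵fromℕ     = trans (lookup-∷ʳ-fromℕ (bernoulliVec n) (bernoulliNext n))
  (trans (sym (bernoulli-suc n)) (cong bernoulli (sym (Fin.toℕ-fromℕ (suc n)))))
... | ‵inject₁ i = trans (lookup-∷ʳ-inject₁ (bernoulliVec n) (bernoulliNext n) i)
  (trans (lookup-bernoulliVec n i) (cong bernoulli (sym (Fin.toℕ-inject₁ i))))

sumℚ-ιℚ : ∀ d k (g : Fin k → ℚ) (f : ℕ → ℤ) → (∀ j → ιℚ d ℚ.* g j ≡ ιℚ (f (toℕ j))) →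
  ιℚ d ℚ.* sumℚ (tabulate g) ≡ ιℚ (Σ< k f)
sumℚ-ιℚ d zero    g f eq = ℚ.*-zeroʳ (ιℚ d)
sumℚ-ιℚ d (suc k) g f eq = trans (ℚ.*-distribˡ-+ (ιℚ d) (g Fin.zero) _)
  (trans (cong₂ ℚ._+_ (eq Fin.zero) (sumℚ-ιℚ d k (g ∘ Fin.suc) (f ∘ suc) (eq ∘ Fin.suc)))
    (sym (ιℚ-+ (f 0) (Σ< k (f ∘ suc)))))

-- p-adically B_n is the limit of S n M / M as M tends to 0; a common denominator D makes this integral.
record Approximates (D : ℕ) (E : ℤ) (n : ℕ) : Set where
  constructor approximates
  field
    rational : ιℚ (+ D) ℚ.* bernoulli n ≡ ιℚ E
    integral : ∀ M → + D * S n M ≋ + M * E [ + M * + M ]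

open Approximates

approximate-scale : ∀ {D E n} k → Approximates D E n → Approximates (k ℕ.* D) (+ k * E) n
approximate-scale {D} {E} {n} k (approximates eq approx) = approximates
  (begin
    ιℚ (+ (k ℕ.* D)) ℚ.* bernoulli n        ≡⟨ cong (λ x → ιℚ x ℚ.* bernoulli n) (ℤ.pos-* k D) ⟩
    ιℚ (+ k * + D) ℚ.* bernoulli n          ≡⟨ cong (ℚ._* bernoulli n) (ιℚ-* (+ k) (+ D)) ⟩
    ιℚ (+ k) ℚ.* ιℚ (+ D) ℚ.* bernoulli n   ≡⟨ ℚ.*-assoc (ιℚ (+ k)) (ιℚ (+ D)) (bernoulli n) ⟩
    ιℚ (+ k) ℚ.* (ιℚ (+ D) ℚ.* bernoulli n) ≡⟨ cong (ιℚ (+ k) ℚ.*_) eq ⟩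
    ιℚ (+ k) ℚ.* ιℚ E                       ≡⟨ ιℚ-* (+ k) E ⟨
    ιℚ (+ k * E)                            ∎)
  λ M → ≋-trans (≋-reflexive (trans (cong (_* S n M) (ℤ.pos-* k D)) (ℤ.*-assoc (+ k) (+ D) (S n M))))
    (≋-trans (≋-*ˡ (+ k) (approx M)) (≋-reflexive (swap (+ k) (+ M) E)))
  where
  open ≡-Reasoning
  swap : ∀ x y z → x * (y * z) ≡ y * (x * z)
  swap = solve-∀

-- `S-step` for the exponent `n + 1` has the coefficients of the recursion defining B_(n+1), apart
-- from the term M^(n+2), which vanishes modulo M². Multiplying by `n + 2` clears the new
-- denominator.
approximate-next : ∀ n {D} (E : ℕ → ℤ) → (∀ j → j ℕ.≤ n → Approximates D (E j) j) →
  Approximates (suc (suc n) ℕ.* D) (- Σ< (suc n) (λ j → suc (suc n) Cℤ j * E j)) (suc n)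
approximate-next n {D} E approx = approximates rational-next integral-next
  where
  m+1 = suc (suc n)
  X = sumℚ (tabulate (λ (j : Fin (suc n)) → ιℚ (m+1 Cℤ toℕ j) ℚ.* lookup (bernoulliVec n) j))
  r = + 1 ℚ./ m+1
  term : ∀ (j : Fin (suc n)) → ιℚ (+ D) ℚ.* (ιℚ (m+1 Cℤ toℕ j) ℚ.* lookup (bernoulliVec n) j) ≡ ιℚ (m+1 Cℤ toℕ j * E (toℕ j))
  term j = begin
    ιℚ (+ D) ℚ.* (c ℚ.* lookup (bernoulliVec n) j)  ≡⟨ cong (λ b → ιℚ (+ D) ℚ.* (c ℚ.* b)) (lookup-bernoulliVec n j) ⟩
    ιℚ (+ D) ℚ.* (c ℚ.* bernoulli (toℕ j))          ≡⟨ swap (ιℚ (+ D)) c (bernoulli (toℕ j)) ⟩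
    c ℚ.* (ιℚ (+ D) ℚ.* bernoulli (toℕ j))          ≡⟨ cong (c ℚ.*_) (rational (approx (toℕ j) (ℕ.≤-pred (Fin.toℕ<n j)))) ⟩
    c ℚ.* ιℚ (E (toℕ j))                            ≡⟨ ιℚ-* (m+1 Cℤ toℕ j) (E (toℕ j)) ⟨
    ιℚ (m+1 Cℤ toℕ j * E (toℕ j))                   ∎
    where
    open ≡-Reasoning
    c = ιℚ (m+1 Cℤ toℕ j)
    open ℚ.+-*-Solver
    swap : ∀ x y z → x ℚ.* (y ℚ.* z) ≡ y ℚ.* (x ℚ.* z)
    swap = solve 3 (λ x y z → x :* (y :* z) := y :* (x :* z)) refl
  rational-next : ιℚ (+ (m+1 ℕ.* D)) ℚ.* bernoulli (suc n) ≡ ιℚ (- Σ< (suc n) (λ j → m+1 Cℤ j * E j))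
  rational-next = begin
    ιℚ (+ (m+1 ℕ.* D)) ℚ.* bernoulli (suc n)
      ≡⟨ cong₂ ℚ._*_ (trans (cong ιℚ (ℤ.pos-* m+1 D)) (ιℚ-* (+ m+1) (+ D))) (bernoulli-suc n) ⟩
    ιℚ (+ m+1) ℚ.* ιℚ (+ D) ℚ.* (ℚ.- (r ℚ.* X))
      ≡⟨ rearrange (ιℚ (+ m+1)) (ιℚ (+ D)) r X ⟩
    ℚ.- (ιℚ (+ m+1) ℚ.* r ℚ.* (ιℚ (+ D) ℚ.* X))
      ≡⟨ cong (λ x → ℚ.- (x ℚ.* (ιℚ (+ D) ℚ.* X))) (ιℚ-recip (suc n)) ⟩
    ℚ.- (1ℚ ℚ.* (ιℚ (+ D) ℚ.* X))
      ≡⟨ cong ℚ.-_ (trans (ℚ.*-identityˡ _) (sumℚ-ιℚ (+ D) (suc n) _ (λ j → m+1 Cℤ j * E j) term)) ⟩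
    ℚ.- ιℚ (Σ< (suc n) (λ j → m+1 Cℤ j * E j))
      ≡⟨ ιℚ-neg (Σ< (suc n) (λ j → m+1 Cℤ j * E j)) ⟨
    ιℚ (- Σ< (suc n) (λ j → m+1 Cℤ j * E j)) ∎
    where
    open ≡-Reasoning
    open ℚ.+-*-Solver
    rearrange : ∀ a d r x → a ℚ.* d ℚ.* (ℚ.- (r ℚ.* x)) ≡ ℚ.- (a ℚ.* r ℚ.* (d ℚ.* x))
    rearrange = solve 4 (λ a d r x → a :* d :* (:- (r :* x)) := :- (a :* r :* (d :* x))) refl
  integral-next : ∀ M → + (m+1 ℕ.* D) * S (suc n) M ≋ + M * (- Σ< (suc n) (λ j → m+1 Cℤ j * E j)) [ + M * + M ]
  integral-next M = begin
    + (m+1 ℕ.* D) * S (suc n) M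
      ≡⟨ trans (cong (_* S (suc n) M) (ℤ.pos-* m+1 D)) (swap (+ m+1) (+ D) (S (suc n) M)) ⟩
    + D * (+ m+1 * S (suc n) M)
      ≡⟨ cong (λ x → + D * x) (S-step (suc n) M) ⟩
    + D * ((+ M) ^ m+1 - Σ< (suc n) (λ j → m+1 Cℤ j * S j M))
      ≈⟨ ≋-*ˡ (+ D) (≋-- (∣⇒≋0 (divides ((+ M) ^ n) (lem₁ (+ M) ((+ M) ^ n)))) (≋-refl {Σ< (suc n) (λ j → m+1 Cℤ j * S j M)})) ⟩
    + D * (+ 0 - Σ< (suc n) (λ j → m+1 Cℤ j * S j M))
      ≡⟨ lem₂ (+ D) (Σ< (suc n) (λ j → m+1 Cℤ j * S j M)) ⟩
    - (+ D * Σ< (suc n) (λ j → m+1 Cℤ j * S j M))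
      ≡⟨ cong -_ (sym (Σ-*ˡ (suc n) (+ D) (λ j → m+1 Cℤ j * S j M))) ⟩
    - Σ< (suc n) (λ j → + D * (m+1 Cℤ j * S j M))
      ≈⟨ ≋-neg (Σ-≋ (suc n) {λ j → + D * (m+1 Cℤ j * S j M)} {λ j → + M * (m+1 Cℤ j * E j)} step) ⟩
    - Σ< (suc n) (λ j → + M * (m+1 Cℤ j * E j))
      ≡⟨ cong -_ (Σ-*ˡ (suc n) (+ M) (λ j → m+1 Cℤ j * E j)) ⟩
    - (+ M * Σ< (suc n) (λ j → m+1 Cℤ j * E j))
      ≡⟨ ℤ.neg-distribʳ-* (+ M) (Σ< (suc n) (λ j → m+1 Cℤ j * E j)) ⟩
    + M * (- Σ< (suc n) (λ j → m+1 Cℤ j * E j)) ∎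
    where
    open ≋-Reasoning (+ M * + M)
    swap : ∀ x y z → x * y * z ≡ y * (x * z)
    swap = solve-∀
    swap′ : ∀ x y z → x * (y * z) ≡ y * (x * z)
    swap′ = solve-∀
    lem₁ : ∀ m x → m * (m * x) ≡ x * (m * m)
    lem₁ = solve-∀
    lem₂ : ∀ d x → d * (+ 0 - x) ≡ - (d * x)
    lem₂ = solve-∀
    step : ∀ j → j ℕ.< suc n → + D * (m+1 Cℤ j * S j M) ≋ + M * (m+1 Cℤ j * E j) [ + M * + M ]
    step j j<n+1 = ≋-trans (≋-reflexive (swap′ (+ D) (m+1 Cℤ j) (S j M)))
      (≋-trans (≋-*ˡ (m+1 Cℤ j) (integral (approx j (ℕ.≤-pred j<n+1)) M)) (≋-reflexive (swap′ (m+1 Cℤ j) (+ M) (E j))))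

-- The recursion for the next Bernoulli number involves all earlier ones, so they are carried along
-- over one denominator, which is (n+1)! by construction.
bernoulli-approximation≤ : ∀ n → ∃ λ D → ℕ.NonZero D × ∃ λ (E : ℕ → ℤ) → ∀ j → j ℕ.≤ n → Approximates D (E j) j
bernoulli-approximation≤ zero = 1 , _ , (λ _ → + 1) , λ { zero _ → approximates refl λ M → ≋-reflexive (trans (ℤ.*-identityˡ _) (S-const M)) }
  where
  S-const : ∀ M → S 0 M ≡ + M * + 1
  S-const M = Σ-const M (+ 1)
bernoulli-approximation≤ (suc n) with bernoulli-approximation≤ n
... | D , D≢0 , E , approx = suc (suc n) ℕ.* D , ℕ.m*n≢0 (suc (suc n)) D {{_}} {{D≢0}} , E′ , approx′
  where
  E′ : ℕ → ℤ
  E′ j with j ℕ.≤? n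
  ... | yes _ = + suc (suc n) * E j
  ... | no  _ = - Σ< (suc n) (λ j → suc (suc n) Cℤ j * E j)
  approx′ : ∀ j → j ℕ.≤ suc n → Approximates (suc (suc n) ℕ.* D) (E′ j) j
  approx′ j j≤n+1 with j ℕ.≤? n
  ... | yes j≤n = approximate-scale (suc (suc n)) (approx j j≤n)
  ... | no  j≰n = subst (Approximates (suc (suc n) ℕ.* D) (- Σ< (suc n) (λ j → suc (suc n) Cℤ j * E j)))
    (ℕ.≤-antisym (ℕ.≰⇒> j≰n) j≤n+1) (approximate-next n E approx)

bernoulli-approximation : ∀ n → ∃ λ D → ℕ.NonZero D × ∃ λ E → Approximates D E n
bernoulli-approximation n with bernoulli-approximation≤ n
... | D , D≢0 , E , approx = D , D≢0 , E n , approx n ℕ.≤-refl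

-- Interpolation values modulo powers of p

zetaValue-cross : ∀ p l s D E → ℕ.NonZero (l ℕ.+ s ℕ.* (p ℕ.∸ 1)) →
  let n = l ℕ.+ s ℕ.* (p ℕ.∸ 1) in
  ιℚ (+ D) ℚ.* bernoulli n ≡ ιℚ E →
  + n * + D * ↥ zetaValue p l s ≡ - ((+ 1 - + (p ℕ.^ (n ℕ.∸ 1))) * E) * ↧ zetaValue p l s
zetaValue-cross p l s D E n≢0 eq = ιℚ-cross (+ n * + D) (- ((+ 1 - P) * E)) (zetaValue p l s) (begin
  ιℚ (+ n * + D) ℚ.* (ℚ.- ((1ℚ ℚ.- ιℚ P) ℚ.* B ℚ.* recipℕ n))
    ≡⟨ cong (ℚ._* (ℚ.- ((1ℚ ℚ.- ιℚ P) ℚ.* B ℚ.* recipℕ n))) (ιℚ-* (+ n) (+ D)) ⟩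
  ιℚ (+ n) ℚ.* ιℚ (+ D) ℚ.* (ℚ.- ((1ℚ ℚ.- ιℚ P) ℚ.* B ℚ.* recipℕ n))
    ≡⟨ rearrange (ιℚ (+ n)) (ιℚ (+ D)) (1ℚ ℚ.- ιℚ P) B (recipℕ n) ⟩
  ℚ.- (ιℚ (+ n) ℚ.* recipℕ n ℚ.* ((1ℚ ℚ.- ιℚ P) ℚ.* (ιℚ (+ D) ℚ.* B)))
    ≡⟨ cong₂ (λ x y → ℚ.- (x ℚ.* ((1ℚ ℚ.- ιℚ P) ℚ.* y))) (recip n n≢0) eq ⟩
  ℚ.- (1ℚ ℚ.* ((1ℚ ℚ.- ιℚ P) ℚ.* ιℚ E))
    ≡⟨ cong ℚ.-_ (ℚ.*-identityˡ ((1ℚ ℚ.- ιℚ P) ℚ.* ιℚ E)) ⟩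
  ℚ.- ((1ℚ ℚ.- ιℚ P) ℚ.* ιℚ E)
    ≡⟨ cong (λ x → ℚ.- (x ℚ.* ιℚ E)) (trans (ιℚ-+ (+ 1) (- P)) (cong (λ y → 1ℚ ℚ.+ y) (ιℚ-neg P))) ⟨
  ℚ.- (ιℚ (+ 1 - P) ℚ.* ιℚ E)
    ≡⟨ cong ℚ.-_ (ιℚ-* (+ 1 - P) E) ⟨
  ℚ.- ιℚ ((+ 1 - P) * E)
    ≡⟨ ιℚ-neg ((+ 1 - P) * E) ⟨
  ιℚ (- ((+ 1 - P) * E)) ∎)
  where
  open ≡-Reasoning
  n = l ℕ.+ s ℕ.* (p ℕ.∸ 1)
  P = + (p ℕ.^ (n ℕ.∸ 1))
  B = bernoulli n
  recip : ∀ n → ℕ.NonZero n → ιℚ (+ n) ℚ.* recipℕ n ≡ 1ℚ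
  recip (suc m) _ = ιℚ-recip m
  open ℚ.+-*-Solver
  rearrange : ∀ n d a b r → n ℚ.* d ℚ.* (ℚ.- (a ℚ.* b ℚ.* r)) ≡ ℚ.- (n ℚ.* r ℚ.* (a ℚ.* (d ℚ.* b)))
  rearrange = solve 5 (λ n d a b r → n :* d :* (:- (a :* b :* r)) := :- (n :* r :* (a :* (d :* b)))) refl

p^-∣ᵤ : ∀ {p k x} → + (p ℕ.^ k) ∣ℤ x → (+ p) ^ k ∣ x
p^-∣ᵤ {p} {k} {x} d = subst (_∣ x) (pos-^ p k) (Signed.∣ᵤ⇒∣ d)

∣ᵤ-p^ : ∀ {p k x} → (+ p) ^ k ∣ x → + (p ℕ.^ k) ∣ℤ x
∣ᵤ-p^ {p} {k} {x} d = Signed.∣⇒∣ᵤ (subst (_∣ x) (sym (pos-^ p k)) d)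

CongMod⇒≋ : ∀ {p k x y} → CongMod p k x y → x k ≋ y k [ (+ p) ^ k ]
CongMod⇒≋ {p} {k} d = ∣⇒≋ (p^-∣ᵤ {p} {k} d)

≋⇒CongMod : ∀ {p k x y} → x k ≋ y k [ (+ p) ^ k ] → CongMod p k x y
≋⇒CongMod {p} {k} c = ∣ᵤ-p^ {p} {k} (≋⇒∣ c)

IsZp-coherent : ∀ {p x k m} → IsZp p x → k ℕ.≤ m → x m ≋ x k [ (+ p) ^ k ]
IsZp-coherent {p} {x} {k} zp k≤m = go (ℕ.≤⇒≤′ k≤m)
  where
  go : ∀ {m} → k ℕ.≤′ m → x m ≋ x k [ (+ p) ^ k ]
  go ℕ.≤′-refl = ≋-refl
  go {suc m} (ℕ.≤′-step k≤′m) =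
    ≋-trans (≋-∣ (^-∣ (+ p) (ℕ.≤′⇒≤ k≤′m)) (∣⇒≋ (p^-∣ᵤ {p} {m} (zp m)))) (go k≤′m)

module _ {p : ℕ} (pr : Prime p) where

  -- `EqRat` controls only the denominator `d` of the value times `z`. Reading it at level `d + k`
  -- leaves `k` digits after `d` is cancelled.
  zeta-approximation : ∀ l s D E {z} → ℕ.NonZero (l ℕ.+ s ℕ.* (p ℕ.∸ 1)) →
    let n = l ℕ.+ s ℕ.* (p ℕ.∸ 1) in
    ιℚ (+ D) ℚ.* bernoulli n ≡ ιℚ E → IsZp p z → EqRat p z (zetaValue p l s) →
    ∀ k → + n * + D * z k ≋ - ((+ 1 - + (p ℕ.^ (n ℕ.∸ 1))) * E) [ (+ p) ^ k ]
  zeta-approximation l s D E {z} n≢0 eq zp z≡r k =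
    ≋-trans (≋-*ˡ (+ n * + D) (≋-sym (IsZp-coherent {x = z} zp (ℕ.m≤n+m k d)))) (∣⇒≋ (p^-cancel-loss pr d k _ divisible))
    where
    r = zetaValue p l s
    d = ℚ.↧ₙ r
    n = l ℕ.+ s ℕ.* (p ℕ.∸ 1)
    Q = - ((+ 1 - + (p ℕ.^ (n ℕ.∸ 1))) * E)
    lem : ∀ a x u w → a * (u * x - w) ≡ u * (a * x) - a * w
    lem = solve-∀
    lem₂ : ∀ u x q → u * x - q * u ≡ u * (x - q)
    lem₂ = solve-∀
    divisible : (+ p) ^ (d ℕ.+ k) ∣ ↧ r * (+ n * + D * z (d ℕ.+ k) - Q)
    divisible = subst ((+ p) ^ (d ℕ.+ k) ∣_)
      (trans (lem (+ n * + D) (z (d ℕ.+ k)) (↧ r) (↥ r))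
        (trans (cong (λ x → ↧ r * (+ n * + D * z (d ℕ.+ k)) - x) (zetaValue-cross p l s D E n≢0 eq))
          (lem₂ (↧ r) (+ n * + D * z (d ℕ.+ k)) Q)))
      (Signed.∣n⇒∣m*n (+ n * + D) (p^-∣ᵤ {p} {d ℕ.+ k} (z≡r (d ℕ.+ k))))

ℕ-∣m+n∣n⇒∣m : ∀ {d m n} → d ℕ.∣ m ℕ.+ n → d ℕ.∣ n → d ℕ.∣ m
ℕ-∣m+n∣n⇒∣m {d} {m} {n} h = ℕ.∣m+n∣m⇒∣n (subst (d ℕ.∣_) (ℕ.+-comm m n) h)

-- Finite differences

diff : ℕ → (ℕ → ℤ) → ℤ
diff n g = Σ< (suc n) (λ k → + (n C k) * signPow (n ℕ.∸ k) * g k)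

diff-≋ : ∀ n {f g : ℕ → ℤ} {m} → (∀ k → k ℕ.≤ n → f k ≋ g k [ m ]) → diff n f ≋ diff n g [ m ]
diff-≋ n {f} {g} p = Σ-≋ (suc n) {λ k → + (n C k) * signPow (n ℕ.∸ k) * f k} {λ k → + (n C k) * signPow (n ℕ.∸ k) * g k}
  (λ k k<n+1 → ≋-*ˡ (+ (n C k) * signPow (n ℕ.∸ k)) (p k (ℕ.≤-pred k<n+1)))

diff-cong : ∀ n {f g : ℕ → ℤ} → (∀ k → f k ≡ g k) → diff n f ≡ diff n g
diff-cong n {f} {g} p = Σ-cong (suc n) {λ k → + (n C k) * signPow (n ℕ.∸ k) * f k} {λ k → + (n C k) * signPow (n ℕ.∸ k) * g k}
  (λ k → cong (λ x → + (n C k) * signPow (n ℕ.∸ k) * x) (p k))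

diff-*ˡ : ∀ n x (f : ℕ → ℤ) → diff n (λ k → x * f k) ≡ x * diff n f
diff-*ˡ n x f = trans (Σ-cong (suc n) (λ k → lem (+ (n C k) * signPow (n ℕ.∸ k)) x (f k)))
  (Σ-*ˡ (suc n) x (λ k → + (n C k) * signPow (n ℕ.∸ k) * f k))
  where
  lem : ∀ a x y → a * (x * y) ≡ x * (a * y)
  lem = solve-∀

diff-Σ : ∀ n m (f : ℕ → ℕ → ℤ) → diff n (λ k → Σ< m (λ i → f i k)) ≡ Σ< m (λ i → diff n (f i))
diff-Σ n m f = trans
  (Σ-cong (suc n) (λ k → sym (Σ-*ˡ m (+ (n C k) * signPow (n ℕ.∸ k)) (λ i → f i k))))
  (Σ-swap (suc n) m (λ k i → + (n C k) * signPow (n ℕ.∸ k) * f i k))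

diff-suc : ∀ n (g : ℕ → ℤ) → diff (suc n) g ≡ diff n (λ k → g (suc k) - g k)
diff-suc n g = begin
  diff (suc n) g
    ≡⟨ Σ-cong (suc (suc n)) (λ k → ℤ.*-assoc (suc n Cℤ k) (signPow (suc n ℕ.∸ k)) (g k)) ⟩
  Σ< (suc (suc n)) (λ k → suc n Cℤ k * h k)
    ≡⟨ Σ-pascal n h ⟩
  Σ< (suc n) (λ k → n Cℤ k * h k) + Σ< (suc n) (λ k → n Cℤ k * h (suc k))
    ≡⟨ Σ-+ (suc n) (λ k → n Cℤ k * h k) (λ k → n Cℤ k * h (suc k)) ⟨
  Σ< (suc n) (λ k → n Cℤ k * h k + n Cℤ k * h (suc k))
    ≡⟨ Σ-cong< (suc n) step ⟩
  diff n (λ k → g (suc k) - g k) ∎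
  where
  open ≡-Reasoning
  h : ℕ → ℤ
  h k = signPow (suc n ℕ.∸ k) * g k
  lem : ∀ c s x y → c * (- s * x) + c * (s * y) ≡ c * s * (y - x)
  lem = solve-∀
  step : ∀ k → k ℕ.< suc n → n Cℤ k * h k + n Cℤ k * h (suc k) ≡ + (n C k) * signPow (n ℕ.∸ k) * (g (suc k) - g k)
  step k (s≤s k≤n) = trans (cong (λ m → n Cℤ k * (signPow m * g k) + n Cℤ k * h (suc k)) (ℕ.+-∸-assoc 1 k≤n))
    (lem (n Cℤ k) (signPow (n ℕ.∸ k)) (g k) (g (suc k)))

diff-0 : ∀ g → diff 0 g ≡ g 0
diff-0 g = lem (g 0)
  where
  lem : ∀ x → + 1 * + 1 * x + + 0 ≡ x
  lem = solve-∀

-- Each first difference multiplies the progression by `v - 1`. For `v` congruent to 1 modulo `p`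
-- this is where the power p^n of the Kummer congruences arises.
diff-geometric : ∀ n a v → diff n (λ k → a * v ^ k) ≡ a * (v - + 1) ^ n
diff-geometric zero    a v = diff-0 (λ k → a * v ^ k)
diff-geometric (suc n) a v = begin
  diff (suc n) (λ k → a * v ^ k)               ≡⟨ diff-suc n (λ k → a * v ^ k) ⟩
  diff n (λ k → a * (v * v ^ k) - a * v ^ k)   ≡⟨ diff-cong n (λ k → lem a v (v ^ k)) ⟩
  diff n (λ k → a * (v - + 1) * v ^ k)         ≡⟨ diff-geometric n (a * (v - + 1)) v ⟩
  a * (v - + 1) * (v - + 1) ^ n                ≡⟨ ℤ.*-assoc a (v - + 1) ((v - + 1) ^ n) ⟩
  a * (v - + 1) ^ suc n                        ∎
  where
  open ≡-Reasoning
  lem : ∀ a v x → a * (v * x) - a * x ≡ a * (v - + 1) * x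
  lem = solve-∀

≋⇒%≡% : ∀ {a b M} .{{_ : ℕ.NonZero M}} → + a ≋ + b [ + M ] → a ℕ.% M ≡ b ℕ.% M
≋⇒%≡% {a} {b} {M} (by (+ n) eq) = trans (cong (ℕ._% M) (ℤ.+-injective (trans eq (cong (λ x → + b + x) (sym (ℤ.pos-* n M))))))
  (ℕ.[m+kn]%n≡m%n b n M)
≋⇒%≡% {a} {b} {M} (by -[1+ n ] eq) = sym (trans (cong (ℕ._% M) (ℤ.+-injective
  (trans (lem (+ b) (+ suc n) (+ M)) (cong₂ _+_ (sym eq) (sym (ℤ.pos-* (suc n) M))))))
  (ℕ.[m+kn]%n≡m%n a (suc n) M))
  where
  lem : ∀ b s m → b ≡ (b + (- s) * m) + s * m
  lem = solve-∀

-- The sum of the thresholds for 0, ..., n lies above each of them.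
bounded-choice : ∀ n (P : ℕ → ℕ → Set) → (∀ k → ∃ λ N₀ → ∀ N → N₀ ℕ.≤ N → P k N) →
  ∃ λ N → ∀ k → k ℕ.≤ n → P k N
bounded-choice n P h = total n , λ k k≤n → proj₂ (h k) (total n) (bound k≤n)
  where
  total : ℕ → ℕ
  total zero    = proj₁ (h 0)
  total (suc n) = total n ℕ.+ proj₁ (h (suc n))
  bound′ : ∀ {k n} → k ℕ.≤′ n → proj₁ (h k) ℕ.≤ total n
  bound′ {zero}  ℕ.≤′-refl = ℕ.≤-refl
  bound′ {suc k} ℕ.≤′-refl = ℕ.m≤n+m (proj₁ (h (suc k))) (total k)
  bound′ {n = suc n} (ℕ.≤′-step q) = ℕ.≤-trans (bound′ q) (ℕ.m≤m+n (total n) (proj₁ (h (suc n))))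
  bound : ∀ {k n} → k ℕ.≤ n → proj₁ (h k) ℕ.≤ total n
  bound k≤n = bound′ (ℕ.≤⇒≤′ k≤n)

-- Voronoi's congruence

module Voronoi {p : ℕ} (pr : Prime p) where

  private instance
    p≢0 : ℕ.NonZero p
    p≢0 = prime⇒nonZero pr

  infixl 7 _/p^_ _%p^_
  _/p^_ _%p^_ : ℕ → ℕ → ℕ
  a /p^ n = ℕ._/_ a (p ℕ.^ n) {{ℕ.m^n≢0 p n}}
  a %p^ n = ℕ._%_ a (p ℕ.^ n) {{ℕ.m^n≢0 p n}}

  %/p^ : ∀ a n → a ≡ a %p^ n ℕ.+ a /p^ n ℕ.* p ℕ.^ n
  %/p^ a n = ℕ.m≡m%n+[m/n]*n a (p ℕ.^ n) {{ℕ.m^n≢0 p n}}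

  -- The trivial character modulo `p`. With it a sum over residues prime to `p` runs over a full
  -- range, where permutations and block decompositions apply.
  χ : ℕ → ℤ
  χ a with p ℕ.∣? a
  ... | yes _ = + 0
  ... | no  _ = + 1

  χ-∣ : ∀ {a} → p ℕ.∣ a → χ a ≡ + 0
  χ-∣ {a} p∣a with p ℕ.∣? a
  ... | yes _  = refl
  ... | no p∤a = contradiction p∣a p∤a

  χ-∤ : ∀ {a} → ¬ p ℕ.∣ a → χ a ≡ + 1
  χ-∤ {a} p∤a with p ℕ.∣? a
  ... | yes p∣a = contradiction p∣a p∤a
  ... | no _    = refl

  χ-cong : ∀ {a b} → (p ℕ.∣ a → p ℕ.∣ b) → (p ℕ.∣ b → p ℕ.∣ a) → χ a ≡ χ b
  χ-cong {a} {b} f g with p ℕ.∣? a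
  ... | yes p∣a = sym (χ-∣ (f p∣a))
  ... | no  p∤a = sym (χ-∤ (p∤a ∘ g))

  χ-≋ : ∀ {a x y m} → (¬ p ℕ.∣ a → x ≋ y [ m ]) → χ a * x ≋ χ a * y [ m ]
  χ-≋ {a} h with p ℕ.∣? a
  ... | yes _  = ≋-refl
  ... | no p∤a = ≋-*ˡ (+ 1) (h p∤a)

  -- In each block of length `p` exactly the first index is a multiple of `p`.
  Σ-χ : ∀ K f → Σ< (K ℕ.* p) (λ a → χ a * f a) ≡ Σ< (K ℕ.* p) f - Σ< K (λ b → f (b ℕ.* p))
  Σ-χ K f = begin
    Σ< (K ℕ.* p) (λ a → χ a * f a)
      ≡⟨ Σ-blocks K p (λ a → χ a * f a) ⟩
    Σ< K (λ b → Σ< p (λ a → χ (a ℕ.+ b ℕ.* p) * f (a ℕ.+ b ℕ.* p)))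
      ≡⟨ Σ-cong K (λ b → block b (ℕ.pred p) (ℕ.suc-pred p)) ⟩
    Σ< K (λ b → Σ< p (λ a → f (a ℕ.+ b ℕ.* p)) - f (b ℕ.* p))
      ≡⟨ Σ-- K (λ b → Σ< p (λ a → f (a ℕ.+ b ℕ.* p))) (λ b → f (b ℕ.* p)) ⟩
    Σ< K (λ b → Σ< p (λ a → f (a ℕ.+ b ℕ.* p))) - Σ< K (λ b → f (b ℕ.* p))
      ≡⟨ cong (_- Σ< K (λ b → f (b ℕ.* p))) (Σ-blocks K p f) ⟨
    Σ< (K ℕ.* p) f - Σ< K (λ b → f (b ℕ.* p)) ∎
    where
    open ≡-Reasoning
    lem : ∀ x y → + 0 * x + y ≡ (x + y) - x
    lem = solve-∀
    block : ∀ b q → suc q ≡ p → Σ< p (λ a → χ (a ℕ.+ b ℕ.* p) * f (a ℕ.+ b ℕ.* p)) ≡ Σ< p (λ a → f (a ℕ.+ b ℕ.* p)) - f (b ℕ.* p)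
    block b q q+1≡p = subst (λ P → Σ< P g ≡ Σ< P h - f (b ℕ.* p)) q+1≡p (begin
      χ (b ℕ.* p) * f (b ℕ.* p) + Σ< q (λ a → g (suc a))
        ≡⟨ cong₂ (λ x y → x * f (b ℕ.* p) + y) (χ-∣ (ℕ.n∣m*n b)) (Σ-cong< q unit) ⟩
      + 0 * f (b ℕ.* p) + Σ< q (λ a → h (suc a))
        ≡⟨ lem (f (b ℕ.* p)) (Σ< q (λ a → h (suc a))) ⟩
      Σ< (suc q) h - f (b ℕ.* p) ∎)
      where
      g h : ℕ → ℤ
      g a = χ (a ℕ.+ b ℕ.* p) * f (a ℕ.+ b ℕ.* p)
      h a = f (a ℕ.+ b ℕ.* p)
      unit : ∀ a → a ℕ.< q → g (suc a) ≡ h (suc a)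
      unit a a<q = trans (cong (_* h (suc a)) (χ-∤ p∤)) (ℤ.*-identityˡ (h (suc a)))
        where
        p∤ : ¬ p ℕ.∣ suc a ℕ.+ b ℕ.* p
        p∤ d = ℕ.>⇒∤ (ℕ.≤-trans (s≤s a<q) (ℕ.≤-reflexive q+1≡p)) (ℕ-∣m+n∣n⇒∣m d (ℕ.n∣m*n b))

  -- Euler's theorem: c^e is 1 modulo p^N for e = (p-1) p^N, so c^(e-1) is an inverse.
  unit-inverse : ∀ c N → ¬ (+ p ∣ + c) → ∃ λ c′ → c ℕ.* c′ %p^ N ≡ 1 %p^ N
  unit-inverse c N p∤c = c ℕ.^ ℕ.pred e , ≋⇒%≡% {{ℕ.m^n≢0 p N}} (subst₂ (λ x m → x ≋ + 1 [ m ]) eq (sym (pos-^ p N))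
    (≋-∣ (^-∣ (+ p) (ℕ.n≤1+n N)) (lift-1 pr N (fermat-unit pr c p∤c))))
    where
    e = (p ℕ.∸ 1) ℕ.* p ℕ.^ N
    e≢0 : ℕ.NonZero e
    e≢0 = ℕ.m*n≢0 (p ℕ.∸ 1) (p ℕ.^ N) {{ℕ.>-nonZero (ℕ.m<n⇒0<n∸m (ℕ.nonTrivial⇒n>1 p {{prime⇒nonTrivial pr}}))}} {{ℕ.m^n≢0 p N}}
    eq : ((+ c) ^ (p ℕ.∸ 1)) ^ (p ℕ.^ N) ≡ + (c ℕ.* c ℕ.^ ℕ.pred e)
    eq = trans (ℤ.^-*-assoc (+ c) (p ℕ.∸ 1) (p ℕ.^ N))
      (trans (sym (pos-^ c e)) (cong (λ k → + (c ℕ.^ k)) (sym (ℕ.suc-pred e {{e≢0}}))))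

  S* : ℕ → ℕ → ℤ
  S* n N = Σ< (p ℕ.^ N) (λ a → χ a * (+ a) ^ n)

  W : ℕ → ℕ → ℕ → ℤ
  W c n N = Σ< (p ℕ.^ N) (λ a → χ a * (+ (c ℕ.* a /p^ N) * (+ (c ℕ.* a)) ^ n))

  -- The origin of the Euler factor: with S n M close to M B_n, the right side is close to p^(N+1)
  -- (1 - p^(n-1)) B_n.
  S*-S : ∀ n N → S* n (suc N) ≡ S n (p ℕ.^ suc N) - (+ p) ^ n * S n (p ℕ.^ N)
  S*-S n N = begin
    Σ< (p ℕ.* p ℕ.^ N) (λ a → χ a * (+ a) ^ n)
      ≡⟨ cong (λ M → Σ< M (λ a → χ a * (+ a) ^ n)) (ℕ.*-comm p (p ℕ.^ N)) ⟩
    Σ< (p ℕ.^ N ℕ.* p) (λ a → χ a * (+ a) ^ n)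
      ≡⟨ Σ-χ (p ℕ.^ N) (λ a → (+ a) ^ n) ⟩
    S n (p ℕ.^ N ℕ.* p) - Σ< (p ℕ.^ N) (λ b → (+ (b ℕ.* p)) ^ n)
      ≡⟨ cong₂ (λ M x → S n M - x) (ℕ.*-comm (p ℕ.^ N) p) (trans (Σ-cong (p ℕ.^ N) step) (Σ-*ˡ (p ℕ.^ N) ((+ p) ^ n) (λ b → (+ b) ^ n))) ⟩
    S n (p ℕ.^ suc N) - (+ p) ^ n * S n (p ℕ.^ N) ∎
    where
    open ≡-Reasoning
    step : ∀ b → (+ (b ℕ.* p)) ^ n ≡ (+ p) ^ n * (+ b) ^ n
    step b = trans (cong (_^ n) (trans (ℤ.pos-* b p) (ℤ.*-comm (+ b) (+ p)))) (^-distribʳ-* (+ p) (+ b) n)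

  -- Let M = p^N and let r be the residue of ca modulo M. Then r = ca - ⌊ca/M⌋ M, and to first order
  -- r^(n+1) is (ca)^(n+1) - (n+1) M ⌊ca/M⌋ (ca)^n modulo M². As `a` runs over the residues prime to
  -- `p`, so does r, and the left sides add up to `S*` again.
  voronoi : ∀ c n N → 0 ℕ.< N → ¬ (+ p ∣ + c) →
    ((+ c) ^ suc n - + 1) * S* (suc n) N ≋ + (p ℕ.^ N) * (+ suc n * W c n N) [ + (p ℕ.^ N) * + (p ℕ.^ N) ]
  voronoi c n N@(suc N-1) _ p∤c = begin
    ((+ c) ^ suc n - + 1) * S* (suc n) N
      ≡⟨ lem₁ ((+ c) ^ suc n) (S* (suc n) N) (+ M * (+ suc n * W c n N)) ⟩
    ((+ c) ^ suc n * S* (suc n) N - + M * (+ suc n * W c n N)) - S* (suc n) N + + M * (+ suc n * W c n N)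
      ≈⟨ ≋-+ (≋⇒-≋0 (≋-sym permuted)) (≋-refl {+ M * (+ suc n * W c n N)}) ⟩
    + 0 + + M * (+ suc n * W c n N)
      ≡⟨ ℤ.+-identityˡ (+ M * (+ suc n * W c n N)) ⟩
    + M * (+ suc n * W c n N) ∎
    where
    M = p ℕ.^ N
    open ≋-Reasoning (+ M * + M)
    lem₁ : ∀ x s w → (x - + 1) * s ≡ (x * s - w) - s + w
    lem₁ = solve-∀
    fl rem : ℕ → ℕ
    fl a = c ℕ.* a /p^ N
    rem a = c ℕ.* a %p^ N
    division : ∀ a → + rem a ≡ + (c ℕ.* a) + - + fl a * + M
    division a = trans (lem (+ rem a) (+ fl a) (+ M))
      (cong (λ x → x + - + fl a * + M) (sym (trans (cong +_ (%/p^ (c ℕ.* a) N)) (cong (λ x → + rem a + x) (ℤ.pos-* (fl a) M)))))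
      where
      lem : ∀ r f m → r ≡ (r + f * m) + - f * m
      lem = solve-∀
    -- Here `N > 0` matters: reduction modulo `M` then preserves divisibility by `p`, and with it
    -- the character.
    p∣M : p ℕ.∣ M
    p∣M = ℕ.m∣m*n (p ℕ.^ N-1)
    χ-rem : ∀ a → χ (rem a) ≡ χ a
    χ-rem a = χ-cong
      (λ d → [ (λ x → contradiction x p∤c) , Signed.∣⇒∣ᵤ ]′ (prime-∣* pr (+ c) (+ a)
        (subst (+ p ∣_) (ℤ.pos-* c a) (Signed.∣ᵤ⇒∣ (subst (p ℕ.∣_) (sym (%/p^ (c ℕ.* a) N)) (ℕ.∣m∣n⇒∣m+n d (ℕ.∣n⇒∣m*n (fl a) p∣M)))))))
      (λ d → ℕ-∣m+n∣n⇒∣m (subst (p ℕ.∣_) (%/p^ (c ℕ.* a) N) (ℕ.∣n⇒∣m*n c d)) (ℕ.∣n⇒∣m*n (fl a) p∣M))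
    power : ∀ a → (+ rem a) ^ suc n ≋ (+ c) ^ suc n * (+ a) ^ suc n - + M * (+ suc n * (+ fl a * (+ (c ℕ.* a)) ^ n)) [ + M * + M ]
    power a = begin
      (+ rem a) ^ suc n
        ≡⟨ cong (_^ suc n) (division a) ⟩
      (+ (c ℕ.* a) + - + fl a * + M) ^ suc n
        ≈⟨ ≋-∣ (divides (+ fl a * + fl a) (sq (+ fl a) (+ M))) (expand₂ (+ (c ℕ.* a)) (- + fl a * + M) n) ⟩
      (+ (c ℕ.* a)) ^ suc n + + suc n * (+ (c ℕ.* a)) ^ n * (- + fl a * + M)
        ≡⟨ cong₂ _+_ (trans (cong (_^ suc n) (ℤ.pos-* c a)) (^-distribʳ-* (+ c) (+ a) (suc n))) (lem (+ suc n) ((+ (c ℕ.* a)) ^ n) (+ fl a) (+ M)) ⟩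
      (+ c) ^ suc n * (+ a) ^ suc n - + M * (+ suc n * (+ fl a * (+ (c ℕ.* a)) ^ n)) ∎
      where
      sq : ∀ f m → - f * m * (- f * m) ≡ f * f * (m * m)
      sq = solve-∀
      lem : ∀ s x f m → s * x * (- f * m) ≡ - (m * (s * (f * x)))
      lem = solve-∀
    c′ : ∃ λ c′ → c ℕ.* c′ %p^ N ≡ 1 %p^ N
    c′ = unit-inverse c N p∤c
    permuted : S* (suc n) N ≋ (+ c) ^ suc n * S* (suc n) N - + M * (+ suc n * W c n N) [ + M * + M ]
    permuted = begin
      S* (suc n) N
        ≡⟨ Σ-permute-% {M} {c} {proj₁ c′} {{ℕ.m^n≢0 p N}} (proj₂ c′) (λ a → χ a * (+ a) ^ suc n) ⟨
      Σ< M (λ a → χ (rem a) * (+ rem a) ^ suc n)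
        ≈⟨ Σ-≋ M {λ a → χ (rem a) * (+ rem a) ^ suc n} {λ a → χ a * (u a - v a)}
             (λ a _ → ≋-trans (≋-reflexive (cong (_* (+ rem a) ^ suc n) (χ-rem a))) (≋-*ˡ (χ a) (power a))) ⟩
      Σ< M (λ a → χ a * (u a - v a))
        ≡⟨ Σ-cong M (λ a → lem (χ a) ((+ c) ^ suc n) ((+ a) ^ suc n) (+ M) (+ suc n) (+ fl a * (+ (c ℕ.* a)) ^ n)) ⟩
      Σ< M (λ a → (+ c) ^ suc n * (χ a * (+ a) ^ suc n) - + M * + suc n * w a)
        ≡⟨ Σ-- M (λ a → (+ c) ^ suc n * (χ a * (+ a) ^ suc n)) (λ a → + M * + suc n * w a) ⟩
      Σ< M (λ a → (+ c) ^ suc n * (χ a * (+ a) ^ suc n)) - Σ< M (λ a → + M * + suc n * w a)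
        ≡⟨ cong₂ _-_ (Σ-*ˡ M ((+ c) ^ suc n) (λ a → χ a * (+ a) ^ suc n))
             (trans (Σ-*ˡ M (+ M * + suc n) w) (ℤ.*-assoc (+ M) (+ suc n) (W c n N))) ⟩
      (+ c) ^ suc n * S* (suc n) N - + M * (+ suc n * W c n N) ∎
      where
      u v w : ℕ → ℤ
      u a = (+ c) ^ suc n * (+ a) ^ suc n
      v a = + M * (+ suc n * (+ fl a * (+ (c ℕ.* a)) ^ n))
      w a = χ a * (+ fl a * (+ (c ℕ.* a)) ^ n)
      lem : ∀ x c a m s y → x * (c * a - m * (s * y)) ≡ c * (x * a) - m * s * (x * y)
      lem = solve-∀

ι-IsZp : ∀ p i → IsZp p (ι i)
ι-IsZp p i k = ∣ᵤ-p^ {p} {k} (≋⇒∣ (≋-refl {i}))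

+Z-IsZp : ∀ {p x y} → IsZp p x → IsZp p y → IsZp p (x +Z y)
+Z-IsZp {p} {x} {y} zx zy k = ∣ᵤ-p^ {p} {k} (≋⇒∣ (≋-+ {x (suc k)} {x k} {y (suc k)} {y k}
  (∣⇒≋ (p^-∣ᵤ {p} {k} (zx k))) (∣⇒≋ (p^-∣ᵤ {p} {k} (zy k)))))

Δ^≡diff : ∀ n f s i → Δ^ n f s i ≡ diff n (λ k → f (s +Z ιℕ k) i)
Δ^≡diff n f s i = sumℤ-upTo (suc n) (λ k → + (n C k) * signPow (n ℕ.∸ k) * f (s +Z ιℕ k) i)

-- Kummer congruences at natural arguments

module Kummer {p : ℕ} (pr : Prime p) (l′ : ℕ) (ζ : Seq → Seq) (ζ-fun : IsZpFun p ζ)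
  (ζ-value : ∀ s → EqRat p (ζ (ιℕ s)) (zetaValue p (suc (suc l′)) s)) where

  open Voronoi pr

  private instance
    p≢0 : ℕ.NonZero p
    p≢0 = prime⇒nonZero pr

  l : ℕ
  l = suc (suc l′)

  weight : ℕ → ℕ
  weight s = l ℕ.+ s ℕ.* (p ℕ.∸ 1)

  z : ℕ → Seq
  z s = ζ (ιℕ s)

  z-IsZp : ∀ s → IsZp p (z s)
  z-IsZp s = proj₁ ζ-fun (ιℕ s) (ι-IsZp p (+ s))

  -- Modulo M², with M = p^N, `D` times `S* n N` is -M n D ζ(s) by the Bernoulli approximation,
  -- while `voronoi` expresses (c^n - 1) `S* n N` through `W`. Comparing the two and cancelling M
  -- leaves a congruence modulo p^N. Cancelling `n D` then costs at most `n D` digits, whence the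
  -- threshold.
  zeta-voronoi : ∀ c → ¬ (+ p ∣ + c) → ∀ s k → ∃ λ N₀ → ∀ N → N₀ ℕ.≤ N →
    W c (ℕ.pred (weight s)) N ≋ - (((+ c) ^ weight s - + 1) * z s k) [ (+ p) ^ k ]
  zeta-voronoi c p∤c s k = from-approximation (bernoulli-approximation (weight s))
   where
   from-approximation : (∃ λ D → ℕ.NonZero D × ∃ λ E → Approximates D E (weight s)) →
     ∃ λ N₀ → ∀ N → N₀ ℕ.≤ N → W c (ℕ.pred (weight s)) N ≋ - (((+ c) ^ weight s - + 1) * z s k) [ (+ p) ^ k ]
   from-approximation (D , D≢0 , E , approximates rational integral) = suc (d ℕ.+ k) , estimate
    where
    m = l′ ℕ.+ s ℕ.* (p ℕ.∸ 1)
    n = suc (suc m)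
    d = n ℕ.* D
    P = + p
    G = (+ c) ^ n - + 1
    estimate : ∀ N → suc (d ℕ.+ k) ℕ.≤ N → W c (suc m) N ≋ - (G * z s k) [ P ^ k ]
    estimate N@(suc N-1) d+k<N = ≋-trans
      (-≋0⇒≋ (∣⇒≋0 (p^-cancel-loss pr d {{ℕ.m*n≢0 n D {{_}} {{D≢0}}}} k X divisible)))
      (≋-neg (≋-*ˡ G (IsZp-coherent {x = z s} (z-IsZp s) (ℕ.≤-trans (ℕ.m≤n+m k d) d+k≤N))))
      where
      d+k≤N : d ℕ.+ k ℕ.≤ N
      d+k≤N = ℕ.<⇒≤ d+k<N
      M = + (p ℕ.^ N)
      M₁ = + (p ℕ.^ N-1)
      X = W c (suc m) N - - (G * z s N)
      M≡ : M ≡ P * M₁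
      M≡ = ℤ.pos-* p (p ℕ.^ N-1)
      F = (+ 1 - + (p ℕ.^ suc m)) * E
      -- The modulus p^n M₁² is a multiple of M² = p² M₁² because n ≥ 2, and p^n M₁ = M p^(n-1)
      -- produces the Euler factor.
      lower : P ^ n * (+ D * S n (p ℕ.^ N-1)) ≋ M * (+ (p ℕ.^ suc m) * E) [ M * M ]
      lower = subst₂ (λ x y → P ^ n * (+ D * S n (p ℕ.^ N-1)) ≋ x [ y * y ])
        (trans (lem (P) (P ^ m) M₁ E) (cong₂ (λ x y → x * (y * E)) (sym M≡) (sym (pos-^ p (suc m))))) (sym M≡)
        (≋-∣ (divides (P ^ m) (lem₂ P (P ^ m) M₁)) (≋-scale (P ^ n) (integral (p ℕ.^ N-1))))
        where
        lem : ∀ p q m e → p * (p * q) * (m * e) ≡ p * m * (p * q * e)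
        lem = solve-∀
        lem₂ : ∀ p q m → p * (p * q) * (m * m) ≡ q * (p * m * (p * m))
        lem₂ = solve-∀
      DS* : + D * S* n N ≋ M * - (+ n * + D * z s N) [ M * M ]
      DS* = begin
        + D * S* n N                                                      ≡⟨ cong (λ x → + D * x) (S*-S n N-1) ⟩
        + D * (S n (p ℕ.^ N) - P ^ n * S n (p ℕ.^ N-1))                   ≡⟨ lem (+ D) (S n (p ℕ.^ N)) (P ^ n) (S n (p ℕ.^ N-1)) ⟩
        + D * S n (p ℕ.^ N) - P ^ n * (+ D * S n (p ℕ.^ N-1))             ≈⟨ ≋-- (integral (p ℕ.^ N)) lower ⟩
        M * E - M * (+ (p ℕ.^ suc m) * E)                                 ≡⟨ lem₂ M E (+ (p ℕ.^ suc m)) ⟩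
        M * - (- F)                                                       ≈⟨ ≋-scale M (≋-neg (subst (λ y → + n * + D * z s N ≋ - F [ y ]) (sym (pos-^ p N))
                                                                              (zeta-approximation pr l s D E {z s} _ rational (z-IsZp s) (ζ-value s) N))) ⟨
        M * - (+ n * + D * z s N)                                         ∎
        where
        open ≋-Reasoning (M * M)
        lem : ∀ d x p y → d * (x - p * y) ≡ d * x - p * (d * y)
        lem = solve-∀
        lem₂ : ∀ m e q → m * e - m * (q * e) ≡ m * - (- ((+ 1 - q) * e))
        lem₂ = solve-∀
      scaled : M * (+ d * X) ≋ M * + 0 [ M * M ]
      scaled = begin
        M * (+ d * (W c (suc m) N - - (G * z s N)))                               ≡⟨ cong (λ x → M * (x * X)) (ℤ.pos-* n D) ⟩
        M * (+ n * + D * (W c (suc m) N - - (G * z s N)))                         ≡⟨ lem M (+ n) (+ D) (W c (suc m) N) G (z s N) ⟩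
        + D * (M * (+ n * W c (suc m) N)) - G * (M * - (+ n * + D * z s N))       ≈⟨ ≋-- (≋-*ˡ (+ D) (voronoi c (suc m) N (s≤s z≤n) p∤c)) (≋-*ˡ G DS*) ⟨
        + D * (G * S* n N) - G * (+ D * S* n N)                                   ≡⟨ lem₂ (+ D) G (S* n N) M ⟩
        M * + 0                                                                   ∎
        where
        open ≋-Reasoning (M * M)
        lem : ∀ m n d w c z → m * (n * d * (w - - (c * z))) ≡ d * (m * (n * w)) - c * (m * - (n * d * z))
        lem = solve-∀
        lem₂ : ∀ d c s m → d * (c * s) - c * (d * s) ≡ m * + 0
        lem₂ = solve-∀
      divisible : P ^ (d ℕ.+ k) ∣ + d * X
      divisible = Signed.∣-trans (^-∣ P d+k≤N) (subst (_∣ + d * X) (pos-^ p N)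
        (≋0⇒∣ (≋-unscale M {{ℕ.m^n≢0 p N}} scaled)))

  -- A single `N` serves all k ≤ r, so the values of `W` form one sum over `a` of geometric
  -- progressions in `k` with ratio (ca)^(p-1). The factor c^l - 1 is prime to `p` and independent
  -- of `k`, so it can be taken out of the difference and cancelled.
  kummer-with : ∀ r s c N → ¬ (+ p ∣ + c) → (+ c) ^ (p ℕ.∸ 1) ≋ + 1 [ (+ p) ^ r ] → ¬ (+ p ∣ (+ c) ^ l - + 1) →
    (∀ k → k ℕ.≤ r → W c (ℕ.pred (weight (s ℕ.+ k))) N ≋ - (((+ c) ^ weight (s ℕ.+ k) - + 1) * z (s ℕ.+ k) r) [ (+ p) ^ r ]) →
    diff r (λ k → z (s ℕ.+ k) r) ≋ + 0 [ (+ p) ^ r ]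
  kummer-with r s c N p∤c G^[p-1]≋1 p∤G^l-1 voronoi-N = ∣⇒≋0 (p^-cancel pr r (G ^ l - + 1) _ p∤G^l-1 (≋0⇒∣ (begin
    (G ^ l - + 1) * diff r (λ k → z (s ℕ.+ k) r)
      ≡⟨ diff-*ˡ r (G ^ l - + 1) (λ k → z (s ℕ.+ k) r) ⟨
    diff r (λ k → (G ^ l - + 1) * z (s ℕ.+ k) r)
      ≈⟨ diff-≋ r {λ k → (G ^ l - + 1) * z (s ℕ.+ k) r} {λ k → - + 1 * W c (ℕ.pred (weight (s ℕ.+ k))) N} term ⟩
    diff r (λ k → - + 1 * W c (ℕ.pred (weight (s ℕ.+ k))) N)
      ≡⟨ diff-*ˡ r (- + 1) (λ k → W c (ℕ.pred (weight (s ℕ.+ k))) N) ⟩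
    - + 1 * diff r (λ k → W c (ℕ.pred (weight (s ℕ.+ k))) N)
      ≡⟨ cong (λ x → - + 1 * x) (trans (diff-cong r (λ k → Σ-cong (p ℕ.^ N) (λ a → geometric a k)))
           (trans (diff-Σ r (p ℕ.^ N) (λ a k → A a * v a ^ k)) (Σ-cong (p ℕ.^ N) (λ a → diff-geometric r (A a) (v a))))) ⟩
    - + 1 * Σ< (p ℕ.^ N) (λ a → A a * (v a - + 1) ^ r)
      ≈⟨ ≋0-*ˡ (- + 1) (Σ-≋0 (p ℕ.^ N) {λ a → A a * (v a - + 1) ^ r} (λ a _ → vanish a)) ⟩
    + 0 ∎)))
    where
    open ≋-Reasoning ((+ p) ^ r)
    G = + c
    G^weight : ∀ t → G ^ weight t ≋ G ^ l [ (+ p) ^ r ]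
    G^weight t = begin
      G ^ weight t                         ≡⟨ ℤ.^-distribˡ-+-* G l (t ℕ.* (p ℕ.∸ 1)) ⟩
      G ^ l * G ^ (t ℕ.* (p ℕ.∸ 1))        ≡⟨ cong (λ n → G ^ l * G ^ n) (ℕ.*-comm t (p ℕ.∸ 1)) ⟩
      G ^ l * G ^ ((p ℕ.∸ 1) ℕ.* t)        ≡⟨ cong (λ x → G ^ l * x) (ℤ.^-*-assoc G (p ℕ.∸ 1) t) ⟨
      G ^ l * (G ^ (p ℕ.∸ 1)) ^ t          ≈⟨ ≋-*ˡ (G ^ l) (≋-^ t G^[p-1]≋1) ⟩
      G ^ l * (+ 1) ^ t                    ≡⟨ trans (cong (λ x → G ^ l * x) (ℤ.^-zeroˡ t)) (ℤ.*-identityʳ (G ^ l)) ⟩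
      G ^ l                                ∎
    term : ∀ k → k ℕ.≤ r → (G ^ l - + 1) * z (s ℕ.+ k) r ≋ - + 1 * W c (ℕ.pred (weight (s ℕ.+ k))) N [ (+ p) ^ r ]
    term k k≤r = ≋-sym (begin
      - + 1 * W c (ℕ.pred (weight (s ℕ.+ k))) N
        ≈⟨ ≋-*ˡ (- + 1) (voronoi-N k k≤r) ⟩
      - + 1 * - ((G ^ weight (s ℕ.+ k) - + 1) * z (s ℕ.+ k) r)
        ≡⟨ lem ((G ^ weight (s ℕ.+ k) - + 1) * z (s ℕ.+ k) r) ⟩
      (G ^ weight (s ℕ.+ k) - + 1) * z (s ℕ.+ k) r
        ≈⟨ ≋-*ʳ (z (s ℕ.+ k) r) (≋-- (G^weight (s ℕ.+ k)) (≋-refl {+ 1})) ⟩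
      (G ^ l - + 1) * z (s ℕ.+ k) r ∎)
      where
      lem : ∀ x → - + 1 * - x ≡ x
      lem = solve-∀
    x : ℕ → ℤ
    x a = + (c ℕ.* a)
    v A : ℕ → ℤ
    v a = x a ^ (p ℕ.∸ 1)
    A a = χ a * (+ (c ℕ.* a /p^ N) * x a ^ ℕ.pred (weight s))
    geometric : ∀ a k → χ a * (+ (c ℕ.* a /p^ N) * x a ^ ℕ.pred (weight (s ℕ.+ k))) ≡ A a * v a ^ k
    geometric a k = trans (cong (λ y → χ a * (+ (c ℕ.* a /p^ N) * y)) split)
      (lem (χ a) (+ (c ℕ.* a /p^ N)) (x a ^ ℕ.pred (weight s)) (v a ^ k))
      where
      lem : ∀ h f y w → h * (f * (y * w)) ≡ h * (f * y) * w
      lem = solve-∀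
      exponent : ℕ.pred (weight (s ℕ.+ k)) ≡ ℕ.pred (weight s) ℕ.+ (p ℕ.∸ 1) ℕ.* k
      exponent = cong suc (trans (cong (l′ ℕ.+_) (ℕ.*-distribʳ-+ (p ℕ.∸ 1) s k))
        (trans (sym (ℕ.+-assoc l′ (s ℕ.* (p ℕ.∸ 1)) (k ℕ.* (p ℕ.∸ 1))))
          (cong (λ y → l′ ℕ.+ s ℕ.* (p ℕ.∸ 1) ℕ.+ y) (ℕ.*-comm k (p ℕ.∸ 1)))))
      split : x a ^ ℕ.pred (weight (s ℕ.+ k)) ≡ x a ^ ℕ.pred (weight s) * v a ^ k
      split = trans (cong (x a ^_) exponent) (trans (ℤ.^-distribˡ-+-* (x a) (ℕ.pred (weight s)) ((p ℕ.∸ 1) ℕ.* k))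
        (cong (λ y → x a ^ ℕ.pred (weight s) * y) (sym (ℤ.^-*-assoc (x a) (p ℕ.∸ 1) k))))
    vanish : ∀ a → A a * (v a - + 1) ^ r ≋ + 0 [ (+ p) ^ r ]
    vanish a = ≋-trans (≋-reflexive (ℤ.*-assoc (χ a) _ _))
      (≋-trans (χ-≋ (λ p∤a → ≋0-*ˡ (+ (c ℕ.* a /p^ N) * x a ^ ℕ.pred (weight s)) (^-≋0 r (≋⇒-≋0 (unit p∤a)))))
        (≋-reflexive (ℤ.*-zeroʳ (χ a))))
      where
      unit : ¬ p ℕ.∣ a → v a ≋ + 1 [ + p ]
      unit p∤a = fermat-unit pr (c ℕ.* a) (λ h → [ p∤c , (λ y → p∤a (Signed.∣⇒∣ᵤ y)) ]′ (prime-∣* pr (+ c) (+ a) (subst (+ p ∣_) (ℤ.pos-* c a) h)))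
      ^-≋0 : ∀ {y} r → y ≋ + 0 [ + p ] → y ^ r ≋ + 0 [ (+ p) ^ r ]
      ^-≋0 zero    h = ∣⇒≋0 (divides (+ 1) refl)
      ^-≋0 {y} (suc r) h with ≋0⇒∣ h | ≋0⇒∣ (^-≋0 r h)
      ... | divides i refl | divides j eq = ∣⇒≋0 (divides (i * j) (trans (cong (λ w → i * + p * w) eq) (lem i j (+ p) ((+ p) ^ r))))
        where
        lem : ∀ i j p q → i * p * (j * q) ≡ i * j * (p * q)
        lem = solve-∀

  -- Replacing g by c = g ^ p ^ r makes c ^ (p - 1) trivial modulo p ^ r, so that the Voronoi factor
  -- c ^ weight s - 1 does not depend on s and can be cancelled.
  teichmüller-like : ∀ r g → ¬ (+ p ∣ + g) → ¬ ((+ g) ^ l ≋ + 1 [ + p ]) → ∃ λ c →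
    ¬ (+ p ∣ + c) × (+ c) ^ (p ℕ.∸ 1) ≋ + 1 [ (+ p) ^ r ] × ¬ (+ p ∣ (+ c) ^ l - + 1)
  teichmüller-like r g p∤g g^l≢1 = c , p∤c , G^[p-1]≋1 , p∤G^l-1
    where
    c = g ℕ.^ (p ℕ.^ r)
    G = + c
    G≡ : G ≡ (+ g) ^ (p ℕ.^ r)
    G≡ = pos-^ g (p ℕ.^ r)
    p∤c : ¬ (+ p ∣ + c)
    p∤c = subst (λ x → ¬ (+ p ∣ x)) (sym G≡) (^-∤ pr (+ g) (p ℕ.^ r) p∤g)
    G≋g : G ≋ + g [ + p ]
    G≋g = subst (λ x → x ≋ + g [ + p ]) (sym G≡) (frobenius r)
      where
      frobenius : ∀ r → (+ g) ^ (p ℕ.^ r) ≋ + g [ + p ]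
      frobenius zero    = ≋-reflexive (ℤ.*-identityʳ (+ g))
      frobenius (suc r) = ≋-trans (≋-reflexive (sym (ℤ.^-*-assoc (+ g) p (p ℕ.^ r))))
        (≋-trans (≋-^ (p ℕ.^ r) (fermat pr g)) (frobenius r))
    G^[p-1]≋1 : G ^ (p ℕ.∸ 1) ≋ + 1 [ (+ p) ^ r ]
    G^[p-1]≋1 = subst (λ x → x ≋ + 1 [ (+ p) ^ r ])
      (trans (ℤ.^-*-assoc (+ g) (p ℕ.∸ 1) (p ℕ.^ r)) (trans (cong (λ n → (+ g) ^ n) (ℕ.*-comm (p ℕ.∸ 1) (p ℕ.^ r)))
        (trans (sym (ℤ.^-*-assoc (+ g) (p ℕ.^ r) (p ℕ.∸ 1))) (cong (_^ (p ℕ.∸ 1)) (sym G≡)))))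
      (≋-∣ (^-∣ (+ p) (ℕ.n≤1+n r)) (lift-1 pr r (fermat-unit pr g p∤g)))
    p∤G^l-1 : ¬ (+ p ∣ G ^ l - + 1)
    p∤G^l-1 h = g^l≢1 (≋-trans (≋-sym (≋-^ l G≋g)) (∣⇒≋ h))

  -- The range 0 < l < p - 1 supplies a `g` prime to `p` whose l-th power is not 1 modulo `p`, from
  -- which an admissible `c` is made.
  kummer : suc l ℕ.< p → ∀ r s → diff r (λ k → z (s ℕ.+ k) r) ≋ + 0 [ (+ p) ^ r ]
  kummer l+1<p r s = with-root (nonroot pr l (s≤s z≤n) l+1<p)
    where
    Goal = diff r (λ k → z (s ℕ.+ k) r) ≋ + 0 [ (+ p) ^ r ]
    Sum : ℕ → ℕ → ℕ → Set
    Sum c k N = W c (ℕ.pred (weight (s ℕ.+ k))) N ≋ - (((+ c) ^ weight (s ℕ.+ k) - + 1) * z (s ℕ.+ k) r) [ (+ p) ^ r ]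
    with-sum : ∀ c → ¬ (+ p ∣ + c) → (+ c) ^ (p ℕ.∸ 1) ≋ + 1 [ (+ p) ^ r ] → ¬ (+ p ∣ (+ c) ^ l - + 1) →
      (∃ λ N → ∀ k → k ℕ.≤ r → Sum c k N) → Goal
    with-sum c p∤c c^[p-1]≋1 p∤c^l-1 (N , h) = kummer-with r s c N p∤c c^[p-1]≋1 p∤c^l-1 h
    with-unit : (∃ λ c → ¬ (+ p ∣ + c) × (+ c) ^ (p ℕ.∸ 1) ≋ + 1 [ (+ p) ^ r ] × ¬ (+ p ∣ (+ c) ^ l - + 1)) → Goal
    with-unit (c , p∤c , c^[p-1]≋1 , p∤c^l-1) = with-sum c p∤c c^[p-1]≋1 p∤c^l-1
      (bounded-choice r (Sum c) (λ k → zeta-voronoi c p∤c (s ℕ.+ k) r))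
    with-root : (∃ λ g → ¬ (+ p ∣ + g) × ¬ ((+ g) ^ l ≋ + 1 [ + p ])) → Goal
    with-root (g , p∤g , g^l≢1) = with-unit (teichmüller-like r g p∤g g^l≢1)

-- Passage from natural to p-adic arguments

module Interpolation {p : ℕ} (pr : Prime p) (l′ : ℕ) (ζ : Seq → Seq) (ζ-fun : IsZpFun p ζ)
  (ζ-value : ∀ s → EqRat p (ζ (ιℕ s)) (zetaValue p (suc (suc l′)) s)) (ζ-continuous : IsContinuous p ζ) where

  open Kummer pr l′ ζ ζ-fun ζ-value

  -- Continuity at each of s, ..., s + r gives a threshold. The residue of `s` modulo p^N, with `N`
  -- above all thresholds, is one natural number that serves every shift, so whole differences can
  -- be transported.
  approximate-by-naturals : ∀ s → IsZp p s → ∀ n r →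
    ∃ λ t → ∀ k → k ℕ.≤ r → ζ (s +Z ιℕ k) n ≋ z (t ℕ.+ k) n [ (+ p) ^ n ]
  approximate-by-naturals s zs n r = finish (bounded-choice r
    (λ k N → ∀ t → + t ≋ s N [ (+ p) ^ N ] → ζ (s +Z ιℕ k) n ≋ z (t ℕ.+ k) n [ (+ p) ^ n ])
    (λ k → from-continuity k (ζ-continuous (s +Z ιℕ k) (+Z-IsZp {x = s} {ιℕ k} zs (ι-IsZp p (+ k))) n)))
    where
    from-continuity : ∀ k → (∃ λ m → ∀ t → IsZp p t → CongMod p m (s +Z ιℕ k) t → CongMod p n (ζ (s +Z ιℕ k)) (ζ t)) →
      ∃ λ N₀ → ∀ N → N₀ ℕ.≤ N → ∀ t → + t ≋ s N [ (+ p) ^ N ] → ζ (s +Z ιℕ k) n ≋ z (t ℕ.+ k) n [ (+ p) ^ n ]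
    from-continuity k (m , close) = m , λ N m≤N t t≋s → CongMod⇒≋ {p} {n} {ζ (s +Z ιℕ k)} {z (t ℕ.+ k)}
      (close (ιℕ (t ℕ.+ k)) (ι-IsZp p (+ (t ℕ.+ k))) (≋⇒CongMod {p} {m} {s +Z ιℕ k} {ιℕ (t ℕ.+ k)}
        (≋-+ (≋-trans (≋-sym (IsZp-coherent {x = s} zs m≤N)) (≋-sym (≋-∣ (^-∣ (+ p) m≤N) t≋s))) (≋-refl {+ k}))))
    finish : (∃ λ N → ∀ k → k ℕ.≤ r → ∀ t → + t ≋ s N [ (+ p) ^ N ] → ζ (s +Z ιℕ k) n ≋ z (t ℕ.+ k) n [ (+ p) ^ n ]) →
      ∃ λ t → ∀ k → k ℕ.≤ r → ζ (s +Z ιℕ k) n ≋ z (t ℕ.+ k) n [ (+ p) ^ n ]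
    finish (N , h) = residue , λ k k≤r → h k k≤r residue residue≋
      where
      instance
        p^N≢0 : ℕ.NonZero (p ℕ.^ N)
        p^N≢0 = ℕ.m^n≢0 p N {{prime⇒nonZero pr}}
      residue = s N ℤ.%ℕ p ℕ.^ N
      residue≋ : + residue ≋ s N [ (+ p) ^ N ]
      residue≋ = ≋-sym (subst (λ m → s N ≋ + residue [ m ]) (pos-^ p N) (by (s N ℤ./ℕ p ℕ.^ N) (ℤ.a≡a%ℕn+[a/ℕn]*n (s N) (p ℕ.^ N))))

  ζ-InK : suc l ℕ.< p → InK p ζ
  ζ-InK l+1<p = ζ-fun , λ s zs n → differences s n (approximate-by-naturals s zs n n)
    where
    differences : ∀ s n → (∃ λ t → ∀ k → k ℕ.≤ n → ζ (s +Z ιℕ k) n ≋ z (t ℕ.+ k) n [ (+ p) ^ n ]) →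
      CongMod p n (Δ^ n ζ s) (ι (+ 0))
    differences s n (t , h) = ≋⇒CongMod {p} {n} {Δ^ n ζ s} {ι (+ 0)} (≋-trans (≋-reflexive (Δ^≡diff n ζ s n))
      (≋-trans (diff-≋ n {λ k → ζ (s +Z ιℕ k) n} {λ k → z (t ℕ.+ k) n} h) (kummer l+1<p n t)))

  z-step : suc l ℕ.< p → ∀ t → z (suc t) 1 ≋ z t 1 [ (+ p) ^ 1 ]
  z-step l+1<p t = subst₂ (λ i j → z i 1 ≋ z j 1 [ (+ p) ^ 1 ]) (ℕ.+-comm t 1) (ℕ.+-identityʳ t)
    (-≋0⇒≋ (≋-trans (≋-reflexive (sym (trans (diff-suc 0 (λ k → z (t ℕ.+ k) 1)) (diff-0 (λ k → z (t ℕ.+ suc k) 1 - z (t ℕ.+ k) 1)))))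
      (kummer l+1<p 1 t)))

  ζ-constant : suc l ℕ.< p → ∀ s → IsZp p s → ζ s 1 ≋ z 0 1 [ (+ p) ^ 1 ]
  ζ-constant l+1<p s zs = ≋-trans shift (from-naturals (approximate-by-naturals s zs 1 0))
    where
    iterate : ∀ t → z t 1 ≋ z 0 1 [ (+ p) ^ 1 ]
    iterate zero    = ≋-refl
    iterate (suc t) = ≋-trans (z-step l+1<p t) (iterate t)
    -- The two sequences agree only pointwise, so the step from `s` to `s +Z ιℕ 0` uses that ζ
    -- respects equality in Z_p.
    s+0≈s : s ≈[ p ] (s +Z ιℕ 0)
    s+0≈s k = ≋⇒CongMod {p} {k} {s} {s +Z ιℕ 0} (≋-reflexive (sym (ℤ.+-identityʳ (s k))))
    shift : ζ s 1 ≋ ζ (s +Z ιℕ 0) 1 [ (+ p) ^ 1 ]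
    shift = CongMod⇒≋ {p} {1} {ζ s} {ζ (s +Z ιℕ 0)} (proj₂ ζ-fun s (s +Z ιℕ 0) zs (+Z-IsZp {x = s} {ιℕ 0} zs (ι-IsZp p (+ 0))) s+0≈s 1)
    from-naturals : (∃ λ t → ∀ k → k ℕ.≤ 0 → ζ (s +Z ιℕ k) 1 ≋ z (t ℕ.+ k) 1 [ (+ p) ^ 1 ]) → ζ (s +Z ιℕ 0) 1 ≋ z 0 1 [ (+ p) ^ 1 ]
    from-naturals (t , h) = ≋-trans (h 0 z≤n) (iterate (t ℕ.+ 0))

-- Power sums over p-power ranges

S-blocks : ∀ m k M → S m (k ℕ.* M) ≡ Σ< k (λ b → Σ< M (λ a → (+ a + + b * + M) ^ m))
S-blocks m k M = trans (Σ-blocks k M (λ a → (+ a) ^ m))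
  (Σ-cong k (λ b → Σ-cong M (λ a → cong (_^ m) (cong (λ x → + a + x) (ℤ.pos-* b M)))))

-- Write the index as a + bM and expand to first order. Summation over `b` leaves the factor
-- `S 1 k`, which is divisible by `p` when k = p.
S-blocks₂ : ∀ m k M → S (suc m) (k ℕ.* M) ≋ + k * S (suc m) M + + suc m * + M * S 1 k * S m M [ + M * + M ]
S-blocks₂ m k M = begin
  S (suc m) (k ℕ.* M)
    ≡⟨ S-blocks (suc m) k M ⟩
  Σ< k (λ b → Σ< M (λ a → (+ a + + b * + M) ^ suc m))
    ≈⟨ Σ-≋ k {λ b → Σ< M (λ a → (+ a + + b * + M) ^ suc m)} {λ b → Σ< M (λ a → term b a)} (λ b _ →
         Σ-≋ M {λ a → (+ a + + b * + M) ^ suc m} {term b} (λ a _ →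
           ≋-∣ (divides (+ b * + b) (sq (+ b) (+ M))) (expand₂ (+ a) (+ b * + M) m))) ⟩
  Σ< k (λ b → Σ< M (λ a → term b a))
    ≡⟨ Σ-cong k (λ b → trans (Σ-+ M (λ a → (+ a) ^ suc m) (λ a → + suc m * (+ a) ^ m * (+ b * + M)))
         (cong (λ x → S (suc m) M + x) (trans (Σ-cong M (λ a → lem (+ suc m) ((+ a) ^ m) (+ b) (+ M))) (Σ-*ˡ M (+ suc m * + M * (+ b) ^ 1) (λ a → (+ a) ^ m))))) ⟩
  Σ< k (λ b → S (suc m) M + + suc m * + M * (+ b) ^ 1 * S m M)
    ≡⟨ Σ-+ k (λ _ → S (suc m) M) (λ b → + suc m * + M * (+ b) ^ 1 * S m M) ⟩
  Σ< k (λ _ → S (suc m) M) + Σ< k (λ b → + suc m * + M * (+ b) ^ 1 * S m M)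
    ≡⟨ cong₂ _+_ (Σ-const k (S (suc m) M)) (trans (Σ-*ʳ k (S m M) (λ b → + suc m * + M * (+ b) ^ 1)) (cong (_* S m M) (Σ-*ˡ k (+ suc m * + M) (λ b → (+ b) ^ 1)))) ⟩
  + k * S (suc m) M + + suc m * + M * S 1 k * S m M ∎
  where
  open ≋-Reasoning (+ M * + M)
  term : ℕ → ℕ → ℤ
  term b a = (+ a) ^ suc m + + suc m * (+ a) ^ m * (+ b * + M)
  sq : ∀ b m → b * m * (b * m) ≡ b * b * (m * m)
  sq = solve-∀
  lem : ∀ s a b m → s * a * (b * m) ≡ s * m * (b * + 1) * a
  lem = solve-∀

-- The third-order version of `S-blocks₂`, for the digit gained when l ≠ 2. Of the cubic term only
-- the factor M³ `S 3 k` matters, so `Q` is left unspecified.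
S-blocks₄ : ∀ m k M → ∃ λ Q → S (suc (suc m)) (k ℕ.* M) ≋
  + k * S (suc (suc m)) M + (+ suc (suc m) * + M * S 1 k * S (suc m) M + (quadCoeff m * (+ M * + M) * S 2 k * S m M + + M * + M * + M * S 3 k * Q))
  [ + M * + M * + M * + M ]
S-blocks₄ m k M = Q , (begin
  S n (k ℕ.* M)
    ≡⟨ S-blocks n k M ⟩
  Σ< k (λ b → Σ< M (λ a → (+ a + + b * + M) ^ n))
    ≈⟨ Σ-≋ k {λ b → Σ< M (λ a → (+ a + + b * + M) ^ n)} {λ b → Σ< M (λ a → term b a)} (λ b _ →
         Σ-≋ M {λ a → (+ a + + b * + M) ^ n} {term b} (λ a _ →
           ≋-trans (≋-∣ (divides (+ b * + b * + b * + b) (sq (+ b) (+ M))) (expand₄ (+ a) (+ b * + M) m))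
             (≋-reflexive (lem (+ n) ((+ a) ^ n) ((+ a) ^ suc m) ((+ a) ^ m) (quadCoeff m) (cubicTerm m (+ a)) (+ b) (+ M))))) ⟩
  Σ< k (λ b → Σ< M (λ a → term b a))
    ≡⟨ Σ-cong k inner ⟩
  Σ< k (λ b → S n M + (c₁ b * S (suc m) M + (c₂ b * S m M + c₃ b * Q)))
    ≡⟨ split k (λ _ → S n M) (λ b → c₁ b * S (suc m) M) (λ b → c₂ b * S m M) (λ b → c₃ b * Q) ⟩
  Σ< k (λ _ → S n M) + (Σ< k (λ b → c₁ b * S (suc m) M) + (Σ< k (λ b → c₂ b * S m M) + Σ< k (λ b → c₃ b * Q)))
    ≡⟨ cong₂ _+_ (Σ-const k (S n M)) (cong₂ _+_ (factor 1 (+ n * + M) (S (suc m) M)) (cong₂ _+_ (factor 2 (quadCoeff m * (+ M * + M)) (S m M)) (factor 3 (+ M * + M * + M) Q))) ⟩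
  + k * S n M + (+ n * + M * S 1 k * S (suc m) M + (quadCoeff m * (+ M * + M) * S 2 k * S m M + + M * + M * + M * S 3 k * Q)) ∎)
  where
  open ≋-Reasoning (+ M * + M * + M * + M)
  n = suc (suc m)
  Q = Σ< M (λ a → cubicTerm m (+ a))
  c₁ c₂ c₃ : ℕ → ℤ
  c₁ b = + n * + M * (+ b) ^ 1
  c₂ b = quadCoeff m * (+ M * + M) * (+ b) ^ 2
  c₃ b = + M * + M * + M * (+ b) ^ 3
  term : ℕ → ℕ → ℤ
  term b a = (+ a) ^ n + (c₁ b * (+ a) ^ suc m + (c₂ b * (+ a) ^ m + c₃ b * cubicTerm m (+ a)))
  sq : ∀ b m → b * m * (b * m) * (b * m) * (b * m) ≡ b * b * b * b * (m * m * m * m)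
  sq = solve-∀
  lem : ∀ s x y w t q b m → x + s * y * (b * m) + t * w * (b * m * (b * m)) + q * (b * m * (b * m) * (b * m))
      ≡ x + (s * m * (b * + 1) * y + (t * (m * m) * (b * (b * + 1)) * w + m * m * m * (b * (b * (b * + 1))) * q))
  lem = solve-∀
  split : ∀ K (f g h i : ℕ → ℤ) → Σ< K (λ b → f b + (g b + (h b + i b))) ≡ Σ< K f + (Σ< K g + (Σ< K h + Σ< K i))
  split K f g h i = trans (Σ-+ K f (λ b → g b + (h b + i b))) (cong (λ x → Σ< K f + x)
    (trans (Σ-+ K g (λ b → h b + i b)) (cong (λ x → Σ< K g + x) (Σ-+ K h i))))
  inner : ∀ b → Σ< M (λ a → term b a) ≡ S n M + (c₁ b * S (suc m) M + (c₂ b * S m M + c₃ b * Q))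
  inner b = trans (split M (λ a → (+ a) ^ n) (λ a → c₁ b * (+ a) ^ suc m) (λ a → c₂ b * (+ a) ^ m) (λ a → c₃ b * cubicTerm m (+ a)))
    (cong (λ x → S n M + x) (cong₂ _+_ (Σ-*ˡ M (c₁ b) (λ a → (+ a) ^ suc m))
      (cong₂ _+_ (Σ-*ˡ M (c₂ b) (λ a → (+ a) ^ m)) (Σ-*ˡ M (c₃ b) (λ a → cubicTerm m (+ a))))))
  factor : ∀ j x y → Σ< k (λ b → x * (+ b) ^ j * y) ≡ x * S j k * y
  factor j x y = trans (Σ-*ʳ k y (λ b → x * (+ b) ^ j)) (cong (_* y) (Σ-*ˡ k x (λ b → (+ b) ^ j)))

∣-*-mono : ∀ {a b c d} → a ∣ b → c ∣ d → a * c ∣ b * d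
∣-*-mono {a} {b} {c} {d} (divides q refl) (divides r refl) = divides (q * r) (lem q a r c)
  where
  lem : ∀ q a r c → q * a * (r * c) ≡ q * r * (a * c)
  lem = solve-∀

module OddPrime {p : ℕ} (pr : Prime p) (3<p : 3 ℕ.< p) where

  private
    P = + p
    instance
      p≢0 : ℕ.NonZero p
      p≢0 = prime⇒nonZero pr

  -- `S≋0` for the exponent 3 requires it; 4 = 2 · 2 is not prime.
  4<p : 4 ℕ.< p
  4<p = ℕ.≤∧≢⇒< 3<p (λ 4≡p → [ not≤2 4≡p , not≤2 4≡p ]′ (euclidsLemma 2 2 pr (subst (ℕ._∣ 4) 4≡p ℕ.∣-refl)))
    where
    not≤2 : 4 ≡ p → ¬ (p ℕ.∣ 2)
    not≤2 refl = ℕ.>⇒∤ (s≤s (s≤s (s≤s z≤n)))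

  p-1-even : 2 ℕ.∣ p ℕ.∸ 1
  p-1-even = from-parity (p ℕ.% 2) (ℕ.m%n<n p 2) (ℕ.m≡m%n+[m/n]*n p 2)
    where
    from-parity : ∀ r → r ℕ.< 2 → p ≡ r ℕ.+ p ℕ./ 2 ℕ.* 2 → 2 ℕ.∣ p ℕ.∸ 1
    from-parity zero _ eq = [ (λ ()) , (λ 2≡p → contradiction 2≡p (ℕ.<⇒≢ (ℕ.<-trans (s≤s (s≤s (s≤s z≤n))) 3<p))) ]′
      (prime⇒irreducible pr (ℕ.divides (p ℕ./ 2) eq))
    from-parity (suc zero) _ eq = ℕ.divides (p ℕ./ 2) (cong (ℕ._∸ 1) eq)
    from-parity (suc (suc _)) (s≤s (s≤s ())) _

  S1≋0 : S 1 p ≋ + 0 [ P ]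
  S1≋0 = S≋0 pr 1 (ℕ.<-trans (s≤s (s≤s (s≤s z≤n))) 3<p)
  S2≋0 : S 2 p ≋ + 0 [ P ]
  S2≋0 = S≋0 pr 2 3<p
  S3≋0 : S 3 p ≋ + 0 [ P ]
  S3≋0 = S≋0 pr 3 4<p

  S-period : ∀ m s → S (suc m ℕ.+ s ℕ.* (p ℕ.∸ 1)) p ≋ S (suc m) p [ P ]
  S-period m s = Σ-≋ p {λ a → (+ a) ^ (suc m ℕ.+ s ℕ.* (p ℕ.∸ 1))} {λ a → (+ a) ^ suc m} (λ a _ → term a)
    where
    term : ∀ a → (+ a) ^ (suc m ℕ.+ s ℕ.* (p ℕ.∸ 1)) ≋ (+ a) ^ suc m [ P ]
    term a with P Signed.∣? + a
    ... | yes p∣a = ≋-trans (≋0-*ʳ ((+ a) ^ (m ℕ.+ s ℕ.* (p ℕ.∸ 1))) (∣⇒≋0 p∣a)) (≋-sym (≋0-*ʳ ((+ a) ^ m) (∣⇒≋0 p∣a)))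
    ... | no  p∤a = begin
      (+ a) ^ (suc m ℕ.+ s ℕ.* (p ℕ.∸ 1))
        ≡⟨ ℤ.^-distribˡ-+-* (+ a) (suc m) (s ℕ.* (p ℕ.∸ 1)) ⟩
      (+ a) ^ suc m * (+ a) ^ (s ℕ.* (p ℕ.∸ 1))
        ≡⟨ cong (λ n → (+ a) ^ suc m * n) (trans (cong ((+ a) ^_) (ℕ.*-comm s (p ℕ.∸ 1))) (sym (ℤ.^-*-assoc (+ a) (p ℕ.∸ 1) s))) ⟩
      (+ a) ^ suc m * ((+ a) ^ (p ℕ.∸ 1)) ^ s
        ≈⟨ ≋-*ˡ ((+ a) ^ suc m) (≋-trans (≋-^ s (fermat-unit pr a p∤a)) (≋-reflexive (ℤ.^-zeroˡ s))) ⟩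
      (+ a) ^ suc m * + 1
        ≡⟨ ℤ.*-identityʳ ((+ a) ^ suc m) ⟩
      (+ a) ^ suc m ∎
      where open ≋-Reasoning P

  S-vanish : ∀ m s → suc (suc m) ℕ.< p → S (suc m ℕ.+ s ℕ.* (p ℕ.∸ 1)) p ≋ + 0 [ P ]
  S-vanish m s m+2<p = ≋-trans (S-period m s) (S≋0 pr (suc m) m+2<p)

  -- The substitution a ↦ p - a.
  S-reflection : ∀ m → 2 ℕ.∣ suc m → S (suc m) p ≋ + 0 [ P ] → S (suc (suc m)) p ≋ + 0 [ P * P ]
  S-reflection m (ℕ.divides j m+1≡j*2) Sm≋0 = ∣⇒≋0 (subst (_∣ S n p) P²≡ (p^-cancel pr 2 (+ 2) (S n p) (<p⇒∤ pr (s≤s z≤n) (ℕ.<-trans (s≤s (s≤s (s≤s z≤n))) 3<p))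
    (subst (_∣ + 2 * S n p) (sym P²≡) (≋0⇒∣ (begin
      + 2 * S n p
        ≡⟨ double (S n p) (P ^ n) ⟩
      (S n p + P ^ n) + (S n p - P ^ n)
        ≈⟨ ≋-+ reflected (≋-refl {S n p - P ^ n}) ⟩
      (- (S n p + P ^ n) + + n * P * (S (suc m) p + P ^ suc m)) + (S n p - P ^ n)
        ≡⟨ regroup (S n p) (P ^ suc m) (P) (+ n) (S (suc m) p) ⟩
      + n * (P * S (suc m) p) + (+ n - + 2) * (P * P ^ suc m)
        ≈⟨ ≋-+ (≋0-*ˡ (+ n) (≋-trans (≋-scale P Sm≋0) (≋-reflexive (ℤ.*-zeroʳ P))))
             (≋0-*ˡ (+ n - + 2) (∣⇒≋0 (divides (P ^ m) (assoc P (P ^ m))))) ⟩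
      + 0 ∎)))))
    where
    n = suc (suc m)
    open ≋-Reasoning (P * P)
    P²≡ : P ^ 2 ≡ P * P
    P²≡ = cong (P *_) (ℤ.*-identityʳ P)
    double : ∀ s x → + 2 * s ≡ (s + x) + (s - x)
    double = solve-∀
    regroup : ∀ s q p n t → (- (s + p * q) + n * p * (t + q)) + (s - p * q) ≡ n * (p * t) + (n - + 2) * (p * q)
    regroup = solve-∀
    assoc : ∀ p q → p * (p * q) ≡ q * (p * p)
    assoc = solve-∀
    even-power : ∀ x → (- x) ^ suc m ≡ x ^ suc m
    even-power x = trans (via (- x)) (trans (cong (_^ j) (square x)) (sym (via x)))
      where
      via : ∀ y → y ^ suc m ≡ (y * y) ^ j
      via y = trans (cong (y ^_) (trans m+1≡j*2 (ℕ.*-comm j 2))) (trans (sym (ℤ.^-*-assoc y 2 j)) (cong (_^ j) (cong (y *_) (ℤ.*-identityʳ y))))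
      square : ∀ x → (- x) * (- x) ≡ x * x
      square = solve-∀
    -- The range is extended to include `p`, so that reversing it is exactly i ↦ p - i; the
    -- additional p^k is corrected in the final count.
    S-suc : ∀ k → Σ< (suc p) (λ a → (+ a) ^ k) ≡ S k p + P ^ k
    S-suc k = Σ-last p (λ a → (+ a) ^ k)
    term : ∀ i → i ℕ.< suc p → (+ (p ℕ.∸ i)) ^ n ≋ - ((+ i) ^ n) + + n * P * (+ i) ^ suc m [ P * P ]
    term i (s≤s i≤p) = begin
      (+ (p ℕ.∸ i)) ^ n
        ≡⟨ cong (_^ n) (trans (sym (ℤ.⊖-≥ i≤p)) (trans (sym (ℤ.m-n≡m⊖n p i)) (ℤ.+-comm P (- + i)))) ⟩
      (- + i + P) ^ n
        ≈⟨ expand₂ (- + i) P (suc m) ⟩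
      - + i * (- + i) ^ suc m + + n * (- + i) ^ suc m * P
        ≡⟨ cong (λ y → - + i * y + + n * y * P) (even-power (+ i)) ⟩
      - + i * (+ i) ^ suc m + + n * (+ i) ^ suc m * P
        ≡⟨ lem (+ i) ((+ i) ^ suc m) (+ n) P ⟩
      - ((+ i) ^ n) + + n * P * (+ i) ^ suc m ∎
      where
      lem : ∀ i y n p → - i * y + n * y * p ≡ - (i * y) + n * p * y
      lem = solve-∀
    reflected : S n p + P ^ n ≋ - (S n p + P ^ n) + + n * P * (S (suc m) p + P ^ suc m) [ P * P ]
    reflected = begin
      S n p + P ^ n                                                            ≡⟨ S-suc n ⟨
      Σ< (suc p) (λ a → (+ a) ^ n)                                             ≡⟨ Σ-reverse (suc p) (λ a → (+ a) ^ n) ⟩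
      Σ< (suc p) (λ i → (+ (p ℕ.∸ i)) ^ n)                                     ≈⟨ Σ-≋ (suc p) {λ i → (+ (p ℕ.∸ i)) ^ n} {λ i → - ((+ i) ^ n) + + n * P * (+ i) ^ suc m} term ⟩
      Σ< (suc p) (λ i → - ((+ i) ^ n) + + n * P * (+ i) ^ suc m)               ≡⟨ Σ-+ (suc p) (λ i → - ((+ i) ^ n)) (λ i → + n * P * (+ i) ^ suc m) ⟩
      Σ< (suc p) (λ i → - ((+ i) ^ n)) + Σ< (suc p) (λ i → + n * P * (+ i) ^ suc m)
        ≡⟨ cong₂ _+_ (trans (Σ-neg (suc p) (λ i → (+ i) ^ n)) (cong -_ (S-suc n))) (trans (Σ-*ˡ (suc p) (+ n * P) (λ i → (+ i) ^ suc m)) (cong (λ x → + n * P * x) (S-suc (suc m)))) ⟩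
      - (S n p + P ^ n) + + n * P * (S (suc m) p + P ^ suc m) ∎

  -- In `S-blocks₂` with k = p the linear term contains M `S 1 p`, a multiple of pM, and M² is a
  -- multiple of pM as well.
  S-multiple : ∀ m M → + p ∣ + M → S (suc m) (p ℕ.* M) ≋ P * S (suc m) M [ P * + M ]
  S-multiple m M p∣M = ≋-shift (≋-∣ (∣-*-mono p∣M (Signed.∣-refl {+ M})) (S-blocks₂ m p M))
    (≋-trans (≋-reflexive (lem (+ suc m) (+ M) (S 1 p) (S m M))) (≋0-*ˡ (+ suc m * S m M)
      (∣⇒≋0 (∣-*-mono (≋0⇒∣ S1≋0) (Signed.∣-refl {+ M})))))
    where
    lem : ∀ s m x y → s * m * x * y ≡ s * y * (x * m)
    lem = solve-∀

  -- Induction through `S-multiple`, whose modulus p · p^(N+1) is at least p²; this explains the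
  -- bound on `e`.
  S-p^-vanish : ∀ m e → e ℕ.≤ 2 → S (suc m) p ≋ + 0 [ P ^ e ] → ∀ N → S (suc m) (p ℕ.^ suc N) ≋ + 0 [ P ^ e ]
  S-p^-vanish m e e≤2 h zero    = subst (λ M → S (suc m) M ≋ + 0 [ P ^ e ]) (sym (ℕ.*-identityʳ p)) h
  S-p^-vanish m e e≤2 h (suc N) = ≋-trans
    (≋-∣ (subst (P ^ e ∣_) (cong (P *_) (sym (pos-^ p (suc N)))) (^-∣ P {e} {suc (suc N)} (ℕ.≤-trans e≤2 (s≤s (s≤s z≤n)))))
      (S-multiple m (p ℕ.^ suc N) (Signed.∣ᵤ⇒∣ (ℕ.m∣m*n (p ℕ.^ N)))))
    (≋0-*ˡ P (S-p^-vanish m e e≤2 h N))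

  -- Every error term of `S-blocks₄` splits as (multiple of p) · M · (multiple of p^e). The first
  -- factor comes from `S 1 p`, `S 2 p`, `S 3 p`, or from `M` in the remainder M⁴. The last comes
  -- from the two divisibility hypotheses, or from p² dividing M².
  S-multiple₄ : ∀ m e M → e ℕ.≤ 2 → P ∣ + M → P ^ e ∣ S (suc m) M → P ^ e ∣ + M * S m M →
    S (suc (suc m)) (p ℕ.* M) ≋ P * S (suc (suc m)) M [ P * + M * P ^ e ]
  S-multiple₄ m e M e≤2 p∣M h₁ h₂ = from-expansion (S-blocks₄ m p M)
    where
    n = suc (suc m)
    mod = P * + M * P ^ e
    P^e∣M² : P ^ e ∣ + M * + M
    P^e∣M² = Signed.∣-trans (^-∣ P e≤2) (∣-*-mono p∣M (subst (_∣ + M) (sym (ℤ.*-identityʳ P)) p∣M))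
    divisible : ∀ {x y} → P ∣ x → P ^ e ∣ y → mod ∣ x * + M * y
    divisible d₁ d₂ = ∣-*-mono (∣-*-mono d₁ (Signed.∣-refl {+ M})) d₂
    from-expansion : (∃ λ Q → S n (p ℕ.* M) ≋
      P * S n M + (+ n * + M * S 1 p * S (suc m) M + (quadCoeff m * (+ M * + M) * S 2 p * S m M + + M * + M * + M * S 3 p * Q))
      [ + M * + M * + M * + M ]) → S n (p ℕ.* M) ≋ P * S n M [ mod ]
    from-expansion (Q , expansion) = ≋-shift
      (≋-∣ (subst (mod ∣_) (lem₀ (+ M)) (divisible p∣M P^e∣M²)) expansion)
      (≋-+ (≋-trans (≋-reflexive (lem₁ (+ n) (+ M) (S 1 p) (S (suc m) M))) (≋0-*ˡ (+ n) (∣⇒≋0 (divisible (≋0⇒∣ S1≋0) h₁))))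
        (≋-+ (≋-trans (≋-reflexive (lem₂ (quadCoeff m) (+ M) (S 2 p) (S m M))) (≋0-*ˡ (quadCoeff m) (∣⇒≋0 (divisible (≋0⇒∣ S2≋0) h₂))))
          (≋-trans (≋-reflexive (lem₃ (+ M) (S 3 p) Q)) (≋0-*ˡ Q (∣⇒≋0 (divisible (≋0⇒∣ S3≋0) P^e∣M²))))))
      where
      lem₀ : ∀ m → m * m * (m * m) ≡ m * m * m * m
      lem₀ = solve-∀
      lem₁ : ∀ n m s t → n * m * s * t ≡ n * (s * m * t)
      lem₁ = solve-∀
      lem₂ : ∀ q m s t → q * (m * m) * s * t ≡ q * (s * m * (m * t))
      lem₂ = solve-∀
      lem₃ : ∀ m s q → m * m * m * s * q ≡ q * (s * m * (m * m))
      lem₃ = solve-∀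

  -- Iterating `S-multiple₄` keeps the precision relative to the range: `e` digits beyond p^(N+1) at
  -- every level. That is what survives in the limit defining B_n.
  S-p^ : ∀ m e → e ℕ.≤ 2 → S (suc m) p ≋ + 0 [ P ^ e ] → (∀ N → P ^ e ∣ + (p ℕ.^ suc N) * S m (p ℕ.^ suc N)) →
    ∀ N → S (suc (suc m)) (p ℕ.^ suc N) ≋ P ^ N * S (suc (suc m)) p [ P ^ suc N * P ^ e ]
  S-p^ m e e≤2 h₁ h₂ zero = ≋-reflexive (trans (cong (S (suc (suc m))) (ℕ.*-identityʳ p)) (sym (ℤ.*-identityˡ _)))
  S-p^ m e e≤2 h₁ h₂ (suc N) = ≋-trans
    (subst (λ x → S (suc (suc m)) (p ℕ.* M) ≋ P * S (suc (suc m)) M [ P * x * P ^ e ]) (pos-^ p (suc N))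
      (S-multiple₄ m e M e≤2 (Signed.∣ᵤ⇒∣ (ℕ.m∣m*n (p ℕ.^ N))) (≋0⇒∣ (S-p^-vanish m e e≤2 h₁ N)) (h₂ N)))
    (subst₂ (λ x y → P * S (suc (suc m)) M ≋ x [ y ]) (sym (ℤ.*-assoc P (P ^ N) (S (suc (suc m)) p))) (sym (ℤ.*-assoc P (P ^ suc N) (P ^ e)))
      (≋-scale P (S-p^ m e e≤2 h₁ h₂ N)))
    where
    M = p ℕ.^ suc N

  module _ (l′ : ℕ) (l+1<p : suc (suc (suc l′)) ℕ.< p) (l-even : 2 ℕ.∣ suc (suc l′)) (ζ : Seq → Seq) (ζ-fun : IsZpFun p ζ)
    (ζ-value : ∀ s → EqRat p (ζ (ιℕ s)) (zetaValue p (suc (suc l′)) s)) where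

    open Kummer pr l′ ζ ζ-fun ζ-value

    -- For large N, p^(N-1) `S n p` agrees with S n (p^N), hence with p^N B_n, modulo p^(N+e);
    -- dividing by p^(N-1) compares `S n p` with p B_n modulo p^(e+1). The Euler factor 1 - p^(n-1)
    -- multiplies both sides until the last hypothesis removes p^(n-1) `S n p`.
    S-zeta : ∀ s e → let m = l′ ℕ.+ s ℕ.* (p ℕ.∸ 1) in e ℕ.≤ 2 →
      S (suc m) p ≋ + 0 [ P ^ e ] → (∀ N → P ^ e ∣ + (p ℕ.^ suc N) * S m (p ℕ.^ suc N)) →
      P ^ suc e ∣ P ^ suc m * S (suc (suc m)) p →
      S (weight s) p ≋ - (P * (+ weight s * z s e)) [ P ^ suc e ]
    S-zeta s e e≤2 h₁ h₂ h₃ = from-approximation (bernoulli-approximation (weight s))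
      where
      m = l′ ℕ.+ s ℕ.* (p ℕ.∸ 1)
      n = suc (suc m)
      q = + (p ℕ.^ suc m)
      from-approximation : (∃ λ D → ℕ.NonZero D × ∃ λ E → Approximates D E (weight s)) →
        S (weight s) p ≋ - (P * (+ weight s * z s e)) [ P ^ suc e ]
      from-approximation (D , D≢0 , E , approximates rational integral) = -≋0⇒≋ (begin
        S n p - - (P * (+ n * z s e))
          ≡⟨ lem (S n p) P (+ n) (z s e) q ⟩
        ((+ 1 - q) * S n p + P * (+ n * z s e)) + q * S n p
          ≈⟨ ≋-+ unscaled (∣⇒≋0 (subst (λ x → P ^ suc e ∣ x * S n p) (sym (pos-^ p (suc m))) h₃)) ⟩
        + 0 ∎)
        where
        open ≋-Reasoning (P ^ suc e)
        lem : ∀ x p n z q → x - - (p * (n * z)) ≡ ((+ 1 - q) * x + p * (n * z)) + q * x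
        lem = solve-∀
        -- Chosen so that 2N = D + (N + e + 1): the relation modulo p^(2N) may lose `D` digits in
        -- cancelling `D`, and p^(N+e+1) remains, one digit more than is used.
        N₁ = D ℕ.+ e
        N = suc N₁
        M = + (p ℕ.^ N)
        M≡ : M ≡ P ^ N
        M≡ = pos-^ p N
        level : P ^ N * P ^ N ≡ P ^ (D ℕ.+ (N ℕ.+ suc e))
        level = trans (sym (ℤ.^-distribˡ-+-* P N N)) (cong (P ^_) (rearrange D e))
          where
          rearrange : ∀ D e → suc (D ℕ.+ e) ℕ.+ suc (D ℕ.+ e) ≡ D ℕ.+ (suc (D ℕ.+ e) ℕ.+ suc e)
          rearrange D e = trans (ℕ.+-comm (suc (D ℕ.+ e)) (suc (D ℕ.+ e))) (trans (cong (suc (D ℕ.+ e) ℕ.+_) (sym (ℕ.+-suc D e)))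
            (trans (sym (ℕ.+-assoc (suc (D ℕ.+ e)) D (suc e))) (trans (cong (ℕ._+ suc e) (ℕ.+-comm (suc (D ℕ.+ e)) D)) (ℕ.+-assoc D (suc (D ℕ.+ e)) (suc e)))))
        X = (+ 1 - q) * S n (p ℕ.^ N) + M * (+ n * z s N)
        DX≋0 : + D * X ≋ + 0 [ M * M ]
        DX≋0 = ≋-trans (≋-reflexive (lem₁ (+ D) q (S n (p ℕ.^ N)) M (+ n) (z s N)))
          (≋-trans (≋-+ (≋-*ˡ (+ 1 - q) (integral (p ℕ.^ N))) (≋-scale M value)) (≋-reflexive (lem₂ q M E)))
          where
          value : + n * + D * z s N ≋ - ((+ 1 - q) * E) [ M ]
          value = subst (λ y → + n * + D * z s N ≋ - ((+ 1 - q) * E) [ y ]) (sym M≡)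
            (zeta-approximation pr l s D E {z s} _ rational (z-IsZp s) (ζ-value s) N)
          lem₁ : ∀ d q x m n z → d * ((+ 1 - q) * x + m * (n * z)) ≡ (+ 1 - q) * (d * x) + m * (n * d * z)
          lem₁ = solve-∀
          lem₂ : ∀ q m e → (+ 1 - q) * (m * e) + m * - ((+ 1 - q) * e) ≡ + 0
          lem₂ = solve-∀
        X≋0 : X ≋ + 0 [ P ^ N₁ * P ^ suc e ]
        X≋0 = ∣⇒≋0 (Signed.∣-trans (subst (_∣ P ^ (N ℕ.+ suc e)) (ℤ.^-distribˡ-+-* P N₁ (suc e)) (^-∣ P (ℕ.n≤1+n (N₁ ℕ.+ suc e))))
          (p^-cancel-loss pr D {{D≢0}} (N ℕ.+ suc e) X
            (subst (_∣ + D * X) (trans (cong₂ _*_ M≡ M≡) level) (≋0⇒∣ DX≋0))))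
        same-modulus : P ^ N * P ^ e ≡ P ^ N₁ * P ^ suc e
        same-modulus = swap P (P ^ N₁) (P ^ e)
          where
          swap : ∀ p x y → p * x * y ≡ x * (p * y)
          swap = solve-∀
        Mz : M * (+ n * z s N) ≋ M * (+ n * z s e) [ P ^ N₁ * P ^ suc e ]
        Mz = subst (λ y → M * (+ n * z s N) ≋ M * (+ n * z s e) [ y ]) (trans (cong (_* P ^ e) M≡) same-modulus)
          (≋-scale M (≋-*ˡ (+ n) (IsZp-coherent {x = z s} (z-IsZp s) (ℕ.≤-trans (ℕ.m≤n+m e D) (ℕ.n≤1+n N₁)))))
        unscaled : (+ 1 - q) * S n p + P * (+ n * z s e) ≋ + 0 [ P ^ suc e ]
        unscaled = ≋-unscale (P ^ N₁) {{^-NonZero P N₁ {{p≢0}}}} (≋-trans (≋-reflexive (trans (lem₃ (P ^ N₁) q (S n p) P (+ n * z s e)) (cong (λ x → (+ 1 - q) * (P ^ N₁ * S n p) + x * (+ n * z s e)) (sym M≡))))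
          (≋-trans (≋-+ (≋-*ˡ (+ 1 - q) (≋-sym (subst (λ y → S n (p ℕ.^ N) ≋ P ^ N₁ * S n p [ y ]) same-modulus (S-p^ m e e≤2 h₁ h₂ N₁)))) (≋-sym Mz))
            (≋-trans X≋0 (≋-reflexive (sym (ℤ.*-zeroʳ (P ^ N₁)))))))
          where
          lem₃ : ∀ r q x p y → r * ((+ 1 - q) * x + p * y) ≡ (+ 1 - q) * (r * x) + p * r * y
          lem₃ = solve-∀

    private
      P∣M : ∀ N → P ∣ + (p ℕ.^ suc N)
      P∣M N = Signed.∣ᵤ⇒∣ (ℕ.m∣m*n (p ℕ.^ N))
      P^1 : P ^ 1 ≡ P
      P^1 = ℤ.*-identityʳ P

    -- The exponents n - 1 and n are congruent modulo p - 1 to l - 1 and l, which lie strictly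
    -- between 0 and p - 1, so both power sums vanish modulo `p`. The condition on S (n-2) is met by
    -- the factor p^(N+1) alone.
    S-zeta₁ : ∀ s → S (weight s) p ≋ - (P * (+ weight s * z s 1)) [ P ^ 2 ]
    S-zeta₁ s = S-zeta s 1 (s≤s z≤n)
      (subst (λ y → S (suc m) p ≋ + 0 [ y ]) (sym P^1) (S-vanish l′ s (ℕ.<-trans (ℕ.n<1+n _) l+1<p)))
      (λ N → subst (_∣ + (p ℕ.^ suc N) * S m (p ℕ.^ suc N)) (sym P^1) (Signed.∣m⇒∣m*n (S m (p ℕ.^ suc N)) (P∣M N)))
      (subst (λ y → P * y ∣ P ^ suc m * S (weight s) p) (sym P^1)
        (∣-*-mono (Signed.∣m⇒∣m*n (P ^ m) (Signed.∣-refl {P})) (≋0⇒∣ (S-vanish (suc l′) s l+1<p))))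
      where
      m = l′ ℕ.+ s ℕ.* (p ℕ.∸ 1)

    -- The exponent n - 2 is even and congruent to l - 2 > 0 modulo p - 1, so `p` divides S (n-2) p,
    -- and reflection gives p² for the odd exponent n - 1. For l = 2 and s > 0 the sum S (n-2) p
    -- would be -1 modulo `p`.
    S-zeta₂ : 2 ℕ.≤ l′ → ∀ s → S (weight s) p ≋ - (P * (+ weight s * z s 2)) [ P ^ 3 ]
    S-zeta₂ (s≤s (s≤s {n = l‴} _)) s = S-zeta s 2 ℕ.≤-refl
      (subst (λ y → S (suc m) p ≋ + 0 [ y ]) (cong (P *_) (sym P^1)) (S-reflection (suc l‴ ℕ.+ s ℕ.* (p ℕ.∸ 1)) m-even Sm≋0))
      (λ N → subst (λ y → P * y ∣ + (p ℕ.^ suc N) * S m (p ℕ.^ suc N)) (sym P^1)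
        (∣-*-mono (P∣M N) (subst (_∣ S m (p ℕ.^ suc N)) P^1 (≋0⇒∣ (S-p^-vanish (suc l‴ ℕ.+ s ℕ.* (p ℕ.∸ 1)) 1 (s≤s z≤n)
          (subst (λ y → S m p ≋ + 0 [ y ]) (sym P^1) Sm≋0) N)))))
      (Signed.∣m⇒∣m*n (S (weight s) p) (^-∣ P {3} {suc m} (s≤s (s≤s (s≤s z≤n)))))
      where
      m = l′ ℕ.+ s ℕ.* (p ℕ.∸ 1)
      Sm≋0 : S m p ≋ + 0 [ P ]
      Sm≋0 = S-vanish (suc l‴) s (ℕ.<-trans (ℕ.n<1+n _) (ℕ.<-trans (ℕ.n<1+n _) l+1<p))
      m-even : 2 ℕ.∣ m
      m-even = ℕ.∣m∣n⇒∣m+n (ℕ.∣m+n∣m⇒∣n l-even ℕ.∣-refl) (ℕ.∣n⇒∣m*n s p-1-even)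

-- Generalised binomial coefficients

binomℤ-0 : ∀ x → binomℤ x 0 ≡ + 1
binomℤ-0 (+ n)    = refl
binomℤ-0 -[1+ n ] = refl

binomℤ-pascal : ∀ x j → binomℤ (+ 1 + x) (suc j) ≡ binomℤ x (suc j) + binomℤ x j
binomℤ-pascal (+ n) j = trans (Cℤ-pascal n j) (ℤ.+-comm (n Cℤ j) (n Cℤ suc j))
binomℤ-pascal -[1+ zero ] j = sym (trans (cong₂ (λ x y → signPow (suc j) * + x + signPow j * + y) (nCn≡1 (suc j)) (nCn≡1 j)) (lem (signPow j)))
  where
  lem : ∀ s → - s * + 1 + s * + 1 ≡ + 0
  lem = solve-∀
binomℤ-pascal -[1+ suc m ] j = sym (begin
  - s * (suc (m ℕ.+ suc j) Cℤ suc j) + s * (suc (m ℕ.+ j) Cℤ j)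
    ≡⟨ cong₂ (λ x y → - s * x + s * (y Cℤ j)) (Cℤ-pascal (m ℕ.+ suc j) j) (sym (ℕ.+-suc m j)) ⟩
  - s * ((m ℕ.+ suc j) Cℤ j + (m ℕ.+ suc j) Cℤ suc j) + s * ((m ℕ.+ suc j) Cℤ j)
    ≡⟨ lem s ((m ℕ.+ suc j) Cℤ j) ((m ℕ.+ suc j) Cℤ suc j) ⟩
  - s * ((m ℕ.+ suc j) Cℤ suc j) ∎)
  where
  open ≡-Reasoning
  s = signPow j
  lem : ∀ s x y → - s * (x + y) + s * x ≡ - s * y
  lem = solve-∀

-- By Pascal's rule each difference lowers `j` by one, until a constant is reached and differenced
-- away.
diff-binomℤ : ∀ n j y → j ℕ.< n → diff n (λ k → binomℤ (y + + k) j) ≡ + 0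
diff-binomℤ (suc n) j y j<n+1 = trans (diff-suc n (λ k → binomℤ (y + + k) j)) (lower j j<n+1)
  where
  shift : ∀ y k → y + (+ 1 + k) ≡ + 1 + (y + k)
  shift = solve-∀
  cancel : ∀ a b → (a + b) - a ≡ b
  cancel = solve-∀
  lower : ∀ j → j ℕ.< suc n → diff n (λ k → binomℤ (y + + suc k) j - binomℤ (y + + k) j) ≡ + 0
  lower zero _ = trans (diff-cong n (λ k → cong₂ _-_ (binomℤ-0 (y + + suc k)) (binomℤ-0 (y + + k))))
    (trans (diff-*ˡ n (+ 0) (λ _ → + 0)) (ℤ.*-zeroˡ (diff n (λ _ → + 0))))
  lower (suc j) (s≤s j<n) = trans (diff-cong n (λ k → trans (cong (λ x → binomℤ x (suc j) - binomℤ (y + + k) (suc j)) (shift y (+ k)))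
      (trans (cong (_- binomℤ (y + + k) (suc j)) (binomℤ-pascal (y + + k) j)) (cancel (binomℤ (y + + k) (suc j)) (binomℤ (y + + k) j)))))
    (diff-binomℤ n j y j<n)

periodic⇒constant : ∀ {m} (h : ℤ → ℤ) → (∀ x → h (+ 1 + x) ≋ h x [ m ]) → ∀ x → h x ≋ h (+ 0) [ m ]
periodic⇒constant h step (+ zero)      = ≋-refl
periodic⇒constant h step (+ suc n)     = ≋-trans (step (+ n)) (periodic⇒constant h step (+ n))
periodic⇒constant h step -[1+ zero ]   = ≋-sym (step -[1+ 0 ])
periodic⇒constant h step -[1+ suc n ]  = ≋-trans (≋-sym (step -[1+ suc n ])) (periodic⇒constant h step -[1+ n ])

module _ {p : ℕ} (pr : Prime p) where

  private
    P = + p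
    instance
      p≢0 : ℕ.NonZero p
      p≢0 = prime⇒nonZero pr

  -- Induction on `j`. By Pascal's rule the left side for j + 1 changes under x ↦ x + 1 by `p` times
  -- the left side for `j`, so modulo p^m it does not depend on `x`. At x = 0 absorption gives (j+1)
  -- C(d, j+1) = d C(d-1, j), and p^(j+1) compensates for the division by j + 1.
  binomℤ-shift : ∀ m d → P ^ m ∣ + d → ∀ j x → P ^ j * (binomℤ (x + + d) j - binomℤ x j) ≋ + 0 [ P ^ m ]
  binomℤ-shift m d p^m∣d zero x = ≋-reflexive (cong₂ (λ a b → + 1 * (a - b)) (binomℤ-0 (x + + d)) (binomℤ-0 x))
  binomℤ-shift m d p^m∣d (suc j) x = ≋-trans (periodic⇒constant h step x) (≋-trans (≋-reflexive h0) (∣⇒≋0 (at-0 d p^m∣d)))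
    where
    h : ℤ → ℤ
    h x = P ^ suc j * (binomℤ (x + + d) (suc j) - binomℤ x (suc j))
    lem : ∀ p q a b c e → p * q * ((a + b) - (c + e)) ≡ p * q * (a - c) + p * (q * (b - e))
    lem = solve-∀
    step : ∀ x → h (+ 1 + x) ≋ h x [ P ^ m ]
    step x = ≋-shift (≋-reflexive (trans
      (cong₂ (λ a b → P ^ suc j * (a - b)) (trans (cong (λ y → binomℤ y (suc j)) (ℤ.+-assoc (+ 1) x (+ d))) (binomℤ-pascal (x + + d) j)) (binomℤ-pascal x j))
      (lem P (P ^ j) (binomℤ (x + + d) (suc j)) (binomℤ (x + + d) j) (binomℤ x (suc j)) (binomℤ x j))))
      (≋0-*ˡ P (binomℤ-shift m d p^m∣d j x))
    h0 : h (+ 0) ≡ P ^ suc j * (d Cℤ suc j)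
    h0 = cong (λ x → P ^ suc j * x) (ℤ.+-identityʳ (d Cℤ suc j))
    at-0 : ∀ d → P ^ m ∣ + d → P ^ m ∣ P ^ suc j * (d Cℤ suc j)
    at-0 zero    _ = divides (+ 0) (ℤ.*-zeroʳ (P ^ suc j))
    at-0 (suc d) h = p^-absorb pr (suc j) m (suc d Cℤ suc j) (subst (P ^ m ∣_) absorb (Signed.∣m⇒∣m*n (d Cℤ j) h))
      where
      absorb : + suc d * (d Cℤ j) ≡ + suc j * (suc d Cℤ suc j)
      absorb = trans (sym (ℤ.pos-* (suc d) (d C j))) (trans (cong +_ (sym (C-absorb d j))) (ℤ.pos-* (suc j) (suc d C suc j)))

  binomℤ-≋⁺ : ∀ m j n {x y} → x ≡ y + + n * P ^ m → P ^ j * binomℤ x j ≋ P ^ j * binomℤ y j [ P ^ m ]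
  binomℤ-≋⁺ m j n {x} {y} refl = subst (λ d → P ^ j * binomℤ (y + d) j ≋ P ^ j * binomℤ y j [ P ^ m ]) d≡
    (-≋0⇒≋ (≋-trans (≋-reflexive (lem (P ^ j) (binomℤ (y + + (n ℕ.* p ℕ.^ m)) j) (binomℤ y j)))
      (binomℤ-shift m (n ℕ.* p ℕ.^ m) (divides (+ n) d≡) j y)))
    where
    d≡ : + (n ℕ.* p ℕ.^ m) ≡ + n * P ^ m
    d≡ = trans (ℤ.pos-* n (p ℕ.^ m)) (cong (λ x → + n * x) (pos-^ p m))
    lem : ∀ p a b → p * a - p * b ≡ p * (a - b)
    lem = solve-∀

  binomℤ-≋ : ∀ m j {x y} → x ≋ y [ P ^ m ] → P ^ j * binomℤ x j ≋ P ^ j * binomℤ y j [ P ^ m ]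
  binomℤ-≋ m j {x} {y} (by (+ n) eq)     = binomℤ-≋⁺ m j n {x} {y} eq
  binomℤ-≋ m j {x} {y} (by -[1+ n ] eq) = ≋-sym (binomℤ-≋⁺ m j (suc n) {y} {x}
    (trans (lem y (+ suc n) (P ^ m)) (cong (_+ + suc n * P ^ m) (sym eq))))
    where
    lem : ∀ y n q → y ≡ (y + (- n) * q) + n * q
    lem = solve-∀

-- The function T

divℕ-exact : ∀ {p m} .{{_ : ℕ.NonZero p}} → p ℕ.∣ m → + m ≡ + p * + divℕ m p
divℕ-exact {suc d} {m} p∣m = trans (cong +_ (sym (ℕ.m*[n/m]≡n p∣m))) (ℤ.pos-* (suc d) (m ℕ./ suc d))

module TFunction {p : ℕ} (pr : Prime p) (l : ℕ) where

  private
    P = + p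
    instance
      p≢0 : ℕ.NonZero p
      p≢0 = prime⇒nonZero pr

  u q α : ℕ → ℤ
  u i = uPow p (suc i)
  q i = fermatQ p (suc i)
  α i = + (suc i ℕ.^ l)

  u-1 : ∀ i → i ℕ.< p ℕ.∸ 1 → u i - + 1 ≡ P * q i
  u-1 i i<p-1 = trans u-1≡ (divℕ-exact (Signed.∣⇒∣ᵤ (subst (P ∣_) u-1≡ (subst (λ x → P ∣ x - + 1) (sym (pos-^ (suc i) (p ℕ.∸ 1)))
    (≋⇒∣ (fermat-unit pr (suc i) (<p⇒∤ pr (s≤s z≤n) i+1<p)))))))
    where
    i+1<p : suc i ℕ.< p
    i+1<p = ℕ.≤-trans (s≤s i<p-1) (ℕ.≤-reflexive (ℕ.suc-pred p))
    u-1≡ : u i - + 1 ≡ + (suc i ℕ.^ (p ℕ.∸ 1) ℕ.∸ 1)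
    u-1≡ = trans (ℤ.m-n≡m⊖n (suc i ℕ.^ (p ℕ.∸ 1)) 1) (ℤ.⊖-≥ (ℕ.m^n>0 (suc i) (p ℕ.∸ 1)))

  [u-1]^ : ∀ i → i ℕ.< p ℕ.∸ 1 → ∀ j x → (u i - + 1) ^ j * x ≡ q i ^ j * (P ^ j * x)
  [u-1]^ i i<p-1 j x = trans (cong (λ y → y ^ j * x) (u-1 i i<p-1))
    (trans (cong (_* x) (^-distribʳ-* P (q i) j)) (lem (P ^ j) (q i ^ j) x))
    where
    lem : ∀ a b x → a * b * x ≡ b * (a * x)
    lem = solve-∀

  [u-1]^≋0 : ∀ i → i ℕ.< p ℕ.∸ 1 → ∀ j x → (u i - + 1) ^ j * x ≋ + 0 [ P ^ j ]
  [u-1]^≋0 i i<p-1 j x = ≋-trans (≋-reflexive ([u-1]^ i i<p-1 j x))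
    (≋0-*ˡ (q i ^ j) (∣⇒≋0 (Signed.∣m⇒∣m*n x (Signed.∣-refl {P ^ j}))))

  -- The argument `x` varies with `j` because `binomZp` reads `s` at level k + j.
  series : ℕ → ℕ → (ℕ → ℤ) → ℤ
  series i k x = Σ< (suc k) (λ j → (u i - + 1) ^ j * binomℤ (x j) j)

  T-series : ∀ s k → T p l s k ≡ Σ< (p ℕ.∸ 1) (λ i → α i * q i * series i k (λ j → s (k ℕ.+ j)))
  T-series s k = trans (sumℤ-upTo (p ℕ.∸ 1) (λ i → α i * q i * powZp (u i) s k))
    (Σ-cong (p ℕ.∸ 1) (λ i → cong (λ x → α i * q i * x) (sumℤ-upTo (suc k) (λ j → (u i - + 1) ^ j * binomZp s j k))))

  -- As u - 1 = p q, the j-th term carries the p^j with which `binomℤ-≋` turns congruent arguments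
  -- into congruent values without loss.
  series-≋ : ∀ i → i ℕ.< p ℕ.∸ 1 → ∀ k {x y : ℕ → ℤ} → (∀ j → x j ≋ y j [ P ^ k ]) → series i k x ≋ series i k y [ P ^ k ]
  series-≋ i i<p-1 k {x} {y} h = Σ-≋ (suc k) {λ j → (u i - + 1) ^ j * binomℤ (x j) j} {λ j → (u i - + 1) ^ j * binomℤ (y j) j} (λ j _ →
    ≋-trans (≋-reflexive ([u-1]^ i i<p-1 j (binomℤ (x j) j)))
      (≋-trans (≋-*ˡ (q i ^ j) (binomℤ-≋ pr k j (h j))) (≋-reflexive (sym ([u-1]^ i i<p-1 j (binomℤ (y j) j))))))

  series-suc : ∀ i → i ℕ.< p ℕ.∸ 1 → ∀ k x → series i (suc k) x ≋ series i k x [ P ^ k ]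
  series-suc i i<p-1 k x = ≋-shift (≋-reflexive (Σ-last (suc k) (λ j → (u i - + 1) ^ j * binomℤ (x j) j)))
    (≋-∣ (^-∣ P (ℕ.n≤1+n k)) ([u-1]^≋0 i i<p-1 (suc k) (binomℤ (x (suc k)) (suc k))))

  T-terms : ∀ {m s t k k′} → (∀ i → i ℕ.< p ℕ.∸ 1 → series i k (λ j → s (k ℕ.+ j)) ≋ series i k′ (λ j → t (k′ ℕ.+ j)) [ m ]) →
    T p l s k ≋ T p l t k′ [ m ]
  T-terms {m} {s} {t} {k} {k′} h = ≋-trans (≋-reflexive (T-series s k)) (≋-trans
    (Σ-≋ (p ℕ.∸ 1) {λ i → α i * q i * series i k (λ j → s (k ℕ.+ j))} {λ i → α i * q i * series i k′ (λ j → t (k′ ℕ.+ j))} (λ i i<p-1 → ≋-*ˡ (α i * q i) (h i i<p-1)))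
    (≋-reflexive (sym (T-series t k′))))

  T-IsZpFun : IsZpFun p (T p l)
  T-IsZpFun = (λ s zs k → ∣ᵤ-p^ {p} {k} (≋⇒∣ (coherent s zs k))) ,
    λ s t zs zt s≈t k → ≋⇒CongMod {p} {k} {T p l s} {T p l t} (T-terms {s = s} {t} {k} {k} (λ i i<p-1 → series-≋ i i<p-1 k {λ j → s (k ℕ.+ j)} {λ j → t (k ℕ.+ j)}
      (λ j → ≋-∣ (^-∣ P (ℕ.m≤m+n k j)) (CongMod⇒≋ {p} {k ℕ.+ j} {s} {t} (s≈t (k ℕ.+ j))))))
    where
    coherent : ∀ s → IsZp p s → ∀ k → T p l s (suc k) ≋ T p l s k [ P ^ k ]
    coherent s zs k = T-terms {s = s} {s} {suc k} {k} (λ i i<p-1 → ≋-trans (series-suc i i<p-1 k (λ j → s (suc k ℕ.+ j)))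
      (series-≋ i i<p-1 k {λ j → s (suc k ℕ.+ j)} {λ j → s (k ℕ.+ j)} (λ j → ≋-∣ (^-∣ P (ℕ.m≤m+n k j)) (∣⇒≋ (p^-∣ᵤ {p} {k ℕ.+ j} (zs (k ℕ.+ j)))))))

  -- At level `n` the series stops at j = n. The n-th difference annihilates the binomial
  -- coefficients with j < n, and the term j = n is divisible by (u-1)^n, hence by p^n.
  T-differences : ∀ s n → diff n (λ k → T p l (s +Z ιℕ k) n) ≋ + 0 [ P ^ n ]
  T-differences s n = begin
    diff n (λ k → T p l (s +Z ιℕ k) n)
      ≡⟨ diff-cong n (λ k → T-series (s +Z ιℕ k) n) ⟩
    diff n (λ k → Σ< (p ℕ.∸ 1) (λ i → α i * q i * series i n (λ j → s (n ℕ.+ j) + + k)))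
      ≡⟨ trans (diff-Σ n (p ℕ.∸ 1) (λ i k → α i * q i * series i n (λ j → s (n ℕ.+ j) + + k)))
           (Σ-cong (p ℕ.∸ 1) (λ i → trans (diff-*ˡ n (α i * q i) (λ k → series i n (λ j → s (n ℕ.+ j) + + k)))
             (cong (λ x → α i * q i * x) (trans (diff-Σ n (suc n) (λ j k → (u i - + 1) ^ j * binomℤ (s (n ℕ.+ j) + + k) j))
               (Σ-cong (suc n) (λ j → diff-*ˡ n ((u i - + 1) ^ j) (λ k → binomℤ (s (n ℕ.+ j) + + k) j))))))) ⟩
    Σ< (p ℕ.∸ 1) (λ i → α i * q i * Σ< (suc n) (λ j → (u i - + 1) ^ j * diff n (λ k → binomℤ (s (n ℕ.+ j) + + k) j)))
      ≈⟨ Σ-≋0 (p ℕ.∸ 1) {λ i → α i * q i * Σ< (suc n) (λ j → (u i - + 1) ^ j * diff n (λ k → binomℤ (s (n ℕ.+ j) + + k) j))}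
           (λ i i<p-1 → ≋0-*ˡ (α i * q i) (Σ-≋0 (suc n) {λ j → (u i - + 1) ^ j * diff n (λ k → binomℤ (s (n ℕ.+ j) + + k) j)} (λ j j<n+1 → term i i<p-1 j (ℕ.m≤n⇒m<n∨m≡n (ℕ.≤-pred j<n+1))))) ⟩
    + 0 ∎
    where
    open ≋-Reasoning (P ^ n)
    term : ∀ i → i ℕ.< p ℕ.∸ 1 → ∀ j → j ℕ.< n ⊎ j ≡ n → (u i - + 1) ^ j * diff n (λ k → binomℤ (s (n ℕ.+ j) + + k) j) ≋ + 0 [ P ^ n ]
    term i i<p-1 j (inj₁ j<n) = ≋-reflexive (trans (cong (λ x → (u i - + 1) ^ j * x) (diff-binomℤ n j (s (n ℕ.+ j)) j<n)) (ℤ.*-zeroʳ ((u i - + 1) ^ j)))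
    term i i<p-1 j (inj₂ refl) = [u-1]^≋0 i i<p-1 n (diff n (λ k → binomℤ (s (n ℕ.+ n) + + k) n))

  T-InK : InK p (T p l)
  T-InK = T-IsZpFun , λ s zs n → ≋⇒CongMod {p} {n} {Δ^ n (T p l) s} {ι (+ 0)}
    (≋-trans (≋-reflexive (Δ^≡diff n (T p l) s n)) (T-differences s n))

  T-constant : ∀ s t → T p l s 1 ≋ T p l t 1 [ P ^ 1 ]
  T-constant s t = T-terms {s = s} {t} {1} {1} (λ i i<p-1 → ≋-trans (leading i i<p-1 (λ j → s (1 ℕ.+ j))) (≋-sym (leading i i<p-1 (λ j → t (1 ℕ.+ j)))))
    where
    leading : ∀ i → i ℕ.< p ℕ.∸ 1 → ∀ x → series i 1 x ≋ + 1 [ P ^ 1 ]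
    leading i i<p-1 x = ≋-trans (≋-+ (≋-reflexive (trans (ℤ.*-identityˡ (binomℤ (x 0) 0)) (binomℤ-0 (x 0))))
      (≋-trans (≋-reflexive (ℤ.+-identityʳ _)) ([u-1]^≋0 i i<p-1 1 (binomℤ (x 1) 1)))) (≋-reflexive (ℤ.+-identityʳ (+ 1)))

  T-0 : ∀ k → T p l (ιℕ 0) k ≡ Σ< (p ℕ.∸ 1) (λ i → α i * q i * u i ^ 0)
  T-0 k = trans (T-series (ιℕ 0) k) (Σ-cong (p ℕ.∸ 1) (λ i → cong (λ x → α i * q i * x)
    (cong (λ x → + 1 * + 1 + x) (trans (Σ-cong k (λ j → ℤ.*-zeroʳ ((u i - + 1) ^ suc j))) (Σ-0 k)))))

  T-1 : T p l (ιℕ 1) 2 ≡ Σ< (p ℕ.∸ 1) (λ i → α i * q i * u i ^ 1)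
  T-1 = trans (T-series (ιℕ 1) 2) (Σ-cong (p ℕ.∸ 1) (λ i → cong (λ x → α i * q i * x) (lem (u i))))
    where
    lem : ∀ u → + 1 * + 1 + ((u - + 1) * + 1 * + 1 + ((u - + 1) * ((u - + 1) * + 1) * + 0 + + 0)) ≡ u * + 1
    lem = solve-∀

  T-power-sum : 0 ℕ.< l → ∀ s → P * Σ< (p ℕ.∸ 1) (λ i → α i * q i * u i ^ s) ≡
    S (l ℕ.+ suc s ℕ.* (p ℕ.∸ 1)) p - S (l ℕ.+ s ℕ.* (p ℕ.∸ 1)) p
  T-power-sum 0<l s = begin
    P * Σ< (p ℕ.∸ 1) (λ i → α i * q i * u i ^ s)
      ≡⟨ Σ-*ˡ (p ℕ.∸ 1) P (λ i → α i * q i * u i ^ s) ⟨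
    Σ< (p ℕ.∸ 1) (λ i → P * (α i * q i * u i ^ s))
      ≡⟨ Σ-cong< (p ℕ.∸ 1) term ⟩
    Σ< (p ℕ.∸ 1) (λ i → (+ suc i) ^ (l ℕ.+ suc s ℕ.* (p ℕ.∸ 1)) - (+ suc i) ^ (l ℕ.+ s ℕ.* (p ℕ.∸ 1)))
      ≡⟨ Σ-- (p ℕ.∸ 1) (λ i → (+ suc i) ^ (l ℕ.+ suc s ℕ.* (p ℕ.∸ 1))) (λ i → (+ suc i) ^ (l ℕ.+ s ℕ.* (p ℕ.∸ 1))) ⟩
    Σ< (p ℕ.∸ 1) (λ i → (+ suc i) ^ (l ℕ.+ suc s ℕ.* (p ℕ.∸ 1))) - Σ< (p ℕ.∸ 1) (λ i → (+ suc i) ^ (l ℕ.+ s ℕ.* (p ℕ.∸ 1)))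
      ≡⟨ cong₂ _-_ (S-positive _ (ℕ.<-≤-trans 0<l (ℕ.m≤m+n l (suc s ℕ.* (p ℕ.∸ 1))))) (S-positive _ (ℕ.<-≤-trans 0<l (ℕ.m≤m+n l (s ℕ.* (p ℕ.∸ 1))))) ⟩
    S (l ℕ.+ suc s ℕ.* (p ℕ.∸ 1)) p - S (l ℕ.+ s ℕ.* (p ℕ.∸ 1)) p ∎
    where
    open ≡-Reasoning
    -- `S` also contains the index 0, which contributes nothing because the exponent is positive.
    S-positive : ∀ n → 0 ℕ.< n → Σ< (p ℕ.∸ 1) (λ i → (+ suc i) ^ n) ≡ S n p
    S-positive (suc n) _ = aux (ℕ.pred p) (ℕ.suc-pred p)
      where
      aux : ∀ r → suc r ≡ p → Σ< (p ℕ.∸ 1) (λ i → (+ suc i) ^ suc n) ≡ S (suc n) p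
      aux r r+1≡p = subst (λ m → Σ< (m ℕ.∸ 1) (λ i → (+ suc i) ^ suc n) ≡ S (suc n) m) r+1≡p
        (sym (ℤ.+-identityˡ (Σ< r (λ i → (+ suc i) ^ suc n))))
    power : ∀ i t → (+ suc i) ^ (l ℕ.+ t ℕ.* (p ℕ.∸ 1)) ≡ α i * u i ^ t
    power i t = trans (ℤ.^-distribˡ-+-* (+ suc i) l (t ℕ.* (p ℕ.∸ 1)))
      (cong₂ _*_ (sym (pos-^ (suc i) l)) (trans (cong ((+ suc i) ^_) (ℕ.*-comm t (p ℕ.∸ 1)))
        (trans (sym (ℤ.^-*-assoc (+ suc i) (p ℕ.∸ 1) t)) (cong (_^ t) (sym (pos-^ (suc i) (p ℕ.∸ 1)))))))
    lem₁ : ∀ p a q x → p * (a * q * x) ≡ a * (p * q) * x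
    lem₁ = solve-∀
    lem₂ : ∀ a u x → a * (u - + 1) * x ≡ a * (u * x) - a * x
    lem₂ = solve-∀
    term : ∀ i → i ℕ.< p ℕ.∸ 1 → P * (α i * q i * u i ^ s) ≡ (+ suc i) ^ (l ℕ.+ suc s ℕ.* (p ℕ.∸ 1)) - (+ suc i) ^ (l ℕ.+ s ℕ.* (p ℕ.∸ 1))
    term i i<p-1 = trans (lem₁ P (α i) (q i) (u i ^ s)) (trans (cong (λ x → α i * x * u i ^ s) (sym (u-1 i i<p-1)))
      (trans (lem₂ (α i) (u i) (u i ^ s)) (sym (cong₂ _-_ (power i (suc s)) (power i s)))))

Δ¹ : ∀ f → Δ^ 1 f (ιℕ 0) 2 ≡ f (ιℕ 1) 2 - f (ιℕ 0) 2
Δ¹ f = trans (Δ^≡diff 1 f (ιℕ 0) 2) (trans (diff-suc 0 (λ k → f (ιℕ k) 2)) (diff-0 (λ k → f (ιℕ (suc k)) 2 - f (ιℕ k) 2)))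

modℤ<p : ∀ p .{{_ : ℕ.NonZero p}} x → modℤ x p ℕ.< p
modℤ<p (suc d) x = ℤ.n%ℕd<d x (suc d)

modℤ-≋ : ∀ p .{{_ : ℕ.NonZero p}} x → + modℤ x p ≋ x [ + p ]
modℤ-≋ (suc d) x = ≋-sym (by (x ℤ./ℕ suc d) (ℤ.a≡a%ℕn+[a/ℕn]*n x (suc d)))

divℤ-exact : ∀ p .{{_ : ℕ.NonZero p}} {x} → + p ∣ x → + p * divℤ x p ≡ x
divℤ-exact p@(suc d) {x} p∣x = sym (trans (ℤ.a≡a%ℕn+[a/ℕn]*n x p) (trans (cong (λ r → + r + (x ℤ./ℕ p) * + p) r≡0)
  (trans (ℤ.+-identityˡ ((x ℤ./ℕ p) * + p)) (ℤ.*-comm (x ℤ./ℕ p) (+ p)))))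
  where
  r = x ℤ.%ℕ p
  p∣r : + p ∣ + r
  p∣r = ≋0⇒∣ (≋-trans (modℤ-≋ p x) (∣⇒≋0 p∣x))
  r≡0 : r ≡ 0
  r≡0 with r | ℤ.n%ℕd<d x p | Signed.∣⇒∣ᵤ p∣r
  ... | zero  | _   | _ = refl
  ... | suc _ | r<p | d = contradiction d (ℕ.>⇒∤ r<p)

-- Comparison of T with ζ

module Comparison {p : ℕ} (pr : Prime p) (3<p : 3 ℕ.< p) (l′ : ℕ) (l+1<p : suc (suc (suc l′)) ℕ.< p) (l-even : 2 ℕ.∣ suc (suc l′))
  (ζ : Seq → Seq) (ζ-fun : IsZpFun p ζ) (ζ-continuous : IsContinuous p ζ)
  (ζ-value : ∀ s → EqRat p (ζ (ιℕ s)) (zetaValue p (suc (suc l′)) s)) where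

  open Kummer pr l′ ζ ζ-fun ζ-value using (l; weight; z; z-IsZp; kummer)
  open Interpolation pr l′ ζ ζ-fun ζ-value ζ-continuous using (ζ-InK; z-step; ζ-constant)
  open OddPrime pr 3<p using (S-zeta₁; S-zeta₂)
  open TFunction pr l using (T-InK; T-constant; T-0; T-1; T-power-sum; α; q; u)

  private
    P = + p
    instance
      p≢0 : ℕ.NonZero p
      p≢0 = prime⇒nonZero pr

  P^1 : P ^ 1 ≡ P
  P^1 = ℤ.*-identityʳ P

  moment : ℕ → ℤ
  moment s = Σ< (p ℕ.∸ 1) (λ i → α i * q i * u i ^ s)

  n : ℕ → ℤ
  n s = + weight s

  n-suc : ∀ s → n (suc s) ≡ n s + (P - + 1)
  n-suc s = trans (cong +_ (trans (cong (l ℕ.+_) (ℕ.+-comm (p ℕ.∸ 1) (s ℕ.* (p ℕ.∸ 1)))) (sym (ℕ.+-assoc l (s ℕ.* (p ℕ.∸ 1)) (p ℕ.∸ 1)))))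
    (cong (λ x → n s + x) (trans (sym (ℤ.⊖-≥ (ℕ.>-nonZero⁻¹ p))) (sym (ℤ.m-n≡m⊖n p 1))))

  moment-zeta : ∀ e → (∀ s → S (weight s) p ≋ - (P * (n s * z s e)) [ P ^ suc e ]) →
    ∀ s → moment s ≋ n s * z s e - n (suc s) * z (suc s) e [ P ^ e ]
  moment-zeta e S-zeta s = ≋-unscale P (begin
    P * moment s                                                        ≡⟨ T-power-sum (s≤s z≤n) s ⟩
    S (weight (suc s)) p - S (weight s) p                               ≈⟨ ≋-- (S-zeta (suc s)) (S-zeta s) ⟩
    - (P * (n (suc s) * z (suc s) e)) - - (P * (n s * z s e))           ≡⟨ lem P (n (suc s) * z (suc s) e) (n s * z s e) ⟩
    P * (n s * z s e - n (suc s) * z (suc s) e)                         ∎)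
    where
    open ≋-Reasoning (P ^ suc e)
    lem : ∀ p x y → - (p * x) - - (p * y) ≡ p * (y - x)
    lem = solve-∀

  -- Since `z 1` and `z 0` agree modulo `p`, the moment collapses to (n 0 - n 1) z 0 = (1 - p) z 0.
  T≋ζ-at-0 : T p l (ιℕ 0) 1 ≋ z 0 1 [ P ^ 1 ]
  T≋ζ-at-0 = begin
    T p l (ιℕ 0) 1                            ≡⟨ T-0 1 ⟩
    moment 0                                  ≈⟨ moment-zeta 1 (S-zeta₁ l′ l+1<p l-even ζ ζ-fun ζ-value) 0 ⟩
    n 0 * z 0 1 - n 1 * z 1 1                 ≈⟨ ≋-- (≋-refl {n 0 * z 0 1}) (≋-*ˡ (n 1) (z-step l+1<p 0)) ⟩
    n 0 * z 0 1 - n 1 * z 0 1                 ≡⟨ trans (cong (λ m → n 0 * z 0 1 - m * z 0 1) (n-suc 0)) (lem (n 0) P (z 0 1)) ⟩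
    z 0 1 + - z 0 1 * P                       ≈⟨ ≋-shift ≋-refl (∣⇒≋0 (divides (- z 0 1) (cong (λ x → - z 0 1 * x) (sym P^1)))) ⟩
    z 0 1                                     ∎
    where
    open ≋-Reasoning (P ^ 1)
    lem : ∀ n p z → n * z - (n + (p - + 1)) * z ≡ z + - z * p
    lem = solve-∀

  T≋ζ : ∀ s → IsZp p s → CongMod p 1 (T p l s) (ζ s)
  T≋ζ s zs = ≋⇒CongMod {p} {1} {T p l s} {ζ s}
    (≋-trans (T-constant s (ιℕ 0)) (≋-trans T≋ζ-at-0 (≋-sym (ζ-constant l+1<p s zs))))

  δT δζ : ℤ
  δT = T p l (ιℕ 1) 2 - T p l (ιℕ 0) 2
  δζ = z 1 2 - z 0 2

  z-close : ∀ s → P ∣ z (suc s) 2 - z s 2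
  z-close s = subst (_∣ z (suc s) 2 - z s 2) P^1 (≋⇒∣ (≋-trans (IsZp-coherent {x = z (suc s)} (z-IsZp (suc s)) (s≤s z≤n))
    (≋-trans (z-step l+1<p s) (≋-sym (IsZp-coherent {x = z s} (z-IsZp s) (s≤s z≤n))))))

  -- T(1) - T(0) is -n₀ Δ²ζ - 2 (p - 1) (ζ(2) - ζ(1)) modulo p².
  δT≋2δζ : 2 ℕ.≤ l′ → δT ≋ + 2 * δζ [ P * P ]
  δT≋2δζ 2≤l′ = subst (λ m → δT ≋ + 2 * δζ [ m ]) (cong (P *_) P^1) (begin
    δT                                                                 ≡⟨ cong₂ _-_ T-1 (T-0 2) ⟩
    moment 1 - moment 0                                                ≈⟨ ≋-- (m≋ 1) (m≋ 0) ⟩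
    (n 1 * z₁ - n 2 * z₂) - (n 0 * z₀ - n 1 * z₁)                      ≡⟨ cong₂ (λ x y → (x * z₁ - y * z₂) - (n 0 * z₀ - x * z₁)) (n-suc 0) (trans (n-suc 1) (cong (_+ (P - + 1)) (n-suc 0))) ⟩
    ((n 0 + d) * z₁ - (n 0 + d + d) * z₂) - (n 0 * z₀ - (n 0 + d) * z₁) ≡⟨ lem (n 0) P z₀ z₁ z₂ ⟩
    -- Replacing ζ(2) - ζ(1) by ζ(1) - ζ(0) costs two more second differences, which turns the
    -- coefficient -n₀ into 2 - n₀; the part of 2(p-1) containing `p` meets a first difference
    -- divisible by `p`.
    + 2 * δζ + ((+ 2 - n 0) * second + - + 2 * (P * (z₂ - z₁)))        ≈⟨ ≋-shift ≋-refl (≋-+ (≋0-*ˡ (+ 2 - n 0) second≋0) (≋0-*ˡ (- + 2) (∣⇒≋0 P²∣))) ⟩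
    + 2 * δζ                                                           ∎)
    where
    open ≋-Reasoning (P ^ 2)
    z₀ = z 0 2
    z₁ = z 1 2
    z₂ = z 2 2
    d = P - + 1
    m≋ : ∀ s → moment s ≋ n s * z s 2 - n (suc s) * z (suc s) 2 [ P ^ 2 ]
    m≋ = moment-zeta 2 (S-zeta₂ l′ l+1<p l-even ζ ζ-fun ζ-value 2≤l′)
    second = (z₂ - z₁) - (z₁ - z₀)
    second≋0 : second ≋ + 0 [ P ^ 2 ]
    second≋0 = ≋-trans (≋-reflexive (sym (trans (diff-suc 1 (λ k → z k 2)) (trans (diff-suc 0 (λ k → z (suc k) 2 - z k 2)) (diff-0 (λ k → (z (suc (suc k)) 2 - z (suc k) 2) - (z (suc k) 2 - z k 2)))))))
      (kummer l+1<p 2 0)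
    P²∣ : P ^ 2 ∣ P * (z₂ - z₁)
    P²∣ = subst (λ x → P * x ∣ P * (z₂ - z₁)) (sym P^1) (Signed.*-monoʳ-∣ P (z-close 1))
    lem : ∀ n p z₀ z₁ z₂ → ((n + (p - + 1)) * z₁ - (n + (p - + 1) + (p - + 1)) * z₂) - (n * z₀ - (n + (p - + 1)) * z₁)
        ≡ + 2 * (z₁ - z₀) + ((+ 2 - n) * ((z₂ - z₁) - (z₁ - z₀)) + - + 2 * (p * (z₂ - z₁)))
    lem = solve-∀

  -- `Δdigit` divides a representative as an integer. The division is exact when `p` divides the
  -- difference, so congruent differences modulo p² have congruent digits modulo `p`.
  digit : ∀ f x → Δ^ 1 f (ιℕ 0) 2 ≡ x → P ∣ x → ∃ λ y → P * y ≡ x × + Δdigit p f ≋ y [ P ]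
  digit f x refl p∣x = divℤ (Δ^ 1 f (ιℕ 0) 2) p , divℤ-exact p p∣x , modℤ-≋ p (divℤ (Δ^ 1 f (ιℕ 0) 2) p)

  digits : 2 ℕ.≤ l′ → + Δdigit p (T p l) ≋ + 2 * + Δdigit p ζ [ P ]
  digits 2≤l′ = combine (digit ζ δζ (Δ¹ ζ) (z-close 0)) (digit (T p l) δT (Δ¹ (T p l)) P∣δT)
    where
    P∣δT : P ∣ δT
    P∣δT = ≋0⇒∣ (≋-trans (≋-∣ (divides P refl) (δT≋2δζ 2≤l′)) (≋0-*ˡ (+ 2) (∣⇒≋0 (z-close 0))))
    combine : (∃ λ y → P * y ≡ δζ × + Δdigit p ζ ≋ y [ P ]) → (∃ λ y → P * y ≡ δT × + Δdigit p (T p l) ≋ y [ P ]) →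
      + Δdigit p (T p l) ≋ + 2 * + Δdigit p ζ [ P ]
    combine (y , Py≡ , y≋) (x , Px≡ , x≋) = ≋-trans x≋ (≋-trans (≋-unscale P (subst₂ (λ v w → v ≋ w [ P * P ]) (sym Px≡)
      (trans (cong (λ w → + 2 * w) (sym Py≡)) (swap P y)) (δT≋2δζ 2≤l′))) (≋-*ˡ (+ 2) (≋-sym y≋)))
      where
      swap : ∀ p y → + 2 * (p * y) ≡ p * (+ 2 * y)
      swap = solve-∀

  zero-digit : ∀ f → P ∣ + Δdigit p f → Δdigit p f ≡ 0
  zero-digit f = small (Δdigit p f) (modℤ<p p (divℤ (Δ^ 1 f (ιℕ 0) 2) p))
    where
    small : ∀ r → r ℕ.< p → P ∣ + r → r ≡ 0
    small zero    _   _ = refl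
    small (suc r) r<p d = contradiction d (<p⇒∤ pr (s≤s z≤n) r<p)

  digit-nonzero : 2 ℕ.≤ l′ → Δdigit p (T p l) ≢ 0 ⇔ Δdigit p ζ ≢ 0
  digit-nonzero 2≤l′ = mk⇔
    (λ T≢0 ζ≡0 → T≢0 (zero-digit (T p l) (≋0⇒∣ (≋-trans (digits 2≤l′) (≋-reflexive (cong (λ r → + 2 * + r) ζ≡0))))))
    (λ ζ≢0 T≡0 → ζ≢0 (zero-digit ζ ([ (λ p∣2 → contradiction p∣2 (<p⇒∤ pr (s≤s z≤n) (ℕ.<-trans (s≤s (s≤s (s≤s z≤n))) 3<p))) , (λ d → d) ]′
      (prime-∣* pr (+ 2) (+ Δdigit p ζ) (≋0⇒∣ (≋-trans (≋-sym (digits 2≤l′)) (≋-reflexive (cong +_ T≡0))))))))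

  digit-congruence : 2 ℕ.≤ l′ → P ∣ℤ (+ Δdigit p (T p l) - + (2 ℕ.* Δdigit p ζ))
  digit-congruence 2≤l′ = Signed.∣⇒∣ᵤ (subst (λ x → P ∣ + Δdigit p (T p l) - x) (sym (ℤ.pos-* 2 (Δdigit p ζ))) (≋⇒∣ (digits 2≤l′)))

  unit⇔ : IsUnit p (T p l (ιℕ 0)) ⇔ IsUnit p (ζ (ιℕ 0))
  unit⇔ = mk⇔ (λ u d → u (transfer (≋-sym T≋ζ-at-0) d)) (λ u d → u (transfer T≋ζ-at-0 d))
    where
    transfer : ∀ {x y} → x ≋ y [ P ^ 1 ] → P ∣ℤ x → P ∣ℤ y
    transfer {x} {y} h d = Signed.∣⇒∣ᵤ (≋0⇒∣ (≋-trans (subst (λ m → y ≋ x [ m ]) P^1 (≋-sym h)) (∣⇒≋0 (Signed.∣ᵤ⇒∣ d))))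

  vanish⇔ : CongMod p 1 (T p l (ιℕ 0)) (ι (+ 0)) ⇔ CongMod p 1 (ζ (ιℕ 0)) (ι (+ 0))
  vanish⇔ = mk⇔
    (λ h → ≋⇒CongMod {p} {1} {ζ (ιℕ 0)} {ι (+ 0)} (≋-trans (≋-sym T≋ζ-at-0) (CongMod⇒≋ {p} {1} {T p l (ιℕ 0)} {ι (+ 0)} h)))
    (λ h → ≋⇒CongMod {p} {1} {T p l (ιℕ 0)} {ι (+ 0)} (≋-trans T≋ζ-at-0 (CongMod⇒≋ {p} {1} {ζ (ιℕ 0)} {ι (+ 0)} h)))

  -- For l = 2 the value 12 ζ(0) = p - 1 is a unit, because B₂ = 1/6.
  vanish⇒l≢2 : CongMod p 1 (ζ (ιℕ 0)) (ι (+ 0)) → l′ ≢ 0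
  vanish⇒l≢2 h refl = prime∤1 pr (≋0⇒∣ (begin
    + 1                                      ≡⟨ lem P ⟩
    P - - ((+ 1 - P * + 1) * + 1)            ≡⟨ cong (λ x → P - - ((+ 1 - x) * + 1)) (pos-^ p 1) ⟨
    P - - ((+ 1 - + (p ℕ.^ 1)) * + 1)        ≈⟨ ≋-- (∣⇒≋0 {P} Signed.∣-refl) 12z ⟩
    + 0 - + 0                                ≡⟨⟩
    + 0                                      ∎))
    where
    open ≋-Reasoning P
    lem : ∀ p → + 1 ≡ p - - ((+ 1 - p * + 1) * + 1)
    lem = solve-∀
    12z : - ((+ 1 - + (p ℕ.^ 1)) * + 1) ≋ + 0 [ P ]
    12z = subst (λ m → - ((+ 1 - + (p ℕ.^ 1)) * + 1) ≋ + 0 [ m ]) P^1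
      -- The pair 6, 1 stands for B₂ = 1/6, confirmed by evaluating the recursion with `refl`; the
      -- factor 12 is n D = 2 · 6.
      (≋-trans (≋-sym (zeta-approximation pr 2 0 6 (+ 1) {z 0} _ refl (z-IsZp 0) (ζ-value 0) 1))
        (≋0-*ˡ (+ 12) (CongMod⇒≋ {p} {1} {ζ (ιℕ 0)} {ι (+ 0)} h)))

  l′≢0⇒2≤l′ : l′ ≢ 0 → 2 ℕ.≤ l′
  l′≢0⇒2≤l′ l′≢0 = aux l′ l′≢0 (ℕ.∣m+n∣m⇒∣n l-even ℕ.∣-refl)
    where
    aux : ∀ m → m ≢ 0 → 2 ℕ.∣ m → 2 ℕ.≤ m
    aux zero    m≢0 _ = contradiction refl m≢0
    aux (suc m) _   d = ℕ.∣⇒≤ d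

  -- The digits are comparable only for l ≠ 2. In either direction the vanishing at 0 is transferred
  -- first; for ζ it excludes l = 2, and only then are the digits compared.
  W0⇔ : InW0 p (T p l) ⇔ InW0 p ζ
  W0⇔ = mk⇔
    (λ (_ , T0≡0 , ΔT≢0) → let ζ0≡0 = Equivalence.to vanish⇔ T0≡0 in
      ζ-InK l+1<p , ζ0≡0 , Equivalence.to (digit-nonzero (l′≢0⇒2≤l′ (vanish⇒l≢2 ζ0≡0))) ΔT≢0)
    (λ (_ , ζ0≡0 , Δζ≢0) → T-InK , Equivalence.from vanish⇔ ζ0≡0 ,
      Equivalence.from (digit-nonzero (l′≢0⇒2≤l′ (vanish⇒l≢2 ζ0≡0))) Δζ≢0)

theorem9p3 : (p l : ℕ) → Prime p → 3 < p → 2 ℕ.∣ l → 0 < l → l < p ∸ 1 →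
    (ζ : Seq → Seq) → IsZpFun p ζ → IsContinuous p ζ →
    (∀ (s : ℕ) → EqRat p (ζ (ιℕ s)) (zetaValue p l s)) →
    (∀ s → IsZp p s → CongMod p 1 (T p l s) (ζ s))
    × (l ≢ 2 → (+ p) ∣ℤ (+ Δdigit p (T p l) ℤ.- + (2 ℕ.* Δdigit p ζ)))
    × (IsUnit p (T p l (ιℕ 0)) ⇔ IsUnit p (ζ (ιℕ 0)))
    × (InW0 p (T p l) ⇔ InW0 p ζ)
theorem9p3 p (suc zero) pr 3<p 2∣1 = contradiction 2∣1 (ℕ.>⇒∤ (s≤s (s≤s z≤n)))
theorem9p3 p (suc (suc l′)) pr 3<p l-even 0<l l<p-1 ζ ζ-fun ζ-continuous ζ-value =
  T≋ζ , (λ l≢2 → digit-congruence (l′≢0⇒2≤l′ (λ l′≡0 → l≢2 (cong (λ m → suc (suc m)) l′≡0)))) , unit⇔ , W0⇔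
  where
  open Comparison pr 3<p l′ (ℕ.≤-trans (s≤s l<p-1) (ℕ.≤-reflexive (ℕ.suc-pred p {{prime⇒nonZero pr}}))) l-even ζ ζ-fun ζ-continuous ζ-value
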